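{- Fix $1 \le r \le \infty$. Let $R$ be a partially ordered commutative ring, and let $\boldsymbol{\phi} = (\phi_i)_{i \ge 0}$ be a sequence in $R$ that is Toeplitz-totally positive of order $r$. Then: (a) The lower-triangular matrix $\mathsf{L}(\boldsymbol{\phi}) = (L_{n,k}(\boldsymbol{\phi}))_{n,k \ge 0}$ is totally positive of order $r$ in the ring $R$. (b) The sequence $(L_n(\boldsymbol{\phi},y))_{n \ge 0}$ is Hankel-totally positive of order $r$ in the ring $R[y]$ equipped with the coefficientwise order. (c) The sequence $(L_{n+1,1}(\boldsymbol{\phi}))_{n \ge 0}$ is Hankel-totally positive of order $r$ in the ring $R$.
   Context: A partially ordered commutative ring is a commutative ring $R$ (with $1 \ne 0$) together with a subset $\mathcal{P}$ ("nonnegative elements") such that $0,1 \in \mathcal{P}$, $\mathcal{P}$ is closed under addition and multiplication, and $\mathcal{P} \cap (-\mathcal{P}) = \{0\}$. For indeterminates $y$, the coefficientwise order on $R[y]$ declares nonnegative the polynomials all of whose coefficients lie in $\mathcal{P}$. A (finite or infinite) matrix is totally positive of order $r$ (TP$_r$) if all its minors of size $\le r$ are nonnegative; TP$_\infty$ means all minors are nonnegative. A sequence $(a_n)_{n\ge0}$ is Hankel-TP$_r$ if the matrix $(a_{i+j})_{i,j\ge0}$ is TP$_r$, and Toeplitz-TP$_r$ if the matrix $(a_{i-j})_{i,j\ge 0}$ (with $a_n := 0$ for $n<0$) is TP$_r$. Generic Lah polynomials: an ordered tree is a rooted tree in which the children of each vertex are linearly ordered; an increasing ordered tree on a finite set of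 integers is an ordered tree whose vertices are bijectively labeled by that set so that every child has a larger label than its parent. For indeterminates $\boldsymbol{\phi}=(\phi_i)_{i\ge 0}$ and $n,k\ge 0$, $L_{n,k}(\boldsymbol{\phi}) \in \mathbb{Z}[\boldsymbol{\phi}]$ is the sum over all unordered forests of $k$ increasing ordered trees whose vertex sets partition $[n]=\{1,\dots,n\}$ of $\prod_{v} \phi_{\deg(v)}$, where $\deg(v)$ is the number of children of $v$ (so $L_{0,0}=1$, $L_{0,k}=0$ for $k\ge1$, $L_{n,0}=0$ for $n \ge 1$). Also $L_n(\boldsymbol{\phi},y) = \sum_{k=0}^n L_{n,k}(\boldsymbol{\phi})\, y^k$. For $\boldsymbol{\phi}$ with values in a ring $R$, these polynomials are evaluated by substitution. -}

module Defs where

open import Level using (Level; _⊔_) renaming (suc to lsuc)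
open import Data.Nat using (ℕ; zero; suc; _∸_; _<ᵇ_; _≡ᵇ_) renaming (_≤_ to _≤ℕ_; _<_ to _<ℕ_; _+_ to _+ℕ_)
open import Data.Nat.Properties using ()
open import Data.Bool using (Bool; true; false; if_then_else_; _∧_; not)
open import Data.Maybe using (Maybe; just; nothing)
open import Data.Fin using (Fin; toℕ; punchIn) renaming (zero to fzero; suc to fsuc)
open import Data.List using (List; []; _∷_; map; concatMap; allFin; foldr; upTo)
open import Data.List.Relation.Unary.All using (All)
open import Data.Product using (_×_)
open import Relation.Nullary using (¬_)
open import Algebra.Bundles using (CommutativeRing)
open import Algebra.Bundles.Raw using (RawRing)

record POCommRing (c ℓ : Level) : Set (lsuc (c ⊔ ℓ)) where
  field
    commRing : CommutativeRing c ℓ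
  open CommutativeRing commRing public
  field
    Pos      : Carrier → Set ℓ
    Pos-resp : ∀ {x y} → x ≈ y → Pos x → Pos y
    1≉0      : ¬ (1# ≈ 0#)
    Pos-0    : Pos 0#
    Pos-1    : Pos 1#
    Pos-+    : ∀ {x y} → Pos x → Pos y → Pos (x + y)
    Pos-*    : ∀ {x y} → Pos x → Pos y → Pos (x * y)
    Pos-anti : ∀ {x} → Pos x → Pos (- x) → x ≈ 0#

record OrderedRaw (c ℓ p : Level) : Set (lsuc (c ⊔ ℓ ⊔ p)) where
  field
    raw : RawRing c ℓ
  open RawRing raw public
  field
    Pos : Carrier → Set p

module _ {c ℓ : Level} (R : RawRing c ℓ) where
  open RawRing R

  sumFin : (m : ℕ) → (Fin m → Carrier) → Carrier
  sumFin zero    f = 0#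
  sumFin (suc m) f = f fzero + sumFin m (λ i → f (fsuc i))

  signed : ℕ → Carrier → Carrier
  signed zero    x = x
  signed (suc n) x = - (signed n x)

  det : (m : ℕ) → (Fin m → Fin m → Carrier) → Carrier
  det zero    A = 1#
  det (suc m) A =
    sumFin (suc m) (λ j →
      signed (toℕ j) (A fzero j * det m (λ i k → A (fsuc i) (punchIn j k))))

data ℕ∞ : Set where
  fin : ℕ → ℕ∞
  ∞   : ℕ∞

_≤∞_ : ℕ → ℕ∞ → Set
m ≤∞ fin r = m ≤ℕ r
m ≤∞ ∞     = Data.Unit.⊤ where import Data.Unit

StrictlyIncreasing : {m : ℕ} → (Fin m → ℕ) → Set
StrictlyIncreasing {m} f = ∀ (a b : Fin m) → toℕ a <ℕ toℕ b → f a <ℕ f b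

module _ {c ℓ p : Level} (R : OrderedRaw c ℓ p) where
  open OrderedRaw R

  minor : (M : ℕ → ℕ → Carrier) (m : ℕ) (I J : Fin m → ℕ) → Carrier
  minor M m I J = det raw m (λ a b → M (I a) (J b))

  TP : ℕ∞ → (ℕ → ℕ → Carrier) → Set p
  TP r M = ∀ (m : ℕ) → m ≤∞ r → (I J : Fin m → ℕ) →
           StrictlyIncreasing I → StrictlyIncreasing J → Pos (minor M m I J)

  HankelMatrix : (ℕ → Carrier) → ℕ → ℕ → Carrier
  HankelMatrix a i j = a (i +ℕ j)

  ToeplitzMatrix : (ℕ → Carrier) → ℕ → ℕ → Carrier
  ToeplitzMatrix a i j = if j <ᵇ suc i then a (i ∸ j) else 0#

  HankelTP : ℕ∞ → (ℕ → Carrier) → Set p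
  HankelTP r a = TP r (HankelMatrix a)

  ToeplitzTP : ℕ∞ → (ℕ → Carrier) → Set p
  ToeplitzTP r a = TP r (ToeplitzMatrix a)

asOrdered : ∀ {c ℓ} → POCommRing c ℓ → OrderedRaw c ℓ ℓ
asOrdered R = record { raw = POCommRing.rawRing R ; Pos = POCommRing.Pos R }

module Poly {c ℓ : Level} (R : POCommRing c ℓ) where
  open POCommRing R

  P : Set c
  P = List Carrier

  coeff : P → ℕ → Carrier
  coeff []      k       = 0#
  coeff (a ∷ p) zero    = a
  coeff (a ∷ p) (suc k) = coeff p k

  _+ₚ_ : P → P → P
  []      +ₚ q       = q
  (a ∷ p) +ₚ []      = a ∷ p
  (a ∷ p) +ₚ (b ∷ q) = (a + b) ∷ (p +ₚ q)

  -ₚ_ : P → P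
  -ₚ p = map -_ p

  _*ₚ_ : P → P → P
  []      *ₚ q = []
  (a ∷ p) *ₚ q = map (a *_) q +ₚ (0# ∷ (p *ₚ q))

  _≈ₚ_ : P → P → Set ℓ
  p ≈ₚ q = ∀ k → coeff p k ≈ coeff q k

  rawPoly : RawRing c ℓ
  rawPoly = record
    { Carrier = P ; _≈_ = _≈ₚ_ ; _+_ = _+ₚ_ ; _*_ = _*ₚ_ ; -_ = -ₚ_
    ; 0# = [] ; 1# = 1# ∷ [] }

  PolyOrdered : OrderedRaw c ℓ (c ⊔ ℓ)
  PolyOrdered = record { raw = rawPoly ; Pos = All Pos }

-- Generic Lah polynomials.
--
-- An increasing ordered forest on [n] (vertex i+1 encoded as i : Fin n)
-- is encoded by
--   par : Fin n → Maybe (Fin n)   (parent of v, or nothing if v is a root)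
--   pos : Fin n → Fin n           (position of v among its siblings)
-- subject to: parents have smaller labels; roots have position 0 (the
-- forest is an unordered collection of trees); the positions of the
-- children of u are pairwise distinct and < deg u, i.e. they form a
-- linear order of the children of u.  Distinct valid (par,pos) pairs
-- correspond bijectively to increasing ordered forests on [n].

allFuns : ∀ {a} {A : Set a} (n : ℕ) → List A → List (Fin n → A)
allFuns zero    xs = (λ ()) ∷ []
allFuns (suc n) xs =
  concatMap (λ x → map (λ f → λ { fzero → x ; (fsuc i) → f i }) (allFuns n xs)) xs

allB : ∀ {a} {A : Set a} → (A → Bool) → List A → Bool
allB p []       = true
allB p (x ∷ xs) = p x ∧ allB p xs

countB : ∀ {a} {A : Set a} → (A → Bool) → List A → ℕ
countB p []       = 0
countB p (x ∷ xs) = if p x then suc (countB p xs) else countB p xs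

module Lah {c ℓ : Level} (R : CommutativeRing c ℓ) (φ : ℕ → CommutativeRing.Carrier R) where
  open CommutativeRing R

  module Forest (n : ℕ) (par : Fin n → Maybe (Fin n)) (pos : Fin n → Fin n) where
    isChild : Fin n → Fin n → Bool
    isChild u v with par v
    ... | nothing = false
    ... | just w  = toℕ w ≡ᵇ toℕ u

    isRoot : Fin n → Bool
    isRoot v with par v
    ... | nothing = true
    ... | just _  = false

    deg : Fin n → ℕ
    deg u = countB (isChild u) (allFin n)

    roots : ℕ
    roots = countB isRoot (allFin n)

    vertexOK : Fin n → Bool
    vertexOK v with par v
    ... | nothing = toℕ (pos v) ≡ᵇ 0
    ... | just u  = (toℕ u <ᵇ toℕ v) ∧ (toℕ (pos v) <ᵇ deg u)

    pairOK : Fin n → Fin n → Bool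
    pairOK v w with par v | par w
    ... | just u | just u' =
          if (toℕ u ≡ᵇ toℕ u') ∧ not (toℕ v ≡ᵇ toℕ w)
          then not (toℕ (pos v) ≡ᵇ toℕ (pos w)) else true
    ... | _ | _ = true

    valid : Bool
    valid = allB vertexOK (allFin n) ∧
            allB (λ v → allB (pairOK v) (allFin n)) (allFin n)

    weight : Carrier
    weight = foldr (λ v acc → φ (deg v) * acc) 1# (allFin n)

  Pars : (n : ℕ) → List (Fin n → Maybe (Fin n))
  Pars n = allFuns n (nothing ∷ map just (allFin n))

  Poss : (n : ℕ) → List (Fin n → Fin n)
  Poss n = allFuns n (allFin n)

  sumList : List Carrier → Carrier
  sumList = foldr _+_ 0#

  L : ℕ → ℕ → Carrier
  L n k = sumList (concatMap (λ par → map (λ pos →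
            let open Forest n par pos in
            if valid ∧ (roots ≡ᵇ k) then weight else 0#) (Poss n)) (Pars n))

  LMatrix : ℕ → ℕ → Carrier
  LMatrix = L

  Lpoly : ℕ → List Carrier
  Lpoly n = map (L n) (upTo (suc n))

{-# OPTIONS --safe #-}
module Submission where

-- Deleting vertex 1 from an increasing forest gives L_{n+1,k+1} = Σ_j L_{n,j} M_{j,k} with
-- M_{j,k} = (j!/k!) φ_{j-k}, so L is the output matrix of the production matrix M Δ (Δ the
-- shift).  Every minor of M is a natural multiple of a Toeplitz minor of φ, so M is totally
-- positive of order r.  For a row-finite Hessenberg matrix Q of that kind, Cauchy–Binet
-- shows by induction on the rows that the matrix W with rows W_0 = c e_0, W_{n+1} = W_n Q is
-- totally positive, and (W_{i+j,0}) = W V with V_{k,j} = (Q^j e_0)_k is a second such product.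
-- (a) is the case Q = M Δ; (c) is the case where the first row of M is dropped, with c = φ_0;
-- (b) is the case Q = M (Δ + y I) over R[y], whose W_{n,k} are the divided y-derivatives of
-- L_n(φ,y).

open import Defs
open import Level using (Level; _⊔_) renaming (suc to lsuc)
open import Algebra.Bundles using (CommutativeRing)
open import Algebra.Morphism.Structures using (IsRingHomomorphism)
open import Data.Bool using (Bool; true; false; T; _∧_; not; if_then_else_)
open import Data.Bool.Properties using (T-∧; ∧-identityʳ; ∧-assoc; ∧-comm)
open import Data.Empty using (⊥-elim)
open import Data.Fin using (Fin; toℕ; punchIn) renaming (zero to fzero; suc to fsuc)
open import Data.Fin.Properties using (toℕ<n; toℕ-injective; punchInᵢ≢i; suc-injective)
open import Data.List using (List; []; _∷_; _++_; map; concatMap; foldr; tabulate; allFin; upTo; applyUpTo)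
open import Data.List.Properties using (map-tabulate; map-∘; map-++)
open import Data.List.Relation.Unary.All using (All; []; _∷_)
open import Data.Maybe using (Maybe; just; nothing; is-nothing)
open import Data.Nat using (ℕ; zero; suc; pred; _<_; _≤_; z≤n; s≤s; z<s; s<s; s≤s⁻¹; NonZero; >-nonZero; _∸_; _!; _<ᵇ_; _≡ᵇ_)
  renaming (_+_ to _+ℕ_; _*_ to _*ℕ_; _⊔_ to _⊔ℕ_)
open import Data.Nat.Combinatorics using (_C_; nCn≡1; nCk≡nC[n∸k]; nCk≡n!/k![n-k]!; k>n⇒nCk≡0; k![n∸k]!∣n!; nCk+nC[k+1]≡[n+1]C[k+1])
open import Data.Nat.DivMod using (m/n*n≡m)
open import Data.Nat.Divisibility using (divides; _∣?_)
import Data.Nat.Properties as ℕₚ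
open import Data.Product using (_×_; _,_; proj₁; proj₂; Σ; ∃)
open import Data.Sum using (_⊎_; inj₁; inj₂)
open import Data.Unit using (tt)
import Data.Unit.Polymorphic as Poly⊤
open import Function using (_∘_; flip; id)
open import Function.Bundles using (module Equivalence; _⇔_; mk⇔)
open import Relation.Nullary using (¬_; yes; no; contradiction)
import Relation.Binary.PropositionalEquality as ≡
open ≡ using (_≡_; _≢_; _≗_)
import Algebra.Properties.CommutativeMonoid.Sum ℕₚ.*-1-commutativeMonoid as ∏
open import Algebra.Properties.CommutativeSemigroup ℕₚ.*-commutativeSemigroup using ()
  renaming (interchange to *ℕ-interchange)

-- Integers need not be invertible, or even cancellable, in R. Formally M is D T D⁻¹ with T the
-- Toeplitz matrix of φ and D = diag(n!), so a minor of M should be a Toeplitz minor times ∏ I! / ∏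
-- J!. That quotient can fail to be an integer, and no denominator can be cleared in R, so the
-- quotients are handled in ℕ, with a case of their own when they are not integral. The matrix Q of
-- (b) arises as follows. Put B = (C(n,k) y^(n-k)). Column 0 of L B lists the polynomials L_n(φ,y),
-- and L B is the output matrix of B⁻¹ M Δ B. Formally M and B are both lower triangular Toeplitz
-- matrices conjugated by D, so they commute; and Δ B = B (Δ + y I) by Pascal's rule. Hence B⁻¹ M Δ
-- B = M (Δ + y I). The code checks M Δ B = B M (Δ + y I) coefficient by coefficient in y, which
-- reduces it to an identity between natural numbers. On the combinatorial side the definition
-- enumerates sibling positions together with parents. These are summed out before a vertex is
-- deleted, which turns the weight φ_d into d! φ_d.

private variable
  a b : Level
  A : Set a
  B : Set b
  c k m n N : ℕ

-- Alternating sums, determinants and the Cauchy-Binet formula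

module Determinant {c ℓ : Level} (R : CommutativeRing c ℓ) where
  open CommutativeRing R hiding (zero)
  open import Algebra.Properties.Ring ring public
    using (-0#≈0#; -‿distribʳ-*; -‿+-comm; -‿involutive)
  open import Algebra.Properties.CommutativeSemigroup +-commutativeSemigroup public
    using () renaming (interchange to +-interchange)
  open import Algebra.Properties.CommutativeSemigroup *-commutativeSemigroup public
    using () renaming (interchange to *-interchange; x∙yz≈y∙xz to *-leftComm)
  import Algebra.Properties.Semiring.Sum semiring as Sum
  open import Relation.Binary.Reasoning.Setoid setoid

  -- Opaque, so that unification treats alternating sums and determinants of
  -- size suc m as rigid.
  opaque
    alt : (m : ℕ) → (Fin m → Carrier) → Carrier
    alt zero    f = 0#
    alt (suc m) f = f fzero + - alt m (f ∘ fsuc)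

    Det : (m : ℕ) → (Fin m → Fin m → Carrier) → Carrier
    Det = det rawRing

    sum : ℕ → (ℕ → Carrier) → Carrier
    sum n f = Sum.sum {n} (f ∘ toℕ)

  opaque
    unfolding alt

    alt-cong : ∀ m {f g : Fin m → Carrier} → (∀ i → f i ≈ g i) → alt m f ≈ alt m g
    alt-cong zero    h = refl
    alt-cong (suc m) h = +-cong (h fzero) (-‿cong (alt-cong m (h ∘ fsuc)))

    alt-zero : ∀ m {f : Fin m → Carrier} → (∀ i → f i ≈ 0#) → alt m f ≈ 0#
    alt-zero zero    h = refl
    alt-zero (suc m) h = begin
      _ + - _    ≈⟨ +-cong (h fzero) (-‿cong (alt-zero m (h ∘ fsuc))) ⟩
      0# + - 0#  ≈⟨ -‿inverseʳ 0# ⟩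
      0#         ∎

    alt-+ : ∀ m (f g : Fin m → Carrier) → alt m (λ i → f i + g i) ≈ alt m f + alt m g
    alt-+ zero    f g = sym (+-identityˡ 0#)
    alt-+ (suc m) f g = begin
      (f fzero + g fzero) + - alt m (λ i → f (fsuc i) + g (fsuc i))
        ≈⟨ +-congˡ (-‿cong (alt-+ m _ _)) ⟩
      (f fzero + g fzero) + - (alt m (f ∘ fsuc) + alt m (g ∘ fsuc))
        ≈⟨ +-congˡ (-‿+-comm _ _) ⟨
      (f fzero + g fzero) + (- alt m (f ∘ fsuc) + - alt m (g ∘ fsuc))
        ≈⟨ +-interchange _ _ _ _ ⟩
      alt (suc m) f + alt (suc m) g ∎

    alt-*ˡ : ∀ m a (f : Fin m → Carrier) → alt m (λ i → a * f i) ≈ a * alt m f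
    alt-*ˡ zero    a f = sym (zeroʳ a)
    alt-*ˡ (suc m) a f = begin
      a * f fzero + - alt m (λ i → a * f (fsuc i)) ≈⟨ +-congˡ (-‿cong (alt-*ˡ m a _)) ⟩
      a * f fzero + - (a * alt m (f ∘ fsuc))       ≈⟨ +-congˡ (-‿distribʳ-* a _) ⟩
      a * f fzero + a * - alt m (f ∘ fsuc)         ≈⟨ distribˡ a _ _ ⟨
      a * alt (suc m) f                            ∎

    alt-*ʳ : ∀ m (f : Fin m → Carrier) a → alt m (λ i → f i * a) ≈ alt m f * a
    alt-*ʳ m f a = trans (alt-cong m (λ i → *-comm (f i) a)) (trans (alt-*ˡ m a f) (*-comm a _))

    alt-neg : ∀ m (f : Fin m → Carrier) → alt m (λ i → - f i) ≈ - alt m f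
    alt-neg zero    f = sym -0#≈0#
    alt-neg (suc m) f = trans (+-congˡ (-‿cong (alt-neg m _))) (-‿+-comm _ _)

    alt-comm : ∀ m n (f : Fin m → Fin n → Carrier) →
               alt m (λ i → alt n (f i)) ≈ alt n (λ j → alt m (λ i → f i j))
    alt-comm zero    n f = sym (alt-zero n (λ _ → refl))
    alt-comm (suc m) n f = begin
      alt n (f fzero) + - alt m (λ i → alt n (f (fsuc i)))
        ≈⟨ +-congˡ (-‿cong (alt-comm m n _)) ⟩
      alt n (f fzero) + - alt n (λ j → alt m (λ i → f (fsuc i) j))
        ≈⟨ +-congˡ (alt-neg n _) ⟨
      alt n (f fzero) + alt n (λ j → - alt m (λ i → f (fsuc i) j))
        ≈⟨ alt-+ n _ _ ⟨
      alt n (λ j → alt (suc m) (λ i → f i j)) ∎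

  alt-product : ∀ m n (f : Fin m → Carrier) (g : Fin n → Carrier) →
                alt m (λ i → alt n (λ j → f i * g j)) ≈ alt m f * alt n g
  alt-product m n f g = trans (alt-cong m (λ i → alt-*ˡ n (f i) g)) (alt-*ʳ m f _)

  opaque
    unfolding alt

    signed-cong : ∀ k {x y} → x ≈ y → signed rawRing k x ≈ signed rawRing k y
    signed-cong zero    e = e
    signed-cong (suc k) e = -‿cong (signed-cong k e)

    sumFin-signed : ∀ m (f : Fin m → Carrier) →
                    sumFin rawRing m (λ i → signed rawRing (toℕ i) (f i)) ≈ alt m f
    sumFin-neg : ∀ m (f : Fin m → Carrier) → sumFin rawRing m (λ i → - f i) ≈ - sumFin rawRing m f

    sumFin-neg zero    f = sym -0#≈0#
    sumFin-neg (suc m) f = trans (+-congˡ (sumFin-neg m _)) (-‿+-comm _ _)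

    sumFin-signed zero    f = refl
    sumFin-signed (suc m) f =
      +-congˡ (trans (sumFin-neg m _) (-‿cong (sumFin-signed m (f ∘ fsuc))))

  Matrix : ℕ → Set c
  Matrix m = Fin m → Fin m → Carrier

  delete : Matrix (suc m) → Fin (suc m) → Fin (suc m) → Matrix m
  delete A i j k l = A (punchIn i k) (punchIn j l)

  opaque
    unfolding alt Det sum

    det-row₀ : ∀ m (A : Matrix (suc m)) →
               Det (suc m) A ≈ alt (suc m) (λ j → A fzero j * Det m (delete A fzero j))
    det-row₀ m A = sumFin-signed (suc m) (λ j → A fzero j * Det m (delete A fzero j))

    det₀ : (A : Matrix 0) → Det 0 A ≈ 1#
    det₀ A = refl

    alt₀ : (f : Fin 0 → Carrier) → alt 0 f ≈ 0#
    alt₀ f = refl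

    alt-suc : ∀ m (f : Fin (suc m) → Carrier) → alt (suc m) f ≈ f fzero + - alt m (f ∘ fsuc)
    alt-suc m f = refl

    alt₁ : (f : Fin 1 → Carrier) → alt 1 f ≈ f fzero
    alt₁ f = trans (+-congˡ -0#≈0#) (+-identityʳ _)

    sum₀ : ∀ f → sum 0 f ≈ 0#
    sum₀ f = refl

    sum-suc : ∀ n f → sum (suc n) f ≈ f 0 + sum n (f ∘ suc)
    sum-suc n f = refl

    sum-cong : ∀ n {f g} → (∀ k → k < n → f k ≈ g k) → sum n f ≈ sum n g
    sum-cong n h = Sum.sum-cong-≋ (λ i → h (toℕ i) (toℕ<n i))

    sum-+ : ∀ n f g → sum n (λ k → f k + g k) ≈ sum n f + sum n g
    sum-+ n f g = Sum.∑-distrib-+ {n} (f ∘ toℕ) (g ∘ toℕ)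

    sum-*ˡ : ∀ n a f → sum n (λ k → a * f k) ≈ a * sum n f
    sum-*ˡ n a f = sym (Sum.*-distribˡ-sum {n} a (f ∘ toℕ))

    sum-*ʳ : ∀ n f a → sum n (λ k → f k * a) ≈ sum n f * a
    sum-*ʳ n f a = sym (Sum.*-distribʳ-sum {n} a (f ∘ toℕ))

    sum-comm : ∀ m n (f : ℕ → ℕ → Carrier) → sum m (λ i → sum n (f i)) ≈ sum n (λ j → sum m (λ i → f i j))
    sum-comm m n f = Sum.∑-comm {m} {n} (λ i j → f (toℕ i) (toℕ j))

    sum-zero : ∀ n {f} → (∀ k → k < n → f k ≈ 0#) → sum n f ≈ 0#
    sum-zero n h = trans (sum-cong n h) (Sum.sum-replicate-zero n)

  sum-head : ∀ n {f} → (∀ k → f (suc k) ≈ 0#) → sum (suc n) f ≈ f 0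
  sum-head n h = trans (sum-suc n _) (trans (+-congˡ (sum-zero n (λ k _ → h k))) (+-identityʳ _))

  sum-truncate : ∀ {m n} → m ≤ n → ∀ {f} → (∀ k → m ≤ k → f k ≈ 0#) → sum n f ≈ sum m f
  sum-truncate {n = n} z≤n h = trans (sum-zero n (λ k _ → h k z≤n)) (sym (sum₀ _))
  sum-truncate {suc m} {suc n} (s≤s m≤n) h = trans (sum-suc n _)
    (trans (+-congˡ (sum-truncate m≤n (λ k m≤k → h (suc k) (s≤s m≤k)))) (sym (sum-suc m _)))

  det-cong : ∀ m {A B : Matrix m} → (∀ i j → A i j ≈ B i j) → Det m A ≈ Det m B
  det-cong zero    h = trans (det₀ _) (sym (det₀ _))
  det-cong (suc m) {A} {B} h = begin
    Det (suc m) A                                            ≈⟨ det-row₀ m A ⟩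
    alt (suc m) (λ j → A fzero j * Det m (delete A fzero j))
      ≈⟨ alt-cong (suc m) (λ j → *-cong (h fzero j) (det-cong m (λ k l → h (fsuc k) (punchIn j l)))) ⟩
    alt (suc m) (λ j → B fzero j * Det m (delete B fzero j)) ≈⟨ det-row₀ m B ⟨
    Det (suc m) B                                            ∎

  -- Both expansions contain the corner term. In every other term of the row expansion the cofactor
  -- still has column 0; expanding it along that column and exchanging the two alternating sums
  -- leaves the row expansions of the cofactors of column 0.
  det-col₀ : ∀ m (A : Matrix (suc m)) →
             Det (suc m) A ≈ alt (suc m) (λ i → A i fzero * Det m (delete A i fzero))
  det-col₀ zero    A = trans (det-row₀ zero A)
    (trans (alt₁ _) (trans (*-congˡ (trans (det₀ _) (sym (det₀ _)))) (sym (alt₁ _))))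
  det-col₀ (suc m) A = begin
    Det (suc (suc m)) A ≈⟨ trans (det-row₀ (suc m) A) (alt-suc _ _) ⟩
    head + - alt (suc m) (λ j → A fzero (fsuc j) * Det (suc m) (delete A fzero (fsuc j)))
      ≈⟨ +-congˡ (-‿cong (alt-cong (suc m) (λ j → *-congˡ (det-col₀ m (delete A fzero (fsuc j)))))) ⟩
    head + - alt (suc m) (λ j → A fzero (fsuc j) * alt (suc m) (λ i → A (fsuc i) fzero * minor₂ i j))
      ≈⟨ +-congˡ (-‿cong (alt-cong (suc m) (λ j → alt-*ˡ (suc m) _ _))) ⟨
    head + - alt (suc m) (λ j → alt (suc m) (λ i → A fzero (fsuc j) * (A (fsuc i) fzero * minor₂ i j)))
      ≈⟨ +-congˡ (-‿cong (alt-comm (suc m) (suc m) _)) ⟩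
    head + - alt (suc m) (λ i → alt (suc m) (λ j → A fzero (fsuc j) * (A (fsuc i) fzero * minor₂ i j)))
      ≈⟨ +-congˡ (-‿cong (alt-cong (suc m) (λ i → alt-cong (suc m) (λ j → *-leftComm _ _ _)))) ⟩
    head + - alt (suc m) (λ i → alt (suc m) (λ j → A (fsuc i) fzero * (A fzero (fsuc j) * minor₂ i j)))
      ≈⟨ +-congˡ (-‿cong (alt-cong (suc m) (λ i → alt-*ˡ (suc m) _ _))) ⟩
    head + - alt (suc m) (λ i → A (fsuc i) fzero * alt (suc m) (λ j → A fzero (fsuc j) * minor₂ i j))
      ≈⟨ +-congˡ (-‿cong (alt-cong (suc m) (λ i → *-congˡ (det-row₀ m (delete A (fsuc i) fzero))))) ⟨
    head + - alt (suc m) (λ i → A (fsuc i) fzero * Det (suc m) (delete A (fsuc i) fzero))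
      ≈⟨ alt-suc _ _ ⟨
    alt (suc (suc m)) (λ i → A i fzero * Det (suc m) (delete A i fzero)) ∎
    where
    head : Carrier
    head = A fzero fzero * Det (suc m) (delete A fzero fzero)
    minor₂ : Fin (suc m) → Fin (suc m) → Carrier
    minor₂ i j = Det m (λ k l → A (fsuc (punchIn i k)) (fsuc (punchIn j l)))

  det-transpose : ∀ m (A : Matrix m) → Det m (λ i j → A j i) ≈ Det m A
  det-transpose zero    A = trans (det₀ _) (sym (det₀ _))
  det-transpose (suc m) A = begin
    Det (suc m) (λ i j → A j i)
      ≈⟨ det-row₀ m _ ⟩
    alt (suc m) (λ j → A j fzero * Det m (λ k l → A (punchIn j l) (fsuc k)))
      ≈⟨ alt-cong (suc m) (λ j → *-congˡ (det-transpose m (delete A j fzero))) ⟩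
    alt (suc m) (λ j → A j fzero * Det m (delete A j fzero))
      ≈⟨ det-col₀ m A ⟨
    Det (suc m) A ∎

  -- g' is g reindexed along the involution that exchanges the order in which
  -- two indices are deleted: (j , l) ↦ (punchIn j l , the position of j after that).
  Swapped : ∀ m → (g g' : Fin (suc m) → Fin m → Carrier) → Set ℓ
  Swapped zero    g g' = Poly⊤.⊤
  Swapped (suc m) g g' =
    (∀ l → g fzero l ≈ g' (fsuc l) fzero) ×
    (∀ j → g (fsuc j) fzero ≈ g' fzero j) ×
    Swapped m (λ j l → g (fsuc j) (fsuc l)) (λ j l → g' (fsuc j) (fsuc l))

  swapped-cong : ∀ m {g g' h h'} → (∀ j l → g j l ≈ h j l) → (∀ j l → g' j l ≈ h' j l) →
                 Swapped m g g' → Swapped m h h'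
  swapped-cong zero    e e' s = Poly⊤.tt
  swapped-cong (suc m) e e' (s₁ , s₂ , s₃) =
    (λ l → trans (sym (e _ _)) (trans (s₁ l) (e' _ _))) ,
    (λ l → trans (sym (e _ _)) (trans (s₂ l) (e' _ _))) ,
    swapped-cong m (λ j l → e _ _) (λ j l → e' _ _) s₃

  -- The signed sum of a Laplace expansion along two rows: column j is deleted first, and l is a
  -- position among the columns that remain.
  alt₂ : ∀ m → (Fin (suc m) → Fin m → Carrier) → Carrier
  alt₂ m g = alt (suc m) (λ j → alt m (g j))

  -- The pairs of columns are split by whether column 0 is deleted first, deleted second, or kept.
  alt₂-suc : ∀ m g → alt₂ (suc m) g ≈
    (alt (suc m) (g fzero) + - alt (suc m) (λ j → g (fsuc j) fzero))
      + alt₂ m (λ j l → g (fsuc j) (fsuc l))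
  alt₂-suc m g = begin
    alt (suc (suc m)) (λ j → alt (suc m) (g j))
      ≈⟨ trans (alt-suc _ _) (+-congˡ (-‿cong (alt-cong (suc m) (λ j → alt-suc m (g (fsuc j)))))) ⟩
    x + - alt (suc m) (λ j → g (fsuc j) fzero + - alt m (λ l → g (fsuc j) (fsuc l)))
      ≈⟨ +-congˡ (-‿cong (trans (alt-+ (suc m) _ _) (+-congˡ (alt-neg (suc m) _)))) ⟩
    x + - (y + - z)    ≈⟨ +-congˡ (-‿+-comm y (- z)) ⟨
    x + (- y + - - z)  ≈⟨ +-assoc x _ _ ⟨
    (x + - y) + - - z  ≈⟨ +-congˡ (-‿involutive z) ⟩
    (x + - y) + z      ∎
    where
    x = alt (suc m) (g fzero)
    y = alt (suc m) (λ j → g (fsuc j) fzero)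
    z = alt₂ m (λ j l → g (fsuc j) (fsuc l))

  alt₂-zero : ∀ g → alt₂ zero g ≈ 0#
  alt₂-zero g = alt-zero 1 (λ j → alt₀ (g j))

  -- Exchanging the order of deletion interchanges the two blocks of `alt₂-suc` that involve column
  -- 0, and these carry opposite signs; the third block is covered by induction.
  alt₂-swap : ∀ m g g' → Swapped m g g' → alt₂ m g ≈ - alt₂ m g'
  alt₂-swap zero    g g' s = trans (alt₂-zero g) (trans (sym -0#≈0#) (-‿cong (sym (alt₂-zero g'))))
  alt₂-swap (suc m) g g' (s₁ , s₂ , s₃) = begin
    alt₂ (suc m) g             ≈⟨ alt₂-suc m g ⟩
    (x + - y) + z              ≈⟨ +-cong (+-cong (alt-cong (suc m) s₁) (-‿cong (alt-cong (suc m) s₂)))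
                                         (alt₂-swap m _ _ s₃) ⟩
    (y' + - x') + - z'         ≈⟨ +-congʳ (+-congʳ (-‿involutive y')) ⟨
    (- - y' + - x') + - z'     ≈⟨ +-congʳ (+-comm _ _) ⟩
    (- x' + - - y') + - z'     ≈⟨ +-congʳ (-‿+-comm _ _) ⟩
    - (x' + - y') + - z'       ≈⟨ -‿+-comm _ _ ⟩
    - ((x' + - y') + z')       ≈⟨ -‿cong (alt₂-suc m g') ⟨
    - alt₂ (suc m) g'          ∎
    where
    x = alt (suc m) (g fzero)
    y = alt (suc m) (λ j → g (fsuc j) fzero)
    z = alt₂ m (λ j l → g (fsuc j) (fsuc l))
    x' = alt (suc m) (g' fzero)
    y' = alt (suc m) (λ j → g' (fsuc j) fzero)
    z' = alt₂ m (λ j l → g' (fsuc j) (fsuc l))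

  -- Not a consequence of alt₂-swap, because 2 need not be cancellable.
  alt₂-symmetric : ∀ m g → Swapped m g g → alt₂ m g ≈ 0#
  alt₂-symmetric zero    g s = alt₂-zero g
  alt₂-symmetric (suc m) g (s₁ , s₂ , s₃) = begin
    alt₂ (suc m) g     ≈⟨ alt₂-suc m g ⟩
    (x + - y) + _      ≈⟨ +-cong (+-congʳ (alt-cong (suc m) s₁)) (alt₂-symmetric m _ s₃) ⟩
    (y + - y) + 0#     ≈⟨ +-identityʳ _ ⟩
    y + - y            ≈⟨ -‿inverseʳ y ⟩
    0#                 ∎
    where
    x = alt (suc m) (g fzero)
    y = alt (suc m) (λ j → g (fsuc j) fzero)

  lift : (Fin m → Fin n) → Fin (suc m) → Fin (suc n)
  lift κ fzero    = fzero
  lift κ (fsuc k) = fsuc (κ k)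

  lift-cong : {κ κ' : Fin m → Fin n} → κ ≗ κ' → lift κ ≗ lift κ'
  lift-cong e fzero    = ≡.refl
  lift-cong e (fsuc k) = ≡.cong fsuc (e k)

  -- F depends on the two deleted columns and on the enumeration κ of the others, which is the same
  -- for both orders of deletion. The extensionality hypotheses are there because `lift` of such an
  -- enumeration agrees only pointwise with the enumeration one size up.
  swapped-punchIn : ∀ m
    (F F' : Fin (suc (suc m)) → Fin (suc (suc m)) → (Fin m → Fin (suc (suc m))) → Carrier) →
    (∀ j l {κ κ'} → κ ≗ κ' → F j l κ ≈ F j l κ') →
    (∀ j l {κ κ'} → κ ≗ κ' → F' j l κ ≈ F' j l κ') →
    (∀ j l κ → F j l κ ≈ F' l j κ) →
    Swapped (suc m) (λ j l → F j (punchIn j l) (λ k → punchIn j (punchIn l k)))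
                    (λ j l → F' j (punchIn j l) (λ k → punchIn j (punchIn l k)))
  swapped-punchIn zero    F F' ext ext' h = (λ l → h _ _ _) , (λ l → h _ _ _) , Poly⊤.tt
  swapped-punchIn (suc m) F F' ext ext' h =
    (λ l → h _ _ _) , (λ l → h _ _ _) ,
    swapped-cong (suc m)
      (λ j l → ext (fsuc j) (fsuc (punchIn j l)) (punch₂ j l))
      (λ j l → ext' (fsuc j) (fsuc (punchIn j l)) (punch₂ j l))
      (swapped-punchIn m
        (λ j l κ → F (fsuc j) (fsuc l) (lift κ)) (λ j l κ → F' (fsuc j) (fsuc l) (lift κ))
        (λ j l e → ext _ _ (lift-cong e)) (λ j l e → ext' _ _ (lift-cong e))
        (λ j l κ → h _ _ _))
    where
    punch₂ : ∀ (j : Fin (suc (suc m))) (l : Fin (suc m)) →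
             lift (λ k → punchIn j (punchIn l k)) ≗ (λ k → punchIn (fsuc j) (punchIn (fsuc l) k))
    punch₂ j l fzero    = ≡.refl
    punch₂ j l (fsuc k) = ≡.refl

  -- The determinant is affine in a rank-one perturbation: terms that use two rows of a bᵀ contain a
  -- 2 × 2 minor of a bᵀ and cancel. The correction term is the adjugate of A paired with a and b.
  det-rank₁ : ∀ m (A : Matrix (suc m)) (a b : Fin (suc m) → Carrier) →
    Det (suc m) (λ i j → A i j + a i * b j) ≈
    Det (suc m) A + alt (suc m) (λ i → alt (suc m) (λ j → (a i * b j) * Det m (delete A i j)))
  det-rank₁ zero A a b = begin
    Det 1 (λ i j → A i j + a i * b j)                        ≈⟨ det₁ _ ⟩
    (A fzero fzero + a fzero * b fzero) * Det 0 _            ≈⟨ distribʳ _ _ _ ⟩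
    A fzero fzero * Det 0 _ + a fzero * b fzero * Det 0 _
      ≈⟨ +-cong (trans (det₁ A) (*-congˡ 0≈0)) (trans (trans (alt₁ _) (alt₁ _)) (*-congˡ 0≈0)) ⟨
    _                                                        ∎
    where
    det₁ : (B : Matrix 1) → Det 1 B ≈ B fzero fzero * Det 0 (delete B fzero fzero)
    det₁ B = trans (det-row₀ 0 B) (alt₁ _)
    0≈0 : ∀ {A B : Matrix 0} → Det 0 A ≈ Det 0 B
    0≈0 = trans (det₀ _) (sym (det₀ _))
  det-rank₁ (suc m) A a b = begin
    Det (suc (suc m)) (λ i j → A i j + a i * b j)
      ≈⟨ det-row₀ (suc m) _ ⟩
    alt (suc (suc m)) (λ j → (A fzero j + a fzero * b j) *
      Det (suc m) (λ k l → A (fsuc k) (punchIn j l) + a (fsuc k) * b (punchIn j l)))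
      ≈⟨ alt-cong (suc (suc m)) (λ j → trans
           (*-congˡ (det-rank₁ m (delete A fzero j) (a ∘ fsuc) (b ∘ punchIn j)))
           (trans (distribʳ _ _ _) (+-cong (distribˡ _ _ _) (distribˡ _ _ _)))) ⟩
    alt (suc (suc m)) (λ j → (A fzero j * E j + A fzero j * Y j) + (a fzero * b j * E j + a fzero * b j * Y j))
      ≈⟨ trans (alt-+ _ _ _) (+-cong (alt-+ _ _ _) (alt-+ _ _ _)) ⟩
    (alt (suc (suc m)) (λ j → A fzero j * E j) + alt (suc (suc m)) (λ j → A fzero j * Y j)) +
      (alt (suc (suc m)) (λ j → a fzero * b j * E j) + alt (suc (suc m)) (λ j → a fzero * b j * Y j))
      ≈⟨ +-cong (+-cong (sym (det-row₀ (suc m) A)) third) (trans (+-congˡ fourth) (+-identityʳ _)) ⟩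
    (Det (suc (suc m)) A + - rest) + alt (suc (suc m)) (λ j → a fzero * b j * E j)
      ≈⟨ trans (+-assoc _ _ _) (+-congˡ (trans (+-comm _ _) (sym (alt-suc _ _)))) ⟩
    Det (suc (suc m)) A + alt (suc (suc m)) (λ i → alt (suc (suc m)) (λ j → (a i * b j) * Det (suc m) (delete A i j))) ∎
    where
    E : Fin (suc (suc m)) → Carrier
    E j = Det (suc m) (delete A fzero j)
    X : Fin (suc m) → (Fin m → Fin (suc (suc m))) → Carrier
    X i κ = Det m (λ k l → A (fsuc (punchIn i k)) (κ l))
    X-ext : ∀ i {κ κ'} → κ ≗ κ' → X i κ ≈ X i κ'
    X-ext i e = det-cong m (λ k l → reflexive (≡.cong (A _) (e l)))
    Y : Fin (suc (suc m)) → Carrier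
    Y j = alt (suc m) (λ i → alt (suc m) (λ l →
            (a (fsuc i) * b (punchIn j l)) * X i (λ k → punchIn j (punchIn l k))))
    rest : Carrier
    rest = alt (suc m) (λ i → alt (suc (suc m)) (λ j →
             (a (fsuc i) * b j) * Det (suc m) (delete A (fsuc i) j)))
    pull : ∀ (x : Fin (suc (suc m)) → Carrier) →
      alt (suc (suc m)) (λ j → x j * Y j) ≈
      alt (suc m) (λ i → alt₂ (suc m) (λ j l →
        x j * ((a (fsuc i) * b (punchIn j l)) * X i (λ k → punchIn j (punchIn l k)))))
    pull x = begin
      alt (suc (suc m)) (λ j → x j * Y j)
        ≈⟨ alt-cong _ (λ j → trans (alt-cong (suc m) (λ i → alt-*ˡ (suc m) (x j) _)) (alt-*ˡ (suc m) (x j) _)) ⟨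
      alt (suc (suc m)) (λ j → alt (suc m) (λ i → alt (suc m) (λ l →
        x j * ((a (fsuc i) * b (punchIn j l)) * X i (λ k → punchIn j (punchIn l k))))))
        ≈⟨ alt-comm (suc (suc m)) (suc m) _ ⟩
      _ ∎
    -- Rows 0 and i + 1 both come from a bᵀ, so the summand is symmetric in the two deleted columns.
    fourth : alt (suc (suc m)) (λ j → a fzero * b j * Y j) ≈ 0#
    fourth = trans (pull (λ j → a fzero * b j)) (alt-zero (suc m) (λ i →
      alt₂-symmetric (suc m) _ (swapped-punchIn m (F i) (F i)
        (λ j l e → *-congˡ (*-congˡ (X-ext i e))) (λ j l e → *-congˡ (*-congˡ (X-ext i e)))
        (λ j l κ → begin
          (a fzero * b j) * ((a (fsuc i) * b l) * X i κ)  ≈⟨ *-assoc _ _ _ ⟨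
          (a fzero * b j) * (a (fsuc i) * b l) * X i κ    ≈⟨ *-congʳ (*-congˡ (*-comm _ _)) ⟩
          (a fzero * b j) * (b l * a (fsuc i)) * X i κ    ≈⟨ *-congʳ (*-interchange _ _ _ _) ⟩
          (a fzero * b l) * (b j * a (fsuc i)) * X i κ    ≈⟨ *-congʳ (*-congˡ (*-comm _ _)) ⟩
          (a fzero * b l) * (a (fsuc i) * b j) * X i κ    ≈⟨ *-assoc _ _ _ ⟩
          (a fzero * b l) * ((a (fsuc i) * b j) * X i κ)  ∎))))
      where
      F : Fin (suc m) → Fin (suc (suc m)) → Fin (suc (suc m)) → (Fin m → Fin (suc (suc m))) → Carrier
      F i j l κ = (a fzero * b j) * ((a (fsuc i) * b l) * X i κ)
    -- Row 0 comes from A and row i + 1 from a bᵀ. Deleting the column of row i + 1 first gives the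
    -- row-0 expansion of a cofactor of A. The sign is the one carried by the tail of the
    -- alternating sum over all rows.
    third : alt (suc (suc m)) (λ j → A fzero j * Y j) ≈ - rest
    third = begin
      alt (suc (suc m)) (λ j → A fzero j * Y j)
        ≈⟨ pull (A fzero) ⟩
      alt (suc m) (λ i → alt₂ (suc m) (λ j l →
        A fzero j * ((a (fsuc i) * b (punchIn j l)) * X i (λ k → punchIn j (punchIn l k)))))
        ≈⟨ alt-cong (suc m) (λ i → alt₂-swap (suc m) _ _ (swapped-punchIn m
             (λ j l κ → A fzero j * ((a (fsuc i) * b l) * X i κ))
             (λ j l κ → (a (fsuc i) * b j) * (A fzero l * X i κ))
             (λ j l e → *-congˡ (*-congˡ (X-ext i e))) (λ j l e → *-congˡ (*-congˡ (X-ext i e)))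
             (λ j l κ → *-leftComm _ _ _))) ⟩
      alt (suc m) (λ i → - alt₂ (suc m) (λ j l →
        (a (fsuc i) * b j) * (A fzero (punchIn j l) * X i (λ k → punchIn j (punchIn l k)))))
        ≈⟨ alt-neg (suc m) _ ⟩
      - alt (suc m) (λ i → alt₂ (suc m) (λ j l →
        (a (fsuc i) * b j) * (A fzero (punchIn j l) * X i (λ k → punchIn j (punchIn l k)))))
        ≈⟨ -‿cong (alt-cong (suc m) (λ i → alt-cong (suc (suc m)) (λ j →
             trans (*-congˡ (det-row₀ m _)) (sym (alt-*ˡ (suc m) _ _))))) ⟨
      - rest ∎

  0∷⁺_ : (Fin m → ℕ) → Fin (suc m) → ℕ
  (0∷⁺ K) fzero    = 0
  (0∷⁺ K) (fsuc k) = suc (K k)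

  opaque
    -- Sums over the strictly increasing m-tuples of natural numbers below n.
    sumInc : ∀ (m n : ℕ) → ((Fin m → ℕ) → Carrier) → Carrier
    sumInc zero    n       f = f (λ ())
    sumInc (suc m) zero    f = 0#
    sumInc (suc m) (suc n) f =
      sumInc m n (λ K → f (0∷⁺ K)) + sumInc (suc m) n (λ K → f (suc ∘ K))

    sumInc-cong : ∀ (m n : ℕ) {f g : (Fin m → ℕ) → Carrier} → (∀ K → f K ≈ g K) → sumInc m n f ≈ sumInc m n g
    sumInc-cong zero    n       h = h _
    sumInc-cong (suc m) zero    h = refl
    sumInc-cong (suc m) (suc n) h = +-cong (sumInc-cong m n (λ K → h _)) (sumInc-cong (suc m) n (λ K → h _))

    sumInc-+ : ∀ (m n : ℕ) (f g : (Fin m → ℕ) → Carrier) →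
               sumInc m n (λ K → f K + g K) ≈ sumInc m n f + sumInc m n g
    sumInc-+ zero    n       f g = refl
    sumInc-+ (suc m) zero    f g = sym (+-identityˡ 0#)
    sumInc-+ (suc m) (suc n) f g = trans (+-cong (sumInc-+ m n _ _) (sumInc-+ (suc m) n _ _)) (+-interchange _ _ _ _)

    sumInc-*ˡ : ∀ (m n : ℕ) a (f : (Fin m → ℕ) → Carrier) → sumInc m n (λ K → a * f K) ≈ a * sumInc m n f
    sumInc-*ˡ zero    n       a f = refl
    sumInc-*ˡ (suc m) zero    a f = sym (zeroʳ a)
    sumInc-*ˡ (suc m) (suc n) a f =
      trans (+-cong (sumInc-*ˡ m n a _) (sumInc-*ˡ (suc m) n a _)) (sym (distribˡ a _ _))

    sumInc-neg : ∀ (m n : ℕ) (f : (Fin m → ℕ) → Carrier) → sumInc m n (λ K → - f K) ≈ - sumInc m n f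
    sumInc-neg zero    n       f = refl
    sumInc-neg (suc m) zero    f = sym -0#≈0#
    sumInc-neg (suc m) (suc n) f =
      trans (+-cong (sumInc-neg m n _) (sumInc-neg (suc m) n _)) (-‿+-comm _ _)

    sumInc-zero : ∀ (m n : ℕ) → sumInc m n (λ _ → 0#) ≈ 0#
    sumInc-zero zero    n       = refl
    sumInc-zero (suc m) zero    = refl
    sumInc-zero (suc m) (suc n) = trans (+-cong (sumInc-zero m n) (sumInc-zero (suc m) n)) (+-identityˡ 0#)

    sumInc₀ : ∀ n f → sumInc 0 n f ≈ f (λ ())
    sumInc₀ n f = refl

    sumInc-suc-zero : ∀ m f → sumInc (suc m) 0 f ≈ 0#
    sumInc-suc-zero m f = refl

    sumInc-suc-suc : ∀ m n f → sumInc (suc m) (suc n) f ≈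
                     sumInc m n (λ K → f (0∷⁺ K)) + sumInc (suc m) n (λ K → f (suc ∘ K))
    sumInc-suc-suc m n f = refl

  sumInc-alt : ∀ m n p (f : Fin p → (Fin m → ℕ) → Carrier) →
               sumInc m n (λ K → alt p (λ i → f i K)) ≈ alt p (λ i → sumInc m n (f i))
  sumInc-alt m n zero    f = trans (sumInc-cong m n (λ K → alt₀ _)) (trans (sumInc-zero m n) (sym (alt₀ _)))
  sumInc-alt m n (suc p) f =
    trans (sumInc-cong m n (λ K → alt-suc p _)) (trans (sumInc-+ m n _ _)
      (trans (+-congˡ (trans (sumInc-neg m n _) (-‿cong (sumInc-alt m n p _)))) (sym (alt-suc p _))))

  -- Induction on n: the inner index 0 contributes a matrix of rank one.
  cauchy-binet : ∀ m n (A : Fin m → ℕ → Carrier) (B : ℕ → Fin m → Carrier) →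
    Det m (λ i j → sum n (λ k → A i k * B k j)) ≈
    sumInc m n (λ K → Det m (λ i j → A i (K j)) * Det m (λ i j → B (K i) j))
  cauchy-binet zero    n       A B = begin
    Det 0 _                                                    ≈⟨ det₀ _ ⟩
    1#                                                         ≈⟨ *-identityˡ 1# ⟨
    1# * 1#                                                    ≈⟨ *-cong (det₀ _) (det₀ _) ⟨
    Det 0 (λ i j → A i _) * Det 0 (λ i j → B _ j)              ≈⟨ sumInc₀ n _ ⟨
    _                                                          ∎
  cauchy-binet (suc m) zero    A B =
    trans (det-row₀ m _) (trans (alt-zero (suc m) (λ j → trans (*-congʳ (sum₀ _)) (zeroˡ _))) (sym (sumInc-suc-zero _ _)))
  cauchy-binet (suc m) (suc n) A B = begin
    Det (suc m) (λ i j → sum (suc n) (λ k → A i k * B k j))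
      ≈⟨ det-cong (suc m) (λ i j → trans (sum-suc n _) (+-comm _ _)) ⟩
    Det (suc m) (λ i j → AB i j + A i 0 * B 0 j)
      ≈⟨ det-rank₁ m AB _ _ ⟩
    Det (suc m) AB + alt (suc m) (λ i → alt (suc m) (λ j → (A i 0 * B 0 j) * Det m (delete AB i j)))
      ≈⟨ trans (+-comm _ _) (+-cong rank₁ (cauchy-binet (suc m) n A⁺ B⁺)) ⟩
    sumInc m n (λ K → Det (suc m) (λ i j → A i ((0∷⁺ K) j)) * Det (suc m) (λ i j → B ((0∷⁺ K) i) j)) +
    sumInc (suc m) n (λ K → Det (suc m) (λ i j → A i (suc (K j))) * Det (suc m) (λ i j → B (suc (K i)) j))
      ≈⟨ sumInc-suc-suc m n _ ⟨
    sumInc (suc m) (suc n) (λ K → Det (suc m) (λ i j → A i (K j)) * Det (suc m) (λ i j → B (K i) j)) ∎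
    where
    A⁺ : Fin (suc m) → ℕ → Carrier
    A⁺ i k = A i (suc k)
    B⁺ : ℕ → Fin (suc m) → Carrier
    B⁺ k j = B (suc k) j
    AB : Matrix (suc m)
    AB i j = sum n (λ k → A⁺ i k * B⁺ k j)
    -- By induction each cofactor of `AB` is a sum over K; for fixed K the double alternating sum
    -- factors into an expansion of an A-minor along column 0 and one of a B-minor along row 0.
    rank₁ : alt (suc m) (λ i → alt (suc m) (λ j → (A i 0 * B 0 j) * Det m (delete AB i j))) ≈
            sumInc m n (λ K → Det (suc m) (λ i j → A i ((0∷⁺ K) j)) * Det (suc m) (λ i j → B ((0∷⁺ K) i) j))
    rank₁ = begin
      alt (suc m) (λ i → alt (suc m) (λ j → (A i 0 * B 0 j) * Det m (delete AB i j)))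
        ≈⟨ alt-cong (suc m) (λ i → alt-cong (suc m) (λ j → trans
             (*-congˡ (cauchy-binet m n (A⁺ ∘ punchIn i) (λ k → B⁺ k ∘ punchIn j)))
             (sym (sumInc-*ˡ m n _ _)))) ⟩
      alt (suc m) (λ i → alt (suc m) (λ j → sumInc m n (λ K → (A i 0 * B 0 j) *
        (Det m (λ k l → A⁺ (punchIn i k) (K l)) * Det m (λ k l → B⁺ (K k) (punchIn j l))))))
        ≈⟨ alt-cong (suc m) (λ i → alt-cong (suc m) (λ j → sumInc-cong m n (λ K → *-interchange _ _ _ _))) ⟩
      alt (suc m) (λ i → alt (suc m) (λ j → sumInc m n (λ K →
        (A i 0 * Det m (λ k l → A⁺ (punchIn i k) (K l))) * (B 0 j * Det m (λ k l → B⁺ (K k) (punchIn j l))))))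
        ≈⟨ alt-cong (suc m) (λ i → sumInc-alt m n (suc m) _) ⟨
      alt (suc m) (λ i → sumInc m n (λ K → alt (suc m) (λ j →
        (A i 0 * Det m (λ k l → A⁺ (punchIn i k) (K l))) * (B 0 j * Det m (λ k l → B⁺ (K k) (punchIn j l))))))
        ≈⟨ sumInc-alt m n (suc m) _ ⟨
      sumInc m n (λ K → alt (suc m) (λ i → alt (suc m) (λ j →
        (A i 0 * Det m (λ k l → A⁺ (punchIn i k) (K l))) * (B 0 j * Det m (λ k l → B⁺ (K k) (punchIn j l))))))
        ≈⟨ sumInc-cong m n (λ K → trans (alt-product (suc m) (suc m) _ _)
             (*-cong (sym (det-col₀ m _)) (sym (det-row₀ m _)))) ⟩
      sumInc m n (λ K → Det (suc m) (λ i j → A i ((0∷⁺ K) j)) * Det (suc m) (λ i j → B ((0∷⁺ K) i) j)) ∎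

  det-row₀-zero : ∀ m (A : Matrix (suc m)) → (∀ j → A fzero j ≈ 0#) → Det (suc m) A ≈ 0#
  det-row₀-zero m A h = trans (det-row₀ m A) (alt-zero (suc m) (λ j → trans (*-congʳ (h j)) (zeroˡ _)))

  det-row₀-head : ∀ m (A : Matrix (suc m)) → (∀ j → A fzero (fsuc j) ≈ 0#) →
                  Det (suc m) A ≈ A fzero fzero * Det m (λ i j → A (fsuc i) (fsuc j))
  det-row₀-head m A h = begin
    Det (suc m) A  ≈⟨ trans (det-row₀ m A) (alt-suc m _) ⟩
    A fzero fzero * Det m (delete A fzero fzero) + - alt m _
      ≈⟨ +-congˡ (-‿cong (alt-zero m (λ j → trans (*-congʳ (h j)) (zeroˡ _)))) ⟩
    A fzero fzero * Det m (delete A fzero fzero) + - 0#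
      ≈⟨ trans (+-congˡ -0#≈0#) (+-identityʳ _) ⟩
    A fzero fzero * Det m (delete A fzero fzero) ∎

  det-col₀-zero : ∀ m (A : Matrix (suc m)) → (∀ i → A i fzero ≈ 0#) → Det (suc m) A ≈ 0#
  det-col₀-zero m A h = trans (sym (det-transpose (suc m) A)) (det-row₀-zero m _ h)

  det-col₀-head : ∀ m (A : Matrix (suc m)) → (∀ i → A (fsuc i) fzero ≈ 0#) →
                  Det (suc m) A ≈ A fzero fzero * Det m (λ i j → A (fsuc i) (fsuc j))
  det-col₀-head m A h = trans (sym (det-transpose (suc m) A))
    (trans (det-row₀-head m _ h) (*-congˡ (det-transpose m _)))

  opaque
    unfolding Det

    Det≈det : ∀ m A → Det m A ≈ det rawRing m A
    Det≈det m A = refl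

-- Total positivity of products and of output matrices

record Cone {c ℓ} (R : CommutativeRing c ℓ) (p : Level) : Set (c ⊔ ℓ ⊔ lsuc p) where
  open CommutativeRing R
  field
    Pos      : Carrier → Set p
    Pos-resp : ∀ {x y} → x ≈ y → Pos x → Pos y
    Pos-0    : Pos 0#
    Pos-1    : Pos 1#
    Pos-+    : ∀ {x y} → Pos x → Pos y → Pos (x + y)
    Pos-*    : ∀ {x y} → Pos x → Pos y → Pos (x * y)

suc-mono-≤∞ : ∀ {m} r → suc m ≤∞ r → m ≤∞ r
suc-mono-≤∞ (fin r) h = ℕₚ.<⇒≤ h
suc-mono-≤∞ ∞       h = tt

tail-increasing : {I : Fin (suc m) → ℕ} → StrictlyIncreasing I → StrictlyIncreasing (I ∘ fsuc)
tail-increasing inc a b a<b = inc (fsuc a) (fsuc b) (s<s a<b)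

head-≤ : {I : Fin (suc m) → ℕ} → StrictlyIncreasing I → ∀ a → I fzero ≤ I a
head-≤ inc fzero    = ℕₚ.≤-refl
head-≤ inc (fsuc a) = ℕₚ.<⇒≤ (inc fzero (fsuc a) z<s)

suc-pred′ : ∀ {n} → 0 < n → suc (pred n) ≡ n
suc-pred′ (s≤s _) = ≡.refl

pred-increasing : {I : Fin m → ℕ} → (∀ a → 0 < I a) → StrictlyIncreasing I → StrictlyIncreasing (pred ∘ I)
pred-increasing pos inc a b a<b = ℕₚ.pred-mono-< {{>-nonZero (pos a)}} (inc a b a<b)

strict-bound : (I : Fin m → ℕ) → ∃ λ s → ∀ a → I a < s
strict-bound {zero}  I = 0 , λ ()
strict-bound {suc m} I with strict-bound (I ∘ fsuc)
... | s , h = suc (I fzero) ⊔ℕ s , λ where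
  fzero    → ℕₚ.m≤m⊔n _ s
  (fsuc a) → ℕₚ.≤-trans (h a) (ℕₚ.m≤n⊔m (suc (I fzero)) s)

module TotalPositivity {c ℓ p} (R : CommutativeRing c ℓ) (C : Cone R p) (r : ℕ∞) where
  open CommutativeRing R hiding (zero)
  open Cone C
  open Determinant R
  open import Relation.Binary.Reasoning.Setoid setoid

  InfMatrix : Set c
  InfMatrix = ℕ → ℕ → Carrier

  -- TP expressed with the opaque determinant.
  TPos : InfMatrix → Set p
  TPos M = ∀ m → m ≤∞ r → (I J : Fin m → ℕ) → StrictlyIncreasing I → StrictlyIncreasing J →
           Pos (Det m (λ a b → M (I a) (J b)))

  ordered : OrderedRaw c ℓ p
  ordered = record { raw = rawRing ; Pos = Pos }

  fromTP : ∀ {M} → TP ordered r M → TPos M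
  fromTP tp m m≤r I J incI incJ = Pos-resp (sym (Det≈det m _)) (tp m m≤r I J incI incJ)

  toTP : ∀ {M} → TPos M → TP ordered r M
  toTP tp m m≤r I J incI incJ = Pos-resp (Det≈det m _) (tp m m≤r I J incI incJ)

  TPos-cong : ∀ {M M'} → (∀ i j → M i j ≈ M' i j) → TPos M → TPos M'
  TPos-cong e tp m m≤r I J incI incJ = Pos-resp (det-cong m (λ a b → e _ _)) (tp m m≤r I J incI incJ)

  TPos-transpose : ∀ {M} → TPos M → TPos (flip M)
  TPos-transpose tp m m≤r I J incI incJ = Pos-resp (sym (det-transpose m _)) (tp m m≤r J I incJ incI)

  Pos-det₀ : ∀ A → Pos (Det 0 A)
  Pos-det₀ A = Pos-resp (sym (det₀ A)) Pos-1

  0∷⁺-increasing : {K : Fin m → ℕ} → StrictlyIncreasing K → StrictlyIncreasing (0∷⁺ K)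
  0∷⁺-increasing inc fzero    (fsuc b) _   = z<s
  0∷⁺-increasing inc (fsuc a) (fsuc b) a<b = s<s (inc a b (s≤s⁻¹ a<b))

  Pos-sumInc : ∀ m n (f : (Fin m → ℕ) → Carrier) →
               (∀ K → StrictlyIncreasing K → Pos (f K)) → Pos (sumInc m n f)
  Pos-sumInc zero    n       f h = Pos-resp (sym (sumInc₀ n f)) (h _ (λ ()))
  Pos-sumInc (suc m) zero    f h = Pos-resp (sym (sumInc-suc-zero m f)) Pos-0
  Pos-sumInc (suc m) (suc n) f h = Pos-resp (sym (sumInc-suc-suc m n f))
    (Pos-+ (Pos-sumInc m n _ (λ K inc → h _ (0∷⁺-increasing inc)))
           (Pos-sumInc (suc m) n _ (λ K inc → h _ (λ a b a<b → s<s (inc a b a<b)))))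

  -- Stated for one minor instead of for `TPos`, because the induction in `rowsBelow` knows the left
  -- factor to be positive only on rows below a bound.
  Pos-product-minor : ∀ m n {M A B : InfMatrix} (I J : Fin m → ℕ) →
    (∀ a b → M (I a) (J b) ≈ sum n (λ k → A (I a) k * B k (J b))) →
    (∀ K → StrictlyIncreasing K → Pos (Det m (λ a b → A (I a) (K b)))) →
    (∀ K → StrictlyIncreasing K → Pos (Det m (λ a b → B (K a) (J b)))) →
    Pos (Det m (λ a b → M (I a) (J b)))
  Pos-product-minor m n {M} {A} {B} I J e posA posB =
    Pos-resp (sym (trans (det-cong m e) (cauchy-binet m n (A ∘ I) (λ k b → B k (J b)))))
      (Pos-sumInc m n _ (λ K inc → Pos-* (posA K inc) (posB K inc)))

  -- Cauchy-Binet needs one truncation n for all rows of a minor, hence a hypothesis that holds for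
  -- every sufficiently large n.
  TPos-product : ∀ {M A B} → (∀ i j n → suc (suc i) ≤ n → M i j ≈ sum n (λ k → A i k * B k j)) →
                 TPos A → TPos B → TPos M
  TPos-product {M} {A} {B} e tpA tpB m m≤r I J incI incJ with strict-bound I
  ... | s , I<s = Pos-product-minor m (suc s) {M} {A} {B} I J (λ a b → e _ _ (suc s) (s≤s (I<s a)))
    (λ K incK → tpA m m≤r I K incI incK) (λ K incK → tpB m m≤r K J incK incJ)

  -- The truncation may depend on the column as well as on the row, so that the module applies both
  -- to an output matrix with finite rows and to the transpose of `V`, where the length of the sum
  -- is governed by the column.
  module OutputMatrix (Q W : InfMatrix) (tpQ : TPos Q) (pos-W₀₀ : Pos (W 0 0))
    (W₀ : ∀ k → W 0 (suc k) ≈ 0#)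
    (W-step : ∀ i k n → suc (suc (i +ℕ k)) ≤ n → W (suc i) k ≈ sum n (λ l → W i l * Q l k))
    where

    RowsBelow : ℕ → Set p
    RowsBelow s = ∀ m → m ≤∞ r → (I J : Fin m → ℕ) → StrictlyIncreasing I → StrictlyIncreasing J →
                  (∀ a → I a < s) → Pos (Det m (λ a b → W (I a) (J b)))

    -- Rows i + 1 of W are rows i of W times Q. Lowering every row index by one brings the minor
    -- within reach of the induction on the row bound.
    nonzeroRows : ∀ s → RowsBelow s →
      ∀ m → m ≤∞ r → (I J : Fin m → ℕ) → StrictlyIncreasing I → StrictlyIncreasing J →
      (∀ a → 0 < I a) → (∀ a → I a < suc s) → Pos (Det m (λ a b → W (I a) (J b)))
    nonzeroRows s below m m≤r I J incI incJ 0<I I≤s with strict-bound J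
    ... | t , J<t = Pos-resp
      (det-cong m (λ a b → reflexive (≡.cong (λ i → W i (J b)) (suc-pred′ (0<I a)))))
      (Pos-product-minor m (suc (s +ℕ t)) {λ i → W (suc i)} {W} {Q} (pred ∘ I) J
        (λ a b → W-step _ _ _ (s≤s (ℕₚ.≤-trans (ℕₚ.≤-reflexive (≡.cong (_+ℕ J b) (suc-pred′ (0<I a))))
          (ℕₚ.+-mono-≤ (s≤s⁻¹ (I≤s a)) (ℕₚ.<⇒≤ (J<t b))))))
        (λ K incK → below m m≤r (pred ∘ I) K (pred-increasing 0<I incI) incK
          (λ a → ℕₚ.≤-trans (ℕₚ.≤-reflexive (suc-pred′ (0<I a))) (s≤s⁻¹ (I≤s a))))
        (λ K incK → tpQ m m≤r K J incK incJ))

    -- Row 0 of W is a multiple of e₀. If row 0 is absent from the minor, `nonzeroRows` applies. If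
    -- it is present without column 0, the minor has a zero row. If both are present, the corner
    -- splits off and the remaining rows are nonzero.
    rowsBelow : ∀ s → RowsBelow s
    rowsBelow zero    zero    m≤r I J incI incJ I<s = Pos-det₀ _
    rowsBelow zero    (suc m) m≤r I J incI incJ I<s = contradiction (I<s fzero) λ ()
    rowsBelow (suc s) zero    m≤r I J incI incJ I<s = Pos-det₀ _
    rowsBelow (suc s) (suc m) m≤r I J incI incJ I<s with I fzero in eqI | J fzero in eqJ
    ... | suc i | _ = nonzeroRows s (rowsBelow s) (suc m) m≤r I J incI incJ
      (λ a → ℕₚ.<-≤-trans (≡.subst (0 <_) (≡.sym eqI) z<s) (head-≤ incI a)) I<s
    ... | zero | suc j = Pos-resp (sym (det-row₀-zero m _ (λ b →
        trans (reflexive (≡.cong₂ W eqI (≡.sym (suc-pred′ (0<J b))))) (W₀ _)))) Pos-0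
      where
      0<J : ∀ b → 0 < J b
      0<J b = ℕₚ.<-≤-trans (≡.subst (0 <_) (≡.sym eqJ) z<s) (head-≤ incJ b)
    ... | zero | zero = Pos-resp (sym (det-row₀-head m _ (λ b →
        trans (reflexive (≡.cong₂ W eqI (≡.sym (suc-pred′ (0<J b))))) (W₀ _))))
      (Pos-* (Pos-resp (reflexive (≡.cong₂ W (≡.sym eqI) (≡.sym eqJ))) pos-W₀₀)
        (nonzeroRows s (rowsBelow s) m (suc-mono-≤∞ r m≤r) (I ∘ fsuc) (J ∘ fsuc)
          (tail-increasing incI) (tail-increasing incJ)
          (λ a → ℕₚ.≤-<-trans z≤n (incI fzero (fsuc a) z<s)) (I<s ∘ fsuc)))
      where
      0<J : ∀ b → 0 < J (fsuc b)
      0<J b = ℕₚ.≤-<-trans z≤n (incJ fzero (fsuc b) z<s)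

    TPos-output : TPos W
    TPos-output m m≤r I J incI incJ with strict-bound I
    ... | s , I<s = rowsBelow s m m≤r I J incI incJ I<s

  module Production (Q W : InfMatrix) (tpQ : TPos Q)
    (Q-hessenberg : ∀ k l → suc k < l → Q k l ≈ 0#)
    (pos-W₀₀ : Pos (W 0 0))
    (W-lower : ∀ i k → i < k → W i k ≈ 0#)
    (W-step : ∀ i k → W (suc i) k ≈ sum (suc i) (λ l → W i l * Q l k))
    where

    W-step′ : ∀ i k n → suc i ≤ n → W (suc i) k ≈ sum n (λ l → W i l * Q l k)
    W-step′ i k n i<n = trans (W-step i k)
      (sym (sum-truncate i<n (λ l i<l → trans (*-congʳ (W-lower i l i<l)) (zeroˡ _))))

    TPos-W : TPos W
    TPos-W = OutputMatrix.TPos-output Q W tpQ pos-W₀₀ (λ k → W-lower 0 (suc k) z<s)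
      (λ i k n h → W-step′ i k n (ℕₚ.≤-trans (s≤s (ℕₚ.≤-trans (ℕₚ.m≤m+n i k) (ℕₚ.n≤1+n _))) h))

    -- Column j is the j-th power of Q applied to the zeroth basis vector.
    V : InfMatrix
    V zero    zero    = 1#
    V (suc k) zero    = 0#
    V k       (suc j) = sum (suc (suc k)) (λ l → Q k l * V l j)

    V-step : ∀ k j n → suc (suc k) ≤ n → V k (suc j) ≈ sum n (λ l → Q k l * V l j)
    V-step k j n h = trans (unfold k)
      (sym (sum-truncate h (λ l k<l → trans (*-congʳ (Q-hessenberg k l k<l)) (zeroˡ _))))
      where
      unfold : ∀ k → V k (suc j) ≈ sum (suc (suc k)) (λ l → Q k l * V l j)
      unfold zero    = refl
      unfold (suc k) = refl

    -- Transposed, `V` is the output matrix of the transpose of Q with first row e₀.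
    TPos-V : TPos V
    TPos-V = TPos-transpose {flip V} (OutputMatrix.TPos-output (flip Q) (flip V) (TPos-transpose {Q} tpQ)
      Pos-1 (λ k → refl)
      (λ j k n h → trans (V-step k j n (ℕₚ.≤-trans (s≤s (s≤s (ℕₚ.m≤n+m k j))) h))
        (sum-cong n (λ l _ → *-comm _ _))))

    -- Both sides are c times the entry (0,0) of a power of Q, with the exponent split as i + j. The
    -- induction moves one factor Q at a time from the row vector to the column vector.
    hankel-product : ∀ j i n → suc i ≤ n → W (i +ℕ j) 0 ≈ sum n (λ k → W i k * V k j)
    hankel-product zero i (suc n) i<n = begin
      W (i +ℕ 0) 0                     ≡⟨ ≡.cong (λ h → W h 0) (ℕₚ.+-identityʳ i) ⟩
      W i 0                            ≈⟨ *-identityʳ _ ⟨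
      W i 0 * V 0 0                    ≈⟨ sum-head n (λ k → zeroʳ _) ⟨
      sum (suc n) (λ k → W i k * V k 0) ∎
    hankel-product (suc j) i n i<n = begin
      W (i +ℕ suc j) 0
        ≡⟨ ≡.cong (λ h → W h 0) (ℕₚ.+-suc i j) ⟩
      W (suc i +ℕ j) 0
        ≈⟨ hankel-product j (suc i) (suc n) (s≤s i<n) ⟩
      sum (suc n) (λ l → W (suc i) l * V l j)
        ≈⟨ sum-cong (suc n) (λ l _ → *-congʳ (W-step′ i l n i<n)) ⟩
      sum (suc n) (λ l → sum n (λ k → W i k * Q k l) * V l j)
        ≈⟨ sum-cong (suc n) (λ l _ → trans (sum-cong n (λ k _ → sym (*-assoc _ _ _))) (sum-*ʳ n _ _)) ⟨
      sum (suc n) (λ l → sum n (λ k → W i k * (Q k l * V l j)))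
        ≈⟨ sum-comm (suc n) n _ ⟩
      sum n (λ k → sum (suc n) (λ l → W i k * (Q k l * V l j)))
        ≈⟨ sum-cong n (λ k k<n → trans (sum-*ˡ (suc n) _ _) (*-congˡ (sym (V-step k j (suc n) (s≤s k<n))))) ⟩
      sum n (λ k → W i k * V k (suc j)) ∎

    TPos-hankel : TPos (λ i j → W (i +ℕ j) 0)
    TPos-hankel = TPos-product {_} {W} {V} (λ i j n h → hankel-product j i n (ℕₚ.<⇒≤ h)) TPos-W TPos-V

-- Factorial scaling of minors, and the factors of the production matrices

-- j!/k! for k ≤ j, and 0 otherwise.
factorialRatio : ℕ → ℕ → ℕ
factorialRatio j k = (j C k) *ℕ ((j ∸ k) !)

nCk*[n∸k]!*k! : ∀ {n k} → k ≤ n → (n C k) *ℕ ((n ∸ k) !) *ℕ (k !) ≡ n !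
nCk*[n∸k]!*k! {n} {k} k≤n = begin
  (n C k) *ℕ ((n ∸ k) !) *ℕ (k !)    ≡⟨ ℕₚ.*-assoc (n C k) _ _ ⟩
  (n C k) *ℕ ((n ∸ k) ! *ℕ k !)      ≡⟨ ≡.cong ((n C k) *ℕ_) (ℕₚ.*-comm ((n ∸ k) !) (k !)) ⟩
  (n C k) *ℕ (k ! *ℕ (n ∸ k) !)      ≡⟨ ≡.cong (_*ℕ (k ! *ℕ (n ∸ k) !)) (nCk≡n!/k![n-k]! k≤n) ⟩
  _                                  ≡⟨ m/n*n≡m (k![n∸k]!∣n! k≤n) ⟩
  n !                                ∎
  where
  open ≡.≡-Reasoning
  instance _ = k ℕₚ.!* (n ∸ k) !≢0

factorialRatio-vanishes : ∀ {j k} → j < k → factorialRatio j k ≡ 0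
factorialRatio-vanishes {j} {k} j<k = ≡.cong (_*ℕ ((j ∸ k) !)) (k>n⇒nCk≡0 j<k)

∏-nonZero : ∀ m (f : Fin m → ℕ) → (∀ i → NonZero (f i)) → NonZero (∏.sum f)
∏-nonZero zero    f h = _
∏-nonZero (suc m) f h = ℕₚ.m*n≢0 (f fzero) _ {{h fzero}} {{∏-nonZero m (f ∘ fsuc) (h ∘ fsuc)}}

module Scaling {c ℓ p} (R : CommutativeRing c ℓ) (C : Cone R p) (r : ℕ∞) where
  open CommutativeRing R hiding (zero)
  open Cone C
  open Determinant R
  open TotalPositivity R C r
  open import Algebra.Properties.Semiring.Mult semiring using (×-congʳ; ×-congˡ; ×-assocˡ; ×-assoc-*; ×-comm-*)
    renaming (_×_ to _·_)
  open import Relation.Binary.Reasoning.Setoid setoid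

  Pos-· : ∀ n {x} → Pos x → Pos (n · x)
  Pos-· zero    px = Pos-0
  Pos-· (suc n) px = Pos-+ px (Pos-· n px)

  ·-zero : ∀ n {x} → x ≈ 0# → n · x ≈ 0#
  ·-zero n e = trans (×-congʳ n (trans e (sym (zeroʳ 0#)))) (trans (sym (×-comm-* n 0# 0#)) (zeroˡ _))

  ·-*-· : ∀ m n x y → (m · x) * (n · y) ≈ (m *ℕ n) · (x * y)
  ·-*-· m n x y = trans (×-assoc-* m x _) (trans (×-congʳ m (×-comm-* n x y)) (×-assocˡ _ m n))

  alt-· : ∀ m n (f : Fin m → Carrier) → alt m (λ i → n · f i) ≈ n · alt m f
  alt-· m n f = begin
    alt m (λ i → n · f i)        ≈⟨ alt-cong m (λ i → trans (×-assoc-* n 1# _) (×-congʳ n (*-identityˡ _))) ⟨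
    alt m (λ i → (n · 1#) * f i) ≈⟨ alt-*ˡ m _ f ⟩
    (n · 1#) * alt m f           ≈⟨ trans (×-assoc-* n 1# _) (×-congʳ n (*-identityˡ _)) ⟩
    n · alt m f                  ∎

  -- The weight w is the quotient d i / e j, stated multiplied out and demanded only where the entry
  -- of A may be nonzero. For factorials the quotient is a natural number only on and below the
  -- diagonal.
  module _ (A : InfMatrix) (w : ℕ → ℕ → ℕ) (d e : ℕ → ℕ) (e≢0 : ∀ j → NonZero (e j))
    (w-ratio : ∀ i j → (w i j *ℕ e j ≡ d i) ⊎ (A i j ≈ 0#)) where

    private
      wA : InfMatrix
      wA i j = w i j · A i j

      split : ∀ (J : Fin (suc m) → ℕ) {N a b} j → w a (J j) *ℕ e (J j) ≡ d a →
              N *ℕ ∏.sum (e ∘ J ∘ punchIn j) ≡ b → w a (J j) *ℕ N *ℕ ∏.sum (e ∘ J) ≡ d a *ℕ b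
      split J {N} {a} j p q = ≡.trans (≡.cong (w a (J j) *ℕ N *ℕ_) (∏.sum-remove {i = j} (e ∘ J)))
        (≡.trans (*ℕ-interchange (w a (J j)) N (e (J j)) _) (≡.cong₂ _*ℕ_ p q))

    -- All permutation products of a minor carry the same integer ∏d/∏e; if it
    -- is not an integer then every product vanishes.
    scaled-minor : ∀ m (I J : Fin m → ℕ) →
      (∃ λ N → N *ℕ ∏.sum (e ∘ J) ≡ ∏.sum (d ∘ I) ×
               Det m (λ a b → wA (I a) (J b)) ≈ N · Det m (λ a b → A (I a) (J b)))
      ⊎ (Det m (λ a b → wA (I a) (J b)) ≈ 0# × Det m (λ a b → A (I a) (J b)) ≈ 0#)
    scaled-minor zero    I J = inj₁ (1 , ≡.refl , trans (det₀ _) (trans (sym (det₀ _)) (sym (+-identityʳ _))))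
    scaled-minor (suc m) I J with ∏.sum (e ∘ J) ∣? ∏.sum (d ∘ I)
    ... | yes (divides N eqN) = inj₁ (N , ≡.sym eqN , (begin
      Det (suc m) (λ a b → wA (I a) (J b))     ≈⟨ det-row₀ m _ ⟩
      alt (suc m) (λ j → wA (I fzero) (J j) * Det m (λ a b → wA (I (fsuc a)) (J (punchIn j b))))
        ≈⟨ alt-cong (suc m) term ⟩
      alt (suc m) (λ j → N · (A (I fzero) (J j) * Det m (λ a b → A (I (fsuc a)) (J (punchIn j b)))))
        ≈⟨ trans (alt-· (suc m) N _) (×-congʳ N (sym (det-row₀ m _))) ⟩
      N · Det (suc m) (λ a b → A (I a) (J b)) ∎))
      where
      term : ∀ j → wA (I fzero) (J j) * Det m (λ a b → wA (I (fsuc a)) (J (punchIn j b))) ≈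
                   N · (A (I fzero) (J j) * Det m (λ a b → A (I (fsuc a)) (J (punchIn j b))))
      term j with w-ratio (I fzero) (J j) | scaled-minor m (I ∘ fsuc) (J ∘ punchIn j)
      ... | inj₂ A≈0 | _ = trans (trans (*-congʳ (·-zero (w (I fzero) (J j)) A≈0)) (zeroˡ _))
                             (sym (·-zero N (trans (*-congʳ A≈0) (zeroˡ _))))
      -- A cofactor can have a non-integral quotient although the whole minor has an integral one.
      -- This is why the second alternative records that both the scaled and the unscaled minor
      -- vanish.
      ... | inj₁ _ | inj₂ (B≈0 , A≈0) = trans (trans (*-congˡ B≈0) (zeroʳ _))
                             (sym (·-zero N (trans (*-congˡ A≈0) (zeroʳ _))))
      ... | inj₁ w*e≡d | inj₁ (N′ , eqN′ , Det≈) =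
        trans (*-congˡ Det≈) (trans (·-*-· (w (I fzero) (J j)) N′ _ _) (×-congˡ w*N′≡N))
        where
        w*N′≡N : w (I fzero) (J j) *ℕ N′ ≡ N
        w*N′≡N = ℕₚ.*-cancelʳ-≡ _ _ (∏.sum (e ∘ J)) {{∏-nonZero (suc m) _ (e≢0 ∘ J)}} (≡.trans (split J j w*e≡d eqN′) eqN)
    ... | no ∤ = inj₂ (trans (det-row₀ m _) (alt-zero (suc m) (proj₁ ∘ term)) ,
                       trans (det-row₀ m _) (alt-zero (suc m) (proj₂ ∘ term)))
      where
      term : ∀ j → wA (I fzero) (J j) * Det m (λ a b → wA (I (fsuc a)) (J (punchIn j b))) ≈ 0# ×
                   A (I fzero) (J j) * Det m (λ a b → A (I (fsuc a)) (J (punchIn j b))) ≈ 0#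
      term j with w-ratio (I fzero) (J j) | scaled-minor m (I ∘ fsuc) (J ∘ punchIn j)
      ... | inj₂ A≈0 | _ = trans (*-congʳ (·-zero (w (I fzero) (J j)) A≈0)) (zeroˡ _) ,
                           trans (*-congʳ A≈0) (zeroˡ _)
      ... | inj₁ _ | inj₂ (B≈0 , A≈0) = trans (*-congˡ B≈0) (zeroʳ _) , trans (*-congˡ A≈0) (zeroʳ _)
      ... | inj₁ w*e≡d | inj₁ (N′ , eqN′ , _) = contradiction
        (divides (w (I fzero) (J j) *ℕ N′) (≡.sym (split J j w*e≡d eqN′))) ∤

    TPos-scaled : TPos A → TPos wA
    TPos-scaled tp m m≤r I J incI incJ with scaled-minor m I J
    ... | inj₁ (N , _ , e) = Pos-resp (sym e) (Pos-· N (tp m m≤r I J incI incJ))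
    ... | inj₂ (e , _)     = Pos-resp (sym e) Pos-0

  -- The matrix M: the Toeplitz matrix conjugated by diag(n!), written without division.
  weightedToeplitz : (ℕ → Carrier) → InfMatrix
  weightedToeplitz φ i k = factorialRatio i k · ToeplitzMatrix ordered φ i k

  Toeplitz-upper : ∀ φ i k → i < k → ToeplitzMatrix ordered φ i k ≈ 0#
  Toeplitz-upper φ i k i<k with k <ᵇ suc i in eq
  ... | false = refl
  ... | true  = contradiction (s≤s⁻¹ (ℕₚ.<ᵇ⇒< k (suc i) (≡.subst T (≡.sym eq) tt))) (ℕₚ.<⇒≱ i<k)

  weightedToeplitz-upper : ∀ φ i k → i < k → weightedToeplitz φ i k ≈ 0#
  weightedToeplitz-upper φ i k i<k = ×-congˡ {ToeplitzMatrix ordered φ i k} (factorialRatio-vanishes i<k)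

  TPos-weightedToeplitz : ∀ φ → ToeplitzTP ordered r φ → TPos (weightedToeplitz φ)
  TPos-weightedToeplitz φ tp = TPos-scaled (ToeplitzMatrix ordered φ) factorialRatio _! _! ℕₚ._!≢0 ratio
    (fromTP {ToeplitzMatrix ordered φ} tp)
    where
    ratio : ∀ i j → (factorialRatio i j *ℕ (j !) ≡ i !) ⊎ (ToeplitzMatrix ordered φ i j ≈ 0#)
    ratio i j with j ℕₚ.≤? i
    ... | yes j≤i = inj₁ (nCk*[n∸k]!*k! j≤i)
    ... | no  j≰i = inj₂ (Toeplitz-upper φ i j (ℕₚ.≰⇒> j≰i))

  -- Right multiplication by the shift Δ.
  prependZeroColumn : InfMatrix → InfMatrix
  prependZeroColumn M i zero    = 0#
  prependZeroColumn M i (suc k) = M i k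

  TPos-prependZeroColumn : ∀ {M} → TPos M → TPos (prependZeroColumn M)
  TPos-prependZeroColumn tp zero       m≤r I J incI incJ = Pos-det₀ _
  TPos-prependZeroColumn {M} tp (suc m) m≤r I J incI incJ with J fzero in eqJ
  ... | zero  = Pos-resp (sym (det-col₀-zero m _ (λ a → reflexive (≡.cong (prependZeroColumn M (I a)) eqJ)))) Pos-0
  ... | suc j = Pos-resp (det-cong (suc m) (λ a b →
      reflexive (≡.cong (prependZeroColumn M (I a)) (suc-pred′ (0<J b)))))
    (tp (suc m) m≤r I (pred ∘ J) incI (pred-increasing 0<J incJ))
    where
    0<J : ∀ b → 0 < J b
    0<J b = ℕₚ.<-≤-trans (≡.subst (0 <_) (≡.sym eqJ) z<s) (head-≤ incJ b)

  -- The matrix Δ + y I.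
  bidiagonal : Carrier → InfMatrix
  bidiagonal y zero    zero          = y
  bidiagonal y zero    (suc zero)    = 1#
  bidiagonal y zero    (suc (suc k)) = 0#
  bidiagonal y (suc l) zero          = 0#
  bidiagonal y (suc l) (suc k)       = bidiagonal y l k

  bidiagonal-lower : ∀ y l k → k < l → bidiagonal y l k ≈ 0#
  bidiagonal-lower y (suc l) zero    _         = refl
  bidiagonal-lower y (suc l) (suc k) (s≤s k<l) = bidiagonal-lower y l k k<l

  bidiagonal-upper : ∀ y l k → suc l < k → bidiagonal y l k ≈ 0#
  bidiagonal-upper y zero    (suc (suc k)) _         = refl
  bidiagonal-upper y (suc l) (suc k)       (s≤s l<k) = bidiagonal-upper y l k l<k
  bidiagonal-upper y zero    (suc zero)    (s≤s ())

  bidiagonal-nonneg : ∀ y → Pos y → ∀ l k → Pos (bidiagonal y l k)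
  bidiagonal-nonneg y py zero    zero          = py
  bidiagonal-nonneg y py zero    (suc zero)    = Pos-1
  bidiagonal-nonneg y py zero    (suc (suc k)) = Pos-0
  bidiagonal-nonneg y py (suc l) zero          = Pos-0
  bidiagonal-nonneg y py (suc l) (suc k)       = bidiagonal-nonneg y py l k

  -- The first row or the first column of a minor has at most its corner nonzero.
  TPos-bidiagonal : ∀ y → Pos y → TPos (bidiagonal y)
  TPos-bidiagonal y py zero    m≤r I J incI incJ = Pos-det₀ _
  TPos-bidiagonal y py (suc m) m≤r I J incI incJ with I fzero ℕₚ.<? J fzero
  ... | yes i<j = Pos-resp (sym (det-row₀-head m _ (λ b → bidiagonal-upper y _ _
      (ℕₚ.≤-<-trans i<j (incJ fzero (fsuc b) z<s)))))
    (Pos-* (bidiagonal-nonneg y py (I fzero) (J fzero)) (TPos-bidiagonal y py m (suc-mono-≤∞ r m≤r) _ _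
      (tail-increasing incI) (tail-increasing incJ)))
  ... | no  i≮j = Pos-resp (sym (det-col₀-head m _ (λ a → bidiagonal-lower y _ _
      (ℕₚ.≤-<-trans (ℕₚ.≮⇒≥ i≮j) (incI fzero (fsuc a) z<s)))))
    (Pos-* (bidiagonal-nonneg y py (I fzero) (J fzero)) (TPos-bidiagonal y py m (suc-mono-≤∞ r m≤r) _ _
      (tail-increasing incI) (tail-increasing incJ)))

  sum-bidiagonal₀ : ∀ y n (f : ℕ → Carrier) → (∀ k → n ≤ k → f k ≈ 0#) → sum n (λ l → f l * bidiagonal y l 0) ≈ f 0 * y
  sum-bidiagonal₀ y zero    f h = trans (sum₀ _) (sym (trans (*-congʳ (h 0 z≤n)) (zeroˡ y)))
  sum-bidiagonal₀ y (suc n) f h = sum-head n (λ l → zeroʳ _)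

  -- Vanishing of f from n on makes the truncated sum correct for every k, also for k = n - 1, whose
  -- second term lies outside the sum.
  sum-bidiagonal : ∀ y n (f : ℕ → Carrier) → (∀ k → n ≤ k → f k ≈ 0#) → ∀ k →
                   sum n (λ l → f l * bidiagonal y l (suc k)) ≈ f k + f (suc k) * y
  sum-bidiagonal y zero    f h k = trans (sum₀ _)
    (sym (trans (+-cong (h k z≤n) (trans (*-congʳ (h (suc k) z≤n)) (zeroˡ y))) (+-identityʳ 0#)))
  sum-bidiagonal y (suc n) f h zero = trans (sum-suc n _)
    (+-cong (*-identityʳ _) (sum-bidiagonal₀ y n (f ∘ suc) (λ k n≤k → h (suc k) (s≤s n≤k))))
  sum-bidiagonal y (suc n) f h (suc k) = trans (sum-suc n _)
    (trans (+-congʳ (zeroʳ _)) (trans (+-identityˡ _)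
      (sum-bidiagonal y n (f ∘ suc) (λ k n≤k → h (suc k) (s≤s n≤k)) k)))

-- The polynomial ring with its coefficientwise order

module DetHomomorphism {c ℓ c′ ℓ′} (R : CommutativeRing c ℓ) (S : CommutativeRing c′ ℓ′)
  (h : CommutativeRing.Carrier R → CommutativeRing.Carrier S)
  (h-homo : IsRingHomomorphism (CommutativeRing.rawRing R) (CommutativeRing.rawRing S) h) where
  private
    module S = CommutativeRing S
    module H = IsRingHomomorphism h-homo
    module DR = Determinant R
    module DS = Determinant S

  alt-homo : ∀ m f → h (DR.alt m f) S.≈ DS.alt m (h ∘ f)
  alt-homo zero    f = S.trans (H.⟦⟧-cong (DR.alt₀ f)) (S.trans H.0#-homo (S.sym (DS.alt₀ _)))
  alt-homo (suc m) f = S.trans (H.⟦⟧-cong (DR.alt-suc m f)) (S.trans (H.+-homo _ _)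
    (S.trans (S.+-congˡ (S.trans (H.-‿homo _) (S.-‿cong (alt-homo m (f ∘ fsuc))))) (S.sym (DS.alt-suc m _))))

  det-homo : ∀ m A → h (DR.Det m A) S.≈ DS.Det m (λ i j → h (A i j))
  det-homo zero    A = S.trans (H.⟦⟧-cong (DR.det₀ A)) (S.trans H.1#-homo (S.sym (DS.det₀ _)))
  det-homo (suc m) A = S.trans (H.⟦⟧-cong (DR.det-row₀ m A)) (S.trans (alt-homo (suc m) _)
    (S.trans (DS.alt-cong (suc m) (λ j → S.trans (H.*-homo _ _) (S.*-congˡ (det-homo m _)))) (S.sym (DS.det-row₀ m _))))

module PolynomialRing {c ℓ} (R : POCommRing c ℓ) where
  open POCommRing R hiding (zero)
  open Poly R
  open Determinant commRing using (+-interchange; -0#≈0#)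
  open import Relation.Binary.Reasoning.Setoid setoid

  private
    Seq : Set c
    Seq = ℕ → Carrier

  -- The Cauchy product. Equality of polynomials is equality of coefficient sequences, so the
  -- multiplicative laws are proved for sequences and carried back by `coeff-*`.
  _⊛_ : Seq → Seq → Seq
  (f ⊛ g) zero    = f 0 * g 0
  (f ⊛ g) (suc k) = f 0 * g (suc k) + ((f ∘ suc) ⊛ g) k

  ⊛-cong : ∀ {f f′ g g′} → (∀ k → f k ≈ f′ k) → (∀ k → g k ≈ g′ k) → ∀ k → (f ⊛ g) k ≈ (f′ ⊛ g′) k
  ⊛-cong e e′ zero    = *-cong (e 0) (e′ 0)
  ⊛-cong e e′ (suc k) = +-cong (*-cong (e 0) (e′ (suc k))) (⊛-cong (e ∘ suc) e′ k)

  -- The mirror image of the defining recursion, peeling off g 0 in place of f 0; comparing the two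
  -- recursions yields commutativity.
  ⊛-suc : ∀ f g k → (f ⊛ g) (suc k) ≈ f (suc k) * g 0 + (f ⊛ (g ∘ suc)) k
  ⊛-suc f g zero    = +-comm _ _
  ⊛-suc f g (suc k) = begin
    f 0 * g (suc (suc k)) + ((f ∘ suc) ⊛ g) (suc k)
      ≈⟨ +-congˡ (⊛-suc (f ∘ suc) g k) ⟩
    f 0 * g (suc (suc k)) + (f (suc (suc k)) * g 0 + ((f ∘ suc) ⊛ (g ∘ suc)) k)
      ≈⟨ trans (sym (+-assoc _ _ _)) (trans (+-congʳ (+-comm _ _)) (+-assoc _ _ _)) ⟩
    f (suc (suc k)) * g 0 + (f ⊛ (g ∘ suc)) (suc k) ∎

  ⊛-comm : ∀ f g k → (f ⊛ g) k ≈ (g ⊛ f) k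
  ⊛-comm f g zero    = *-comm _ _
  ⊛-comm f g (suc k) = trans (⊛-suc f g k) (+-cong (*-comm _ _) (⊛-comm f (g ∘ suc) k))

  ⊛-distribʳ : ∀ f g h k → ((λ i → f i + g i) ⊛ h) k ≈ (f ⊛ h) k + (g ⊛ h) k
  ⊛-distribʳ f g h zero    = distribʳ _ _ _
  ⊛-distribʳ f g h (suc k) = trans (+-cong (distribʳ _ _ _) (⊛-distribʳ (f ∘ suc) (g ∘ suc) h k))
    (+-interchange _ _ _ _)

  ⊛-*ˡ : ∀ a f g k → ((λ i → a * f i) ⊛ g) k ≈ a * (f ⊛ g) k
  ⊛-*ˡ a f g zero    = *-assoc _ _ _
  ⊛-*ˡ a f g (suc k) = trans (+-cong (*-assoc _ _ _) (⊛-*ˡ a (f ∘ suc) g k)) (sym (distribˡ _ _ _))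

  ⊛-assoc : ∀ f g h k → ((f ⊛ g) ⊛ h) k ≈ (f ⊛ (g ⊛ h)) k
  ⊛-assoc f g h zero    = *-assoc _ _ _
  ⊛-assoc f g h (suc k) = begin
    f 0 * g 0 * h (suc k) + (((f ⊛ g) ∘ suc) ⊛ h) k
      ≈⟨ +-cong (*-assoc _ _ _) (trans (⊛-distribʳ _ _ h k)
           (+-cong (⊛-*ˡ (f 0) (g ∘ suc) h k) (⊛-assoc (f ∘ suc) g h k))) ⟩
    f 0 * (g 0 * h (suc k)) + (f 0 * ((g ∘ suc) ⊛ h) k + ((f ∘ suc) ⊛ (g ⊛ h)) k)
      ≈⟨ +-assoc _ _ _ ⟨
    f 0 * (g 0 * h (suc k)) + f 0 * ((g ∘ suc) ⊛ h) k + ((f ∘ suc) ⊛ (g ⊛ h)) k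
      ≈⟨ +-congʳ (distribˡ _ _ _) ⟨
    (f ⊛ (g ⊛ h)) (suc k) ∎

  ⊛-zeroˡ : ∀ f g → (∀ k → f k ≈ 0#) → ∀ k → (f ⊛ g) k ≈ 0#
  ⊛-zeroˡ f g e zero    = trans (*-congʳ (e 0)) (zeroˡ _)
  ⊛-zeroˡ f g e (suc k) = trans (+-cong (trans (*-congʳ (e 0)) (zeroˡ _)) (⊛-zeroˡ (f ∘ suc) g (e ∘ suc) k))
    (+-identityʳ 0#)

  ⊛-constˡ : ∀ f g → (∀ k → f (suc k) ≈ 0#) → ∀ k → (f ⊛ g) k ≈ f 0 * g k
  ⊛-constˡ f g e zero    = refl
  ⊛-constˡ f g e (suc k) = trans (+-congˡ (⊛-zeroˡ (f ∘ suc) g e k)) (+-identityʳ _)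

  coeff-+ : ∀ p q k → coeff (p +ₚ q) k ≈ coeff p k + coeff q k
  coeff-+ []      q       k       = sym (+-identityˡ _)
  coeff-+ (a ∷ p) []      k       = sym (+-identityʳ _)
  coeff-+ (a ∷ p) (b ∷ q) zero    = refl
  coeff-+ (a ∷ p) (b ∷ q) (suc k) = coeff-+ p q k

  coeff-neg : ∀ p k → coeff (-ₚ p) k ≈ - coeff p k
  coeff-neg []      k       = sym -0#≈0#
  coeff-neg (a ∷ p) zero    = refl
  coeff-neg (a ∷ p) (suc k) = coeff-neg p k

  coeff-map-* : ∀ a p k → coeff (map (a *_) p) k ≈ a * coeff p k
  coeff-map-* a []      k       = sym (zeroʳ a)
  coeff-map-* a (b ∷ p) zero    = refl
  coeff-map-* a (b ∷ p) (suc k) = coeff-map-* a p k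

  coeff-* : ∀ p q k → coeff (p *ₚ q) k ≈ (coeff p ⊛ coeff q) k
  coeff-* []      q k       = sym (⊛-zeroˡ (coeff []) (coeff q) (λ _ → refl) k)
  coeff-* (a ∷ p) q zero    = trans (coeff-+ (map (a *_) q) _ 0) (trans (+-identityʳ _) (coeff-map-* a q 0))
  coeff-* (a ∷ p) q (suc k) = trans (coeff-+ (map (a *_) q) _ (suc k))
    (+-cong (coeff-map-* a q (suc k)) (coeff-* p q k))

  polyRing : CommutativeRing c ℓ
  polyRing = record
    { Carrier = P ; _≈_ = _≈ₚ_ ; _+_ = _+ₚ_ ; _*_ = _*ₚ_ ; -_ = -ₚ_ ; 0# = [] ; 1# = 1# ∷ []
    ; isCommutativeRing = record
      { isRing = record
        { +-isAbelianGroup = record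
          { isGroup = record
            { isMonoid = record
              { isSemigroup = record
                { isMagma = record
                  { isEquivalence = record
                    { refl = λ k → refl ; sym = λ e k → sym (e k) ; trans = λ e e′ k → trans (e k) (e′ k) }
                  ; ∙-cong = λ {p} {p′} {q} {q′} e e′ k → trans (coeff-+ p q k)
                      (trans (+-cong (e k) (e′ k)) (sym (coeff-+ p′ q′ k)))
                  }
                ; assoc = λ p q s k → trans (trans (coeff-+ (p +ₚ q) s k) (+-congʳ (coeff-+ p q k)))
                    (trans (+-assoc _ _ _) (sym (trans (coeff-+ p (q +ₚ s) k) (+-congˡ (coeff-+ q s k)))))
                }
              ; identity = (λ p k → refl) , (λ p k → trans (coeff-+ p [] k) (+-identityʳ _))
              }
            ; inverse = (λ p k → trans (coeff-+ (-ₚ p) p k) (trans (+-congʳ (coeff-neg p k)) (-‿inverseˡ _)))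
                      , (λ p k → trans (coeff-+ p (-ₚ p) k) (trans (+-congˡ (coeff-neg p k)) (-‿inverseʳ _)))
            ; ⁻¹-cong = λ {p} {q} e k → trans (coeff-neg p k) (trans (-‿cong (e k)) (sym (coeff-neg q k)))
            }
          ; comm = λ p q k → trans (coeff-+ p q k) (trans (+-comm _ _) (sym (coeff-+ q p k)))
          }
        ; *-cong = λ {p} {p′} {q} {q′} e e′ k → trans (coeff-* p q k)
            (trans (⊛-cong e e′ k) (sym (coeff-* p′ q′ k)))
        ; *-assoc = λ p q s k → trans (trans (coeff-* (p *ₚ q) s k) (⊛-cong (coeff-* p q) (λ _ → refl) k))
            (trans (⊛-assoc (coeff p) (coeff q) (coeff s) k)
              (sym (trans (coeff-* p (q *ₚ s) k) (⊛-cong {coeff p} (λ _ → refl) (coeff-* q s) k))))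
        ; *-identity = *ₚ-identityˡ , (λ p k → trans (*ₚ-comm p (1# ∷ []) k) (*ₚ-identityˡ p k))
        ; distrib = (λ p q s k → trans (*ₚ-comm p (q +ₚ s) k) (trans (*ₚ-distribʳ p q s k)
              (trans (coeff-+ (q *ₚ p) (s *ₚ p) k) (trans (+-cong (*ₚ-comm q p k) (*ₚ-comm s p k))
                (sym (coeff-+ (p *ₚ q) (p *ₚ s) k))))))
            , *ₚ-distribʳ
        }
      ; *-comm = *ₚ-comm
      }
    }
    where
    *ₚ-comm : ∀ p q → (p *ₚ q) ≈ₚ (q *ₚ p)
    *ₚ-comm p q k = trans (coeff-* p q k) (trans (⊛-comm (coeff p) (coeff q) k) (sym (coeff-* q p k)))
    *ₚ-identityˡ : ∀ p → ((1# ∷ []) *ₚ p) ≈ₚ p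
    *ₚ-identityˡ p k = trans (coeff-* (1# ∷ []) p k)
      (trans (⊛-constˡ (coeff (1# ∷ [])) (coeff p) (λ _ → refl) k) (*-identityˡ _))
    *ₚ-distribʳ : ∀ p q s → ((q +ₚ s) *ₚ p) ≈ₚ ((q *ₚ p) +ₚ (s *ₚ p))
    *ₚ-distribʳ p q s k = trans (coeff-* (q +ₚ s) p k) (trans (⊛-cong (coeff-+ q s) (λ _ → refl) k)
      (trans (⊛-distribʳ (coeff q) (coeff s) (coeff p) k)
        (sym (trans (coeff-+ (q *ₚ p) (s *ₚ p) k) (+-cong (coeff-* q p k) (coeff-* s p k))))))

  cone : Cone commRing ℓ
  cone = record { Pos = Pos ; Pos-resp = Pos-resp ; Pos-0 = Pos-0 ; Pos-1 = Pos-1 ; Pos-+ = Pos-+ ; Pos-* = Pos-* }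

  -- Nonnegativity is a property of a list, while equality ignores trailing zeros. Passing to all
  -- coefficients, where those past the end are covered by `Pos-0`, makes it invariant under
  -- equality.
  All⇒coeff : ∀ {p} → All Pos p → ∀ k → Pos (coeff p k)
  All⇒coeff []         k       = Pos-0
  All⇒coeff (pa ∷ pp)  zero    = pa
  All⇒coeff (pa ∷ pp)  (suc k) = All⇒coeff pp k

  coeff⇒All : ∀ p → (∀ k → Pos (coeff p k)) → All Pos p
  coeff⇒All []      h = []
  coeff⇒All (a ∷ p) h = h 0 ∷ coeff⇒All p (h ∘ suc)

  Pos-⊛ : ∀ f g → (∀ k → Pos (f k)) → (∀ k → Pos (g k)) → ∀ k → Pos ((f ⊛ g) k)
  Pos-⊛ f g pf pg zero    = Pos-* (pf 0) (pg 0)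
  Pos-⊛ f g pf pg (suc k) = Pos-+ (Pos-* (pf 0) (pg (suc k))) (Pos-⊛ (f ∘ suc) g (pf ∘ suc) pg k)

  polyCone : Cone polyRing (c ⊔ ℓ)
  polyCone = record
    { Pos      = All Pos
    ; Pos-resp = λ {p} {q} e pp → coeff⇒All q (λ k → Pos-resp (e k) (All⇒coeff pp k))
    ; Pos-0    = []
    ; Pos-1    = Pos-1 ∷ []
    ; Pos-+    = λ {p} {q} pp pq → coeff⇒All _ (λ k →
                   Pos-resp (sym (coeff-+ p q k)) (Pos-+ (All⇒coeff pp k) (All⇒coeff pq k)))
    ; Pos-*    = λ {p} {q} pp pq → coeff⇒All _ (λ k →
                   Pos-resp (sym (coeff-* p q k)) (Pos-⊛ _ _ (All⇒coeff pp) (All⇒coeff pq) k))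
    }

  const : Carrier → P
  const a = a ∷ []

  y : P
  y = 0# ∷ 1# ∷ []

  private module R[y] = CommutativeRing polyRing

  const-cong : ∀ {a b} → a ≈ b → const a ≈ₚ const b
  const-cong e zero    = e
  const-cong e (suc k) = refl

  const-0 : const 0# ≈ₚ []
  const-0 zero    = refl
  const-0 (suc k) = refl

  coeff-*-const : ∀ p a k → coeff (p *ₚ const a) k ≈ coeff p k * a
  coeff-*-const p a k = trans (R[y].*-comm p (const a) k) (trans (coeff-* (const a) p k)
    (trans (⊛-constˡ _ (coeff p) (λ _ → refl) k) (*-comm _ _)))

  coeff-*-y₀ : ∀ p → coeff (p *ₚ y) 0 ≈ 0#
  coeff-*-y₀ p = trans (coeff-* p y 0) (zeroʳ _)

  coeff-*-y : ∀ p k → coeff (p *ₚ y) (suc k) ≈ coeff p k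
  coeff-*-y p k = trans (R[y].*-comm p y (suc k)) (trans (coeff-* y p (suc k))
    (trans (+-cong (zeroˡ _) (⊛-constˡ (coeff y ∘ suc) (coeff p) (λ _ → refl) k))
      (trans (+-identityˡ _) (*-identityˡ _))))

  private
    module DR = Determinant commRing
    module DP = Determinant polyRing

  coeff-sum : ∀ n f k → coeff (DP.sum n f) k ≈ DR.sum n (λ i → coeff (f i) k)
  coeff-sum zero    f k = trans (DP.sum₀ f k) (sym (DR.sum₀ _))
  coeff-sum (suc n) f k = trans (DP.sum-suc n f k) (trans (coeff-+ (f 0) _ k)
    (trans (+-congˡ (coeff-sum n (f ∘ suc) k)) (sym (DR.sum-suc n _))))

  const-homo : IsRingHomomorphism rawRing rawPoly const
  const-homo = record
    { isSemiringHomomorphism = record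
      { isNearSemiringHomomorphism = record
        { +-isMonoidHomomorphism = record
          { isMagmaHomomorphism = record
            { isRelHomomorphism = record { cong = const-cong }
            ; homo = λ a b k → refl
            }
          ; ε-homo = const-0
          }
        ; *-homo = λ { a b zero → sym (+-identityʳ _) ; a b (suc k) → refl }
        }
      ; 1#-homo = λ k → refl
      }
    ; -‿homo = λ a k → refl
    }

  TPos-const : ∀ r {M} → TotalPositivity.TPos commRing cone r M →
               TotalPositivity.TPos polyRing polyCone r (λ i j → const (M i j))
  TPos-const r tp m m≤r I J incI incJ = Cone.Pos-resp polyCone
    (DetHomomorphism.det-homo commRing polyRing const const-homo m _)
    (tp m m≤r I J incI incJ ∷ [])

-- Binomial identities behind the divided derivatives

C-factorialRatio : ∀ s d k → d +ℕ k ≤ s → (s C d) *ℕ factorialRatio (s ∸ d) k *ℕ (d ! *ℕ k !) ≡ s !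
C-factorialRatio s d k d+k≤s = begin
  (s C d) *ℕ factorialRatio (s ∸ d) k *ℕ (d ! *ℕ k !)
    ≡⟨ ≡.cong ((s C d) *ℕ factorialRatio (s ∸ d) k *ℕ_) (ℕₚ.*-comm (d !) (k !)) ⟩
  (s C d) *ℕ factorialRatio (s ∸ d) k *ℕ (k ! *ℕ d !)
    ≡⟨ ℕₚ.*-assoc ((s C d) *ℕ factorialRatio (s ∸ d) k) (k !) (d !) ⟨
  (s C d) *ℕ factorialRatio (s ∸ d) k *ℕ k ! *ℕ d !
    ≡⟨ ≡.cong (_*ℕ d !) (ℕₚ.*-assoc (s C d) (factorialRatio (s ∸ d) k) (k !)) ⟩
  (s C d) *ℕ (factorialRatio (s ∸ d) k *ℕ k !) *ℕ d !
    ≡⟨ ≡.cong (λ x → (s C d) *ℕ x *ℕ d !) (nCk*[n∸k]!*k! (ℕₚ.m+n≤o⇒m≤o∸n k (≡.subst (_≤ s) (ℕₚ.+-comm d k) d+k≤s))) ⟩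
  (s C d) *ℕ (s ∸ d) ! *ℕ d !
    ≡⟨ nCk*[n∸k]!*k! (ℕₚ.m+n≤o⇒m≤o d d+k≤s) ⟩
  s ! ∎
  where open ≡.≡-Reasoning

-- By `C-factorialRatio` each product on the left is s! over two factorials. Over the common
-- denominator (d+1)! (k+1)! the three terms become (k+1) s!, (d+1) s! and (k+d+2) s!.
choose-pascal : ∀ s d k → suc d +ℕ k ≤ s →
  (s C suc d) *ℕ factorialRatio (s ∸ suc d) k +ℕ (s C d) *ℕ factorialRatio (s ∸ d) (suc k) ≡
  ((suc k +ℕ suc d) C suc d) *ℕ factorialRatio s (k +ℕ suc d)
choose-pascal s d k h = ℕₚ.*-cancelʳ-≡ (X +ℕ Y) Z (suc d ! *ℕ suc k !) {{suc d ℕₚ.!* suc k !≢0}} (begin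
  (X +ℕ Y) *ℕ (suc d ! *ℕ suc k !)
    ≡⟨ ℕₚ.*-distribʳ-+ (suc d ! *ℕ suc k !) X Y ⟩
  X *ℕ (suc d ! *ℕ suc k !) +ℕ Y *ℕ (suc d ! *ℕ suc k !)
    ≡⟨ ≡.cong₂ _+ℕ_ (pullʳ X (suc d !) (suc k) (k !)) (pullˡ Y (suc d) (d !) (suc k !)) ⟩
  suc k *ℕ (X *ℕ (suc d ! *ℕ k !)) +ℕ suc d *ℕ (Y *ℕ (d ! *ℕ suc k !))
    ≡⟨ ≡.cong₂ (λ x y → suc k *ℕ x +ℕ suc d *ℕ y) (C-factorialRatio s (suc d) k h)
         (C-factorialRatio s d (suc k) (≡.subst (_≤ s) (≡.sym (ℕₚ.+-suc d k)) h)) ⟩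
  suc k *ℕ s ! +ℕ suc d *ℕ s !
    ≡⟨ ℕₚ.*-distribʳ-+ (s !) (suc k) (suc d) ⟨
  (suc k +ℕ suc d) *ℕ s !
    ≡⟨ ≡.cong ((suc k +ℕ suc d) *ℕ_) (nCk*[n∸k]!*k! k+d≤s) ⟨
  (suc k +ℕ suc d) *ℕ (factorialRatio s (k +ℕ suc d) *ℕ (k +ℕ suc d) !)
    ≡⟨ x∙yz≈y∙xz (suc k +ℕ suc d) (factorialRatio s (k +ℕ suc d)) _ ⟩
  factorialRatio s (k +ℕ suc d) *ℕ (suc k +ℕ suc d) !
    ≡⟨ ≡.cong (factorialRatio s (k +ℕ suc d) *ℕ_) (nCk*[n∸k]!*k! (ℕₚ.m≤n+m (suc d) (suc k))) ⟨
  factorialRatio s (k +ℕ suc d) *ℕ (((suc k +ℕ suc d) C suc d) *ℕ (suc k +ℕ suc d ∸ suc d) ! *ℕ suc d !)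
    ≡⟨ ≡.cong (λ x → factorialRatio s (k +ℕ suc d) *ℕ (((suc k +ℕ suc d) C suc d) *ℕ x ! *ℕ suc d !))
         (ℕₚ.m+n∸n≡m (suc k) (suc d)) ⟩
  factorialRatio s (k +ℕ suc d) *ℕ (((suc k +ℕ suc d) C suc d) *ℕ suc k ! *ℕ suc d !)
    ≡⟨ rotate (factorialRatio s (k +ℕ suc d)) ((suc k +ℕ suc d) C suc d) (suc k !) (suc d !) ⟩
  Z *ℕ (suc d ! *ℕ suc k !) ∎)
  where
  open ≡.≡-Reasoning
  open import Algebra.Properties.CommutativeSemigroup ℕₚ.*-commutativeSemigroup using (x∙yz≈y∙xz)
  X Y Z : ℕ
  X = (s C suc d) *ℕ factorialRatio (s ∸ suc d) k
  Y = (s C d) *ℕ factorialRatio (s ∸ d) (suc k)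
  Z = ((suc k +ℕ suc d) C suc d) *ℕ factorialRatio s (k +ℕ suc d)
  k+d≤s : k +ℕ suc d ≤ s
  k+d≤s = ≡.subst (_≤ s) (ℕₚ.+-comm (suc d) k) h
  pullʳ : ∀ x a b c → x *ℕ (a *ℕ (b *ℕ c)) ≡ b *ℕ (x *ℕ (a *ℕ c))
  pullʳ x a b c = ≡.trans (≡.cong (x *ℕ_) (x∙yz≈y∙xz a b c)) (x∙yz≈y∙xz x b _)
  pullˡ : ∀ x a b c → x *ℕ (a *ℕ b *ℕ c) ≡ a *ℕ (x *ℕ (b *ℕ c))
  pullˡ x a b c = ≡.trans (≡.cong (x *ℕ_) (ℕₚ.*-assoc a b c)) (x∙yz≈y∙xz x a _)
  rotate : ∀ r z a b → r *ℕ (z *ℕ a *ℕ b) ≡ z *ℕ r *ℕ (b *ℕ a)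
  rotate r z a b = ≡.trans (≡.cong (r *ℕ_) (≡.trans (ℕₚ.*-assoc z a b) (≡.cong (z *ℕ_) (ℕₚ.*-comm a b))))
    (≡.trans (≡.sym (ℕₚ.*-assoc r z _)) (≡.cong (_*ℕ (b *ℕ a)) (ℕₚ.*-comm r z)))

choose-pascal₀ : ∀ s d → d ≤ s →
  (s C d) *ℕ factorialRatio (s ∸ d) 0 ≡ (suc d C suc d) *ℕ factorialRatio s d
choose-pascal₀ s d d≤s = ℕₚ.*-cancelʳ-≡ _ _ (d ! *ℕ 1) {{d ℕₚ.!* 0 !≢0}} (begin
  (s C d) *ℕ factorialRatio (s ∸ d) 0 *ℕ (d ! *ℕ 1)
    ≡⟨ C-factorialRatio s d 0 (≡.subst (_≤ s) (≡.sym (ℕₚ.+-identityʳ d)) d≤s) ⟩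
  s !
    ≡⟨ nCk*[n∸k]!*k! d≤s ⟨
  factorialRatio s d *ℕ d !
    ≡⟨ ≡.cong₂ _*ℕ_ (≡.trans (≡.sym (ℕₚ.*-identityˡ (factorialRatio s d)))
         (≡.cong (_*ℕ factorialRatio s d) (≡.sym (nCn≡1 (suc d))))) (≡.sym (ℕₚ.*-identityʳ (d !))) ⟩
  (suc d C suc d) *ℕ factorialRatio s d *ℕ (d ! *ℕ 1) ∎)
  where open ≡.≡-Reasoning

-- The three positivity statements, deduced from the recurrence

module LahPositivity {c ℓ} (R : POCommRing c ℓ) (r : ℕ∞) (1≤r : 1 ≤∞ r) where
  open POCommRing R hiding (zero)
  open PolynomialRing R
  open Poly R
  open TotalPositivity commRing cone r
  open Scaling commRing cone r
  open Determinant commRing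
  open import Algebra.Properties.Semiring.Mult semiring using (×-congʳ; ×-congˡ; ×-assocˡ; ×-comm-*; ×-homo-+; ×-homo-1)
    renaming (_×_ to _·_)
  open import Relation.Binary.Reasoning.Setoid setoid

  private
    module TPₚ = TotalPositivity polyRing polyCone r
    module Sₚ = Scaling polyRing polyCone r
    module Dₚ = Determinant polyRing
    module R[y] = CommutativeRing polyRing

  -- All three parts use only the recurrence and the boundary values, so L is abstract here and the
  -- combinatorics of forests stays separate.
  module FromRecurrence (φ : ℕ → Carrier) (tpφ : ToeplitzTP (asOrdered R) r φ) (L : ℕ → ℕ → Carrier)
    (L₀₀ : L 0 0 ≈ 1#) (L₀-suc : ∀ k → L 0 (suc k) ≈ 0#) (L-suc₀ : ∀ n → L (suc n) 0 ≈ 0#)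
    (L-suc : ∀ n k → L (suc n) (suc k) ≈ sum (suc n) (λ j → L n j * weightedToeplitz φ j k)) where

    private
      M : InfMatrix
      M = weightedToeplitz φ
      Tφ : InfMatrix
      Tφ = ToeplitzMatrix ordered φ

    TPos-M : TPos M
    TPos-M = TPos-weightedToeplitz φ tpφ

    L-lower : ∀ n k → n < k → L n k ≈ 0#
    L-lower zero    (suc k) _         = L₀-suc k
    L-lower (suc n) (suc k) (s≤s n<k) = trans (L-suc n k) (sum-zero (suc n) (λ j j≤n →
      trans (*-congˡ (weightedToeplitz-upper φ j k (ℕₚ.≤-trans j≤n n<k))) (zeroʳ _)))

    shiftedM-hessenberg : ∀ k l → suc k < l → prependZeroColumn M k l ≈ 0#
    shiftedM-hessenberg k (suc l) (s≤s k<l) = weightedToeplitz-upper φ k l k<l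

    L-step : ∀ n k → L (suc n) k ≈ sum (suc n) (λ j → L n j * prependZeroColumn M j k)
    L-step n zero    = trans (L-suc₀ n) (sym (sum-zero (suc n) (λ j _ → zeroʳ _)))
    L-step n (suc k) = L-suc n k

    module LProduction = Production (prependZeroColumn M) L (TPos-prependZeroColumn {M} TPos-M)
      shiftedM-hessenberg (Pos-resp (sym L₀₀) Pos-1) L-lower L-step

    TP-L : TP (asOrdered R) r L
    TP-L = toTP {L} LProduction.TPos-W

    Pos-entry : ∀ {A : InfMatrix} → TPos A → ∀ i j → Pos (A i j)
    Pos-entry tp i j = Pos-resp (trans (det-row₀-head 0 _ (λ ())) (trans (*-congˡ (det₀ _)) (*-identityʳ _)))
      (tp 1 1≤r (λ _ → i) (λ _ → j) (λ { fzero fzero () }) (λ { fzero fzero () }))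

    TPos-dropRow : TPos (λ j k → M (suc j) k)
    TPos-dropRow m m≤r I J incI incJ = TPos-M m m≤r (suc ∘ I) J (λ a b a<b → s<s (incI a b a<b)) incJ

    -- This entry is φ₀, the corner of the matrix whose row n lists `L (suc n) (suc k)`. Its sign is
    -- that of a minor of size one, which is where 1 ≤ r enters.
    Pos-L₁₁ : Pos (L 1 1)
    Pos-L₁₁ = Pos-resp
      (sym (trans (L-suc 0 0) (sum-head 0 (λ k → trans (*-congʳ (L₀-suc k)) (zeroˡ _)))))
      (Pos-* (Pos-resp (sym L₀₀) Pos-1) (Pos-entry {M} TPos-M 0 0))

    -- A nonempty forest has a root, so the term j = 0 of the recurrence drops out, and with it row
    -- 0 of M.
    trees-step : ∀ n k → L (suc (suc n)) (suc k) ≈ sum (suc n) (λ j → L (suc n) (suc j) * M (suc j) k)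
    trees-step n k = trans (L-suc (suc n) k) (trans (sum-suc (suc n) _)
      (trans (+-congʳ (trans (*-congʳ (L-suc₀ n)) (zeroˡ _))) (+-identityˡ _)))

    module TreeProduction = Production (λ j k → M (suc j) k) (λ n k → L (suc n) (suc k)) TPos-dropRow
      (λ k l k<l → weightedToeplitz-upper φ (suc k) l k<l) Pos-L₁₁
      (λ n k n<k → L-lower (suc n) (suc k) (s≤s n<k)) trees-step

    HankelTP-trees : HankelTP (asOrdered R) r (λ n → L (suc n) 1)
    HankelTP-trees = toTP {λ i j → L (suc (i +ℕ j)) 1} TreeProduction.TPos-hankel

    Q : ℕ → ℕ → P
    Q i zero    = const (M i 0) *ₚ y
    Q i (suc k) = const (M i k) +ₚ (const (M i (suc k)) *ₚ y)

    constM-upper : ∀ i k → i < k → const (M i k) ≈ₚ []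
    constM-upper i k i<k zero    = weightedToeplitz-upper φ i k i<k
    constM-upper i k i<k (suc d) = refl

    TPos-Q : TPₚ.TPos Q
    TPos-Q = TPₚ.TPos-product {Q} {λ i k → const (M i k)} {Sₚ.bidiagonal y} factor
      (TPos-const r {M} TPos-M) (Sₚ.TPos-bidiagonal y (Pos-0 ∷ Pos-1 ∷ []))
      where
      vanish : ∀ i n → suc (suc i) ≤ n → ∀ k → n ≤ k → const (M i k) ≈ₚ []
      vanish i n h k n≤k = constM-upper i k (ℕₚ.≤-trans (ℕₚ.<⇒≤ h) n≤k)
      factor : ∀ i j n → suc (suc i) ≤ n →
               Q i j ≈ₚ Dₚ.sum n (λ k → const (M i k) *ₚ Sₚ.bidiagonal y k j)
      factor i zero    n h k = sym (Sₚ.sum-bidiagonal₀ y n (const ∘ M i) (vanish i n h) k)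
      factor i (suc j) n h k = sym (Sₚ.sum-bidiagonal y n (const ∘ M i) (vanish i n h) j k)

    Q-hessenberg : ∀ k l → suc k < l → Q k l ≈ₚ []
    Q-hessenberg k (suc l) (s≤s k<l) =
      R[y].+-cong {const (M k l)} {[]} {const (M k (suc l)) *ₚ y} {[]} (constM-upper k l k<l)
        (R[y].*-congʳ {y} {const (M k (suc l))} {[]} (constM-upper k (suc l) (ℕₚ.m≤n⇒m≤1+n k<l)))

    W : ℕ → ℕ → P
    W zero    zero    = 1# ∷ []
    W zero    (suc k) = []
    W (suc i) k       = Dₚ.sum (suc i) (λ l → W i l *ₚ Q l k)

    sum-shift : ∀ d n (F : ℕ → Carrier) → (∀ s → s < d → F s ≈ 0#) → (∀ s → n ≤ s → F s ≈ 0#) →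
                sum n (λ l → F (l +ℕ d)) ≈ sum n F
    sum-shift zero    n F lo hi = sum-cong n (λ k _ → reflexive (≡.cong F (ℕₚ.+-identityʳ k)))
    sum-shift (suc d) n F lo hi = begin
      sum n (λ l → F (l +ℕ suc d))   ≈⟨ sum-cong n (λ l _ → reflexive (≡.cong F (ℕₚ.+-suc l d))) ⟩
      sum n (λ l → F (suc (l +ℕ d))) ≈⟨ sum-shift d n (F ∘ suc) (λ s s<d → lo (suc s) (s≤s s<d))
                                          (λ s n≤s → hi (suc s) (ℕₚ.m≤n⇒m≤1+n n≤s)) ⟩
      sum n (F ∘ suc)                ≈⟨ +-identityˡ _ ⟨
      0# + sum n (F ∘ suc)           ≈⟨ +-congʳ (lo 0 z<s) ⟨
      F 0 + sum n (F ∘ suc)          ≈⟨ sum-suc n F ⟨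
      sum (suc n) F                  ≈⟨ sum-truncate (ℕₚ.n≤1+n n) hi ⟩
      sum n F                        ∎

    Toeplitz-shift : ∀ d i j → Tφ i j ≈ Tφ (d +ℕ i) (d +ℕ j)
    Toeplitz-shift zero    i j = refl
    Toeplitz-shift (suc d) i j = Toeplitz-shift d i j

    -- Rewrites multiples of entries of M as multiples of one Toeplitz entry, so that identities
    -- between them become identities in ℕ. For d > s the truncated difference is harmless because
    -- the binomial coefficient is zero.
    C·M : ∀ s d k → (s C d) · M (s ∸ d) k ≈ ((s C d) *ℕ factorialRatio (s ∸ d) k) · Tφ s (d +ℕ k)
    C·M s d k with d ℕₚ.≤? s
    ... | yes d≤s = trans (×-assocˡ _ (s C d) (factorialRatio (s ∸ d) k))
      (×-congʳ ((s C d) *ℕ factorialRatio (s ∸ d) k)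
        (trans (Toeplitz-shift d (s ∸ d) k) (reflexive (≡.cong (λ x → Tφ x (d +ℕ k)) (ℕₚ.m+[n∸m]≡n d≤s)))))
    ... | no  d≰s = trans (×-congˡ {M (s ∸ d) k} sCd≡0)
      (×-congˡ {Tφ s (d +ℕ k)} {0} (≡.sym (≡.cong (_*ℕ factorialRatio (s ∸ d) k) sCd≡0)))
      where
      sCd≡0 : s C d ≡ 0
      sCd≡0 = k>n⇒nCk≡0 (ℕₚ.≰⇒> d≰s)

    -- The coefficient of y^(d+1) in entry (s, k+1) of B M (Δ + y I) = M Δ B, where B has entries
    -- C(s,j) y^(s-j).
    C·M-pascal : ∀ s d k → (s C suc d) · M (s ∸ suc d) k + (s C d) · M (s ∸ d) (suc k) ≈
                 ((suc k +ℕ suc d) C suc d) · M s (k +ℕ suc d)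
    C·M-pascal s d k = begin
      (s C suc d) · M (s ∸ suc d) k + (s C d) · M (s ∸ d) (suc k)
        ≈⟨ +-cong (C·M s (suc d) k) (C·M s d (suc k)) ⟩
      x · Tφ s (suc d +ℕ k) + y′ · Tφ s (d +ℕ suc k)
        ≈⟨ +-cong (×-congʳ x (reflexive (≡.cong (Tφ s) (ℕₚ.+-comm (suc d) k))))
                  (×-congʳ y′ (reflexive (≡.cong (Tφ s) (≡.trans (ℕₚ.+-suc d k) (ℕₚ.+-comm (suc d) k))))) ⟩
      x · t + y′ · t
        ≈⟨ ×-homo-+ t x y′ ⟨
      (x +ℕ y′) · t
        ≈⟨ both ⟩
      (((suc k +ℕ suc d) C suc d) *ℕ factorialRatio s (k +ℕ suc d)) · t
        ≈⟨ ×-assocˡ t ((suc k +ℕ suc d) C suc d) (factorialRatio s (k +ℕ suc d)) ⟨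
      ((suc k +ℕ suc d) C suc d) · M s (k +ℕ suc d) ∎
      where
      x y′ : ℕ
      x = (s C suc d) *ℕ factorialRatio (s ∸ suc d) k
      y′ = (s C d) *ℕ factorialRatio (s ∸ d) (suc k)
      t : Carrier
      t = Tφ s (k +ℕ suc d)
      both : (x +ℕ y′) · t ≈ (((suc k +ℕ suc d) C suc d) *ℕ factorialRatio s (k +ℕ suc d)) · t
      both with suc d +ℕ k ℕₚ.≤? s
      ... | yes h = ×-congˡ (choose-pascal s d k h)
      -- Here the position is above the diagonal and the common Toeplitz entry is zero, so no
      -- identity in ℕ is called for.
      ... | no  h = trans (·-zero (x +ℕ y′) t≈0) (sym (·-zero (((suc k +ℕ suc d) C suc d) *ℕ factorialRatio s (k +ℕ suc d)) t≈0))
        where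
        t≈0 : t ≈ 0#
        t≈0 = Toeplitz-upper φ s _ (≡.subst (s <_) (ℕₚ.+-comm (suc d) k) (ℕₚ.≰⇒> h))

    -- Column 0 of the same matrix identity, where Δ contributes nothing on the left.
    C·M-pascal₀ : ∀ s d → (s C d) · M (s ∸ d) 0 ≈ (suc d C suc d) · M s d
    C·M-pascal₀ s d = begin
      (s C d) · M (s ∸ d) 0                               ≈⟨ C·M s d 0 ⟩
      ((s C d) *ℕ factorialRatio (s ∸ d) 0) · Tφ s (d +ℕ 0) ≈⟨ ×-congʳ ((s C d) *ℕ factorialRatio (s ∸ d) 0) (reflexive (≡.cong (Tφ s) (ℕₚ.+-identityʳ d))) ⟩
      ((s C d) *ℕ factorialRatio (s ∸ d) 0) · Tφ s d        ≈⟨ both ⟩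
      ((suc d C suc d) *ℕ factorialRatio s d) · Tφ s d      ≈⟨ ×-assocˡ _ (suc d C suc d) (factorialRatio s d) ⟨
      (suc d C suc d) · M s d                              ∎
      where
      both : ((s C d) *ℕ factorialRatio (s ∸ d) 0) · Tφ s d ≈ ((suc d C suc d) *ℕ factorialRatio s d) · Tφ s d
      both with d ℕₚ.≤? s
      ... | yes h = ×-congˡ (choose-pascal₀ s d h)
      ... | no  h = trans (·-zero ((s C d) *ℕ factorialRatio (s ∸ d) 0) t≈0) (sym (·-zero ((suc d C suc d) *ℕ factorialRatio s d) t≈0))
        where
        t≈0 : Tφ s d ≈ 0#
        t≈0 = Toeplitz-upper φ s d (ℕₚ.≰⇒> h)

    L-suc-· : ∀ c n k (a : ℕ → Carrier) → (∀ s → a s ≈ c · M s k) →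
              sum (suc n) (λ s → L n s * a s) ≈ c · L (suc n) (suc k)
    L-suc-· c n k a h = begin
      sum (suc n) (λ s → L n s * a s)           ≈⟨ sum-cong (suc n) (λ s _ → trans (*-congˡ (h s)) (×-comm-* c _ _)) ⟩
      sum (suc n) (λ s → c · (L n s * M s k))   ≈⟨ sum-· c (suc n) _ ⟩
      c · sum (suc n) (λ s → L n s * M s k)     ≈⟨ ×-congʳ c (L-suc n k) ⟨
      c · L (suc n) (suc k)                     ∎
      where
      sum-· : ∀ c n (f : ℕ → Carrier) → sum n (λ s → c · f s) ≈ c · sum n f
      sum-· zero    n f = sum-zero n (λ _ _ → refl)
      sum-· (suc c) n f = trans (sum-+ n f _) (+-congˡ (sum-· c n f))

    -- Reindexing by s = l + d. The values s < d that are added vanish through C(s,d), and those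
    -- beyond n vanish because L is lower triangular.
    shifted : ∀ n d k → sum (suc n) (λ l → (((l +ℕ d) C d) · L n (l +ℕ d)) * M l k) ≈
              sum (suc n) (λ s → L n s * ((s C d) · M (s ∸ d) k))
    shifted n d k = trans
      (sum-cong (suc n) (λ l _ → begin
        (((l +ℕ d) C d) · L n (l +ℕ d)) * M l k              ≈⟨ ·-swap ((l +ℕ d) C d) _ _ ⟩
        L n (l +ℕ d) * (((l +ℕ d) C d) · M l k)
          ≈⟨ *-congˡ (×-congʳ ((l +ℕ d) C d) (reflexive (≡.cong (λ i → M i k) (≡.sym (ℕₚ.m+n∸n≡m l d))))) ⟩
        L n (l +ℕ d) * (((l +ℕ d) C d) · M (l +ℕ d ∸ d) k)   ∎))
      (sum-shift d (suc n) (λ s → L n s * ((s C d) · M (s ∸ d) k))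
        (λ s s<d → trans (*-congˡ (×-congˡ {M (s ∸ d) k} (k>n⇒nCk≡0 s<d))) (zeroʳ _))
        (λ s n<s → trans (*-congʳ (L-lower n s n<s)) (zeroˡ _)))
      where
      ·-swap : ∀ c a b → (c · a) * b ≈ a * (c · b)
      ·-swap c a b = trans (*-comm _ _) (trans (×-comm-* c b a) (trans (×-congʳ c (*-comm b a)) (sym (×-comm-* c a b))))

    -- W n k is the k-th divided derivative of the Lah polynomial L n.
    coeff-W : ∀ n k d → coeff (W n k) d ≈ ((k +ℕ d) C d) · L n (k +ℕ d)
    coeff-W zero    zero    zero    = sym (trans (×-homo-1 _) L₀₀)
    coeff-W zero    zero    (suc d) = sym (·-zero (suc d C suc d) (L₀-suc d))
    coeff-W zero    (suc k) d       = sym (·-zero ((suc k +ℕ d) C d) (L₀-suc (k +ℕ d)))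
    coeff-W (suc n) k       d       = trans (coeff-sum (suc n) _ d) (step k d)
      where
      IH : ∀ l d a → coeff (W n l) d * a ≈ (((l +ℕ d) C d) · L n (l +ℕ d)) * a
      IH l d a = *-congʳ (coeff-W n l d)
      regroup : ∀ l p q → (W n l *ₚ (p *ₚ q)) ≈ₚ ((W n l *ₚ p) *ₚ q)
      regroup l p q k = sym (R[y].*-assoc (W n l) p q k)
      coeff-y : ∀ l m d → coeff (W n l *ₚ (const (M l m) *ₚ y)) (suc d) ≈ (((l +ℕ d) C d) · L n (l +ℕ d)) * M l m
      coeff-y l m d = trans (regroup l (const (M l m)) y (suc d)) (trans (coeff-*-y (W n l *ₚ const (M l m)) d)
        (trans (coeff-*-const (W n l) (M l m) d) (IH l d _)))
      coeff-y₀ : ∀ l m → coeff (W n l *ₚ (const (M l m) *ₚ y)) 0 ≈ 0#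
      coeff-y₀ l m = trans (regroup l (const (M l m)) y 0) (coeff-*-y₀ (W n l *ₚ const (M l m)))
      coeff-Q : ∀ l k d → coeff (W n l *ₚ Q l (suc k)) d ≈
                (((l +ℕ d) C d) · L n (l +ℕ d)) * M l k + coeff (W n l *ₚ (const (M l (suc k)) *ₚ y)) d
      coeff-Q l k d = trans (R[y].distribˡ (W n l) (const (M l k)) (const (M l (suc k)) *ₚ y) d)
        (trans (coeff-+ (W n l *ₚ const (M l k)) _ d)
          (+-congʳ (trans (coeff-*-const (W n l) (M l k) d) (IH l d _))))
      -- Column 0 of Q has no term from Δ, and a multiple of y has no constant coefficient; only for
      -- k and d both positive do two terms meet, and there Pascal's rule is needed.
      step : ∀ k d → sum (suc n) (λ l → coeff (W n l *ₚ Q l k) d) ≈ ((k +ℕ d) C d) · L (suc n) (k +ℕ d)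
      step zero    zero    = trans (sum-zero (suc n) (λ l _ → coeff-y₀ l 0)) (sym (·-zero 1 (L-suc₀ n)))
      step zero    (suc d) = trans (sum-cong (suc n) (λ l _ → coeff-y l 0 d)) (trans (shifted n d 0)
        (L-suc-· (suc d C suc d) n d _ (λ s → C·M-pascal₀ s d)))
      step (suc k) zero    = trans
        (sum-cong (suc n) (λ l _ → trans (coeff-Q l k 0) (trans (+-congˡ (coeff-y₀ l (suc k))) (+-identityʳ _))))
        (trans (shifted n 0 k) (L-suc-· 1 n (k +ℕ 0) _
          (λ s → reflexive (≡.cong (λ j → 1 · M s j) (≡.sym (ℕₚ.+-identityʳ k))))))
      step (suc k) (suc d) = trans
        (sum-cong (suc n) (λ l _ → trans (coeff-Q l k (suc d)) (+-congˡ (coeff-y l (suc k) d))))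
        (trans (sum-+ (suc n) _ _) (trans (+-cong (shifted n (suc d) k) (shifted n d (suc k)))
          (trans (sym (sum-+ (suc n) _ _)) (trans (sum-cong (suc n) (λ s _ → sym (distribˡ _ _ _)))
            (L-suc-· ((suc k +ℕ suc d) C suc d) n (k +ℕ suc d) _ (λ s → C·M-pascal s d k))))))

    W-lower : ∀ n k → n < k → W n k ≈ₚ []
    W-lower n k n<k d = trans (coeff-W n k d)
      (·-zero ((k +ℕ d) C d) (L-lower n (k +ℕ d) (ℕₚ.≤-trans n<k (ℕₚ.m≤m+n k d))))

    coeff-applyUpTo : ∀ n (g : ℕ → ℕ) f → (∀ k → n ≤ k → f (g k) ≈ 0#) → ∀ k →
                      coeff (map f (applyUpTo g n)) k ≈ f (g k)
    coeff-applyUpTo zero    g f h k       = sym (h k z≤n)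
    coeff-applyUpTo (suc n) g f h zero    = refl
    coeff-applyUpTo (suc n) g f h (suc k) = coeff-applyUpTo n (g ∘ suc) f (λ k n≤k → h (suc k) (s≤s n≤k)) k

    W₀-Lpoly : ∀ n → W n 0 ≈ₚ map (L n) (upTo (suc n))
    W₀-Lpoly n d = begin
      coeff (W n 0) d                      ≈⟨ coeff-W n 0 d ⟩
      (d C d) · L n d                      ≈⟨ ×-congˡ {L n d} (nCn≡1 d) ⟩
      1 · L n d                            ≈⟨ ×-homo-1 _ ⟩
      L n d                                ≈⟨ coeff-applyUpTo (suc n) (λ k → k) (L n) (L-lower n) d ⟨
      coeff (map (L n) (upTo (suc n))) d   ∎

    module PolyProduction = TPₚ.Production Q W TPos-Q Q-hessenberg (Pos-1 ∷ []) W-lower (λ i k _ → refl)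

    HankelTP-Lpoly : HankelTP PolyOrdered r (λ n → map (L n) (upTo (suc n)))
    HankelTP-Lpoly = TPₚ.toTP {λ i j → map (L (i +ℕ j)) (upTo (suc (i +ℕ j)))}
      (TPₚ.TPos-cong {λ i j → W (i +ℕ j) 0} {λ i j → map (L (i +ℕ j)) (upTo (suc (i +ℕ j)))} (λ i j → W₀-Lpoly (i +ℕ j)) PolyProduction.TPos-hankel)

-- Booleans and counting on finite sets

T-injective : ∀ {x y} → (T x → T y) → (T y → T x) → x ≡ y
T-injective {false} {false} f g = ≡.refl
T-injective {false} {true}  f g = ⊥-elim (g tt)
T-injective {true}  {false} f g = ⊥-elim (f tt)
T-injective {true}  {true}  f g = ≡.refl

T-not⁺ : ∀ {x} → ¬ T x → T (not x)
T-not⁺ {false} h = tt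
T-not⁺ {true}  h = h tt

T-not⁻ : ∀ {x} → T (not x) → ¬ T x
T-not⁻ {false} h ()

≡ᵇ-sym : ∀ i j → (i ≡ᵇ j) ≡ (j ≡ᵇ i)
≡ᵇ-sym zero    zero    = ≡.refl
≡ᵇ-sym zero    (suc j) = ≡.refl
≡ᵇ-sym (suc i) zero    = ≡.refl
≡ᵇ-sym (suc i) (suc j) = ≡ᵇ-sym i j

≡ᵇ-refl : ∀ i → (i ≡ᵇ i) ≡ true
≡ᵇ-refl zero    = ≡.refl
≡ᵇ-refl (suc i) = ≡ᵇ-refl i

≢⇒≡ᵇ-false : ∀ i j → i ≢ j → (i ≡ᵇ j) ≡ false
≢⇒≡ᵇ-false i j i≢j with i ≡ᵇ j in eq
... | false = ≡.refl
... | true  = contradiction (ℕₚ.≡ᵇ⇒≡ i j (≡.subst T (≡.sym eq) tt)) i≢j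

infixr 5 _∷ᶠ_
_∷ᶠ_ : A → (Fin n → A) → Fin (suc n) → A
(x ∷ᶠ f) fzero    = x
(x ∷ᶠ f) (fsuc i) = f i

count : (Fin n → Bool) → ℕ
count {zero}  p = 0
count {suc n} p = if p fzero then suc (count (p ∘ fsuc)) else count (p ∘ fsuc)

countB-tabulate : (p : A → Bool) (f : Fin n → A) → countB p (tabulate f) ≡ count (p ∘ f)
countB-tabulate {n = zero}  p f = ≡.refl
countB-tabulate {n = suc n} p f with p (f fzero)
... | true  = ≡.cong suc (countB-tabulate p (f ∘ fsuc))
... | false = countB-tabulate p (f ∘ fsuc)

count-cong : {p q : Fin n → Bool} → p ≗ q → count p ≡ count q
count-cong {zero}  e = ≡.refl
count-cong {suc n} {p} {q} e with p fzero | q fzero | e fzero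
... | true  | _ | ≡.refl = ≡.cong suc (count-cong (e ∘ fsuc))
... | false | _ | ≡.refl = count-cong (e ∘ fsuc)

count≤n : (p : Fin n → Bool) → count p ≤ n
count≤n {zero}  p = z≤n
count≤n {suc n} p with p fzero
... | true  = s≤s (count≤n (p ∘ fsuc))
... | false = ℕₚ.m≤n⇒m≤1+n (count≤n (p ∘ fsuc))

count-false : (p : Fin n → Bool) → (∀ i → p i ≡ false) → count p ≡ 0
count-false {zero}  p e = ≡.refl
count-false {suc n} p e with p fzero | e fzero
... | false | _ = count-false (p ∘ fsuc) (e ∘ fsuc)

count-<ᵇ : ∀ k → k ≤ n → count {n} (λ i → toℕ i <ᵇ k) ≡ k
count-<ᵇ {n}     zero    _         = count-false {n} _ (λ _ → ≡.refl)
count-<ᵇ {suc n} (suc k) (s≤s k≤n) = ≡.cong suc (count-<ᵇ k k≤n)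

count-remove : (p : Fin n → Bool) (i : Fin n) → T (p i) →
               count (λ j → p j ∧ not (toℕ j ≡ᵇ toℕ i)) ≡ pred (count p)
count-remove {suc n} p fzero    h with p fzero
... | true  = count-cong (λ j → ∧-identityʳ (p (fsuc j)))
count-remove {suc n} p (fsuc i) h with p fzero
... | false = count-remove (p ∘ fsuc) i h
... | true  = ≡.trans (≡.cong suc (count-remove (p ∘ fsuc) i h)) (suc-pred′ (positive (p ∘ fsuc) i h))
  where
  positive : (q : Fin N → Bool) (i : Fin N) → T (q i) → 0 < count q
  positive {suc N} q i h with q fzero in eq
  ... | true = z<s
  positive {suc N} q fzero h | false = ⊥-elim (≡.subst T eq h)
  positive {suc N} q (fsuc i) h | false = positive (q ∘ fsuc) i h

allᶠ : (Fin n → Bool) → Bool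
allᶠ {zero}  p = true
allᶠ {suc n} p = p fzero ∧ allᶠ (p ∘ fsuc)

allB-tabulate : (p : A → Bool) (f : Fin n → A) → allB p (tabulate f) ≡ allᶠ (p ∘ f)
allB-tabulate {n = zero}  p f = ≡.refl
allB-tabulate {n = suc n} p f = ≡.cong (p (f fzero) ∧_) (allB-tabulate p (f ∘ fsuc))

allᶠ-cong : {p q : Fin n → Bool} → p ≗ q → allᶠ p ≡ allᶠ q
allᶠ-cong {zero}  e = ≡.refl
allᶠ-cong {suc n} e = ≡.cong₂ _∧_ (e fzero) (allᶠ-cong (e ∘ fsuc))

T-allᶠ : {p : Fin n → Bool} → T (allᶠ p) ⇔ (∀ i → T (p i))
T-allᶠ {zero}      = mk⇔ (λ _ ()) (λ _ → tt)
T-allᶠ {suc n} {p} = mk⇔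
  (λ h → let (h₀ , hs) = Equivalence.to T-∧ h in λ where
    fzero    → h₀
    (fsuc i) → Equivalence.to T-allᶠ hs i)
  (λ h → Equivalence.from T-∧ (h fzero , Equivalence.from T-allᶠ (h ∘ fsuc)))

-- Sibling orders as placements

isChildOf : ℕ → Maybe (Fin c) → Bool
isChildOf u nothing  = false
isChildOf u (just w) = toℕ w ≡ᵇ u

-- The number m of vertices and the number c of possible parents are kept apart, since the
-- inductions remove vertices one at a time while the parents stay.
degree : (Fin m → Maybe (Fin c)) → ℕ → ℕ
degree cl u = count (isChildOf u ∘ cl)

-- `av u x` means that place x among the children of u is still free.
okAt : Maybe (Fin c) → (Fin c → Fin N → Bool) → Fin N → Bool
okAt nothing  av x = toℕ x ≡ᵇ 0
okAt (just u) av x = av u x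

occupy : Maybe (Fin c) → Fin N → (Fin c → Fin N → Bool) → Fin c → Fin N → Bool
occupy nothing  x av = av
occupy (just u) x av u′ x′ = av u′ x′ ∧ not ((toℕ u′ ≡ᵇ toℕ u) ∧ (toℕ x′ ≡ᵇ toℕ x))

-- A vertex v in the class u = cl v occupies a place
-- of u, distinct vertices of a class occupying distinct places; vertices of
-- class nothing sit at place 0.
placeable : ∀ m → (Fin m → Maybe (Fin c)) → (Fin c → Fin N → Bool) → (Fin m → Fin N) → Bool
placeable zero    cl av pos = true
placeable (suc m) cl av pos =
  okAt (cl fzero) av (pos fzero) ∧
  placeable m (cl ∘ fsuc) (occupy (cl fzero) (pos fzero) av) (pos ∘ fsuc)

Clash : Maybe (Fin c) → Maybe (Fin c) → Fin N → Fin N → Set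
Clash {c} k k′ x x′ = Σ (Fin c) λ u → k ≡ just u × k′ ≡ just u × x ≡ x′

clash-sym : ∀ {k k′ : Maybe (Fin c)} {x x′ : Fin N} → Clash k k′ x x′ → Clash k′ k x′ x
clash-sym (u , p , q , e) = u , q , p , ≡.sym e

okAt-occupy : ∀ (k₀ k : Maybe (Fin c)) (x₀ x : Fin N) av →
              T (okAt k (occupy k₀ x₀ av) x) ⇔ (T (okAt k av x) × ¬ Clash k₀ k x₀ x)
okAt-occupy nothing   nothing  x₀ x av = mk⇔ (λ h → h , λ { (_ , () , _) }) proj₁
okAt-occupy nothing   (just u) x₀ x av = mk⇔ (λ h → h , λ { (_ , () , _) }) proj₁
okAt-occupy (just u₀) nothing  x₀ x av = mk⇔ (λ h → h , λ { (_ , _ , () , _) }) proj₁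
okAt-occupy (just u₀) (just u) x₀ x av = mk⇔
  (λ h → let (h₁ , h₂) = Equivalence.to (T-∧ {av u x}) h in h₁ , λ { (_ , ≡.refl , ≡.refl , ≡.refl) →
    T-not⁻ h₂ (Equivalence.from T-∧ (ℕₚ.≡⇒≡ᵇ (toℕ u) (toℕ u) ≡.refl , ℕₚ.≡⇒≡ᵇ (toℕ x) (toℕ x) ≡.refl)) })
  (λ { (h₁ , h₂) → Equivalence.from T-∧ (h₁ , T-not⁺ (λ h →
    let (e , e′) = Equivalence.to (T-∧ {toℕ u ≡ᵇ toℕ u₀}) h in
    h₂ (u₀ , ≡.refl , ≡.cong just (toℕ-injective (ℕₚ.≡ᵇ⇒≡ (toℕ u) (toℕ u₀) e)) ,
        ≡.sym (toℕ-injective (ℕₚ.≡ᵇ⇒≡ (toℕ x) (toℕ x₀) e′))))) })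

-- The sequential test can be counted vertex by vertex; this identifies it with the pairwise
-- condition in which forests are defined.
T-placeable : ∀ m (cl : Fin m → Maybe (Fin c)) av (pos : Fin m → Fin N) →
  T (placeable m cl av pos) ⇔
  ((∀ v → T (okAt (cl v) av (pos v))) × (∀ v w → v ≢ w → ¬ Clash (cl v) (cl w) (pos v) (pos w)))
T-placeable zero    cl av pos = mk⇔ (λ _ → (λ ()) , (λ ())) (λ _ → tt)
T-placeable {c} {N} (suc m) cl av pos = mk⇔ to from
  where
  rest = T-placeable m (cl ∘ fsuc) (occupy (cl fzero) (pos fzero) av) (pos ∘ fsuc)
  occ : ∀ v → _
  occ v = okAt-occupy (cl fzero) (cl (fsuc v)) (pos fzero) (pos (fsuc v)) av
  to : T (placeable (suc m) cl av pos) → _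
  to h with Equivalence.to (T-∧ {okAt (cl fzero) av (pos fzero)}) h
  ... | h₀ , hs with Equivalence.to rest hs
  ... | oks , apart = ok , noClash
    where
    ok : ∀ v → T (okAt (cl v) av (pos v))
    ok fzero    = h₀
    ok (fsuc v) = proj₁ (Equivalence.to (occ v) (oks v))
    noClash : ∀ v w → v ≢ w → ¬ Clash (cl v) (cl w) (pos v) (pos w)
    noClash fzero    fzero    v≢w = contradiction ≡.refl v≢w
    noClash fzero    (fsuc w) _   = proj₂ (Equivalence.to (occ w) (oks w))
    noClash (fsuc v) fzero    _   = proj₂ (Equivalence.to (occ v) (oks v)) ∘ clash-sym
    noClash (fsuc v) (fsuc w) v≢w = apart v w (v≢w ∘ ≡.cong fsuc)
  from : _ → T (placeable (suc m) cl av pos)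
  from (ok , noClash) = Equivalence.from T-∧ (ok fzero , Equivalence.from rest
    ( (λ v → Equivalence.from (occ v) (ok (fsuc v) , noClash fzero (fsuc v) (λ ())))
    , (λ v w v≢w → noClash (fsuc v) (fsuc w) (v≢w ∘ suc-injective))))

removePlace : Maybe (Fin c) → (Fin c → ℕ) → Fin c → ℕ
removePlace nothing  A u = A u
removePlace (just w) A u = if toℕ u ≡ᵇ toℕ w then pred (A u) else A u

choices : Maybe (Fin c) → (Fin c → ℕ) → ℕ
choices nothing  A = 1
choices (just w) A = A w

-- The number of position functions accepted by `placeable`, expressed through the numbers A u of
-- free places alone.
placements : ∀ m → (Fin m → Maybe (Fin c)) → (Fin c → ℕ) → ℕ
placements zero    cl A = 1
placements (suc m) cl A = choices (cl fzero) A *ℕ placements m (cl ∘ fsuc) (removePlace (cl fzero) A)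

choices-cong : ∀ (k : Maybe (Fin c)) {A B} → A ≗ B → choices k A ≡ choices k B
choices-cong nothing  e = ≡.refl
choices-cong (just w) e = e w

removePlace-cong : ∀ (k : Maybe (Fin c)) {A B} → A ≗ B → removePlace k A ≗ removePlace k B
removePlace-cong nothing  e u = e u
removePlace-cong (just w) e u = ≡.cong (λ x → if toℕ u ≡ᵇ toℕ w then pred x else x) (e u)

placements-cong : ∀ m (cl : Fin m → Maybe (Fin c)) {A B} → A ≗ B → placements m cl A ≡ placements m cl B
placements-cong zero    cl e = ≡.refl
placements-cong (suc m) cl e = ≡.cong₂ _*ℕ_ (choices-cong (cl fzero) e)
  (placements-cong m (cl ∘ fsuc) (removePlace-cong (cl fzero) e))

-- A free place that gets occupied costs its class exactly one place, whichever place it is, so the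
-- count of what remains is independent of the choice made.
count-occupy : ∀ (k : Maybe (Fin c)) (x : Fin N) av → T (okAt k av x) →
               (λ u → count (occupy k x av u)) ≗ removePlace k (λ u → count (av u))
count-occupy nothing  x av h u = ≡.refl
count-occupy (just w) x av h u with toℕ u ≡ᵇ toℕ w in eq
... | true  = count-remove (av u) x (≡.subst (λ u → T (av u x))
                (≡.sym (toℕ-injective (ℕₚ.≡ᵇ⇒≡ (toℕ u) (toℕ w) (≡.subst T (≡.sym eq) tt)))) h)
... | false = count-cong (λ x′ → ∧-identityʳ (av u x′))

∏-scale : ∀ (w : Fin c) (f g : Fin c → ℕ) {k} → f w ≡ k *ℕ g w → (∀ u → u ≢ w → f u ≡ g u) →
          ∏.sum f ≡ k *ℕ ∏.sum g
∏-scale {suc c} w f g {k} e e′ = begin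
  ∏.sum f                                ≡⟨ ∏.sum-remove {i = w} f ⟩
  f w *ℕ ∏.sum (f ∘ punchIn w)           ≡⟨ ≡.cong₂ _*ℕ_ e (∏.sum-cong-≗ (λ u → e′ _ (punchInᵢ≢i w u))) ⟩
  k *ℕ g w *ℕ ∏.sum (g ∘ punchIn w)      ≡⟨ ℕₚ.*-assoc k (g w) _ ⟩
  k *ℕ (g w *ℕ ∏.sum (g ∘ punchIn w))    ≡⟨ ≡.cong (k *ℕ_) (∏.sum-remove {i = w} g) ⟨
  k *ℕ ∏.sum g                           ∎
  where open ≡.≡-Reasoning

-- With as many places as children, the children of u can be ordered in (deg u)! ways. The first
-- child of w has `D w` choices and leaves the degrees of the remaining vertices as capacities,
-- which matches D! = D (D - 1)!.
placements-degree : ∀ m (cl : Fin m → Maybe (Fin c)) →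
                    placements m cl (degree cl ∘ toℕ) ≡ ∏.sum {c} (λ u → degree cl (toℕ u) !)
placements-degree {c} zero    cl = ≡.sym (∏.sum-replicate-zero c)
placements-degree {c} (suc m) cl with cl fzero
... | nothing = ≡.trans (ℕₚ.*-identityˡ _) (placements-degree m (cl ∘ fsuc))
... | just w  = begin
  D w *ℕ placements m (cl ∘ fsuc) (removePlace (just w) D)
    ≡⟨ ≡.cong (D w *ℕ_) (≡.trans (placements-cong m (cl ∘ fsuc) removed) (placements-degree m (cl ∘ fsuc))) ⟩
  D w *ℕ ∏.sum (λ u → D′ u !)
    ≡⟨ ∏-scale w (λ u → D u !) (λ u → D′ u !) {D w} (≡.trans (≡.cong _! D-w) (≡.cong (_*ℕ D′ w !) (≡.sym D-w)))
         (λ u u≢w → ≡.cong _! (D-≢ u u≢w)) ⟨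
  ∏.sum (λ u → D u !) ∎
  where
  open ≡.≡-Reasoning
  D D′ : Fin c → ℕ
  D′ u = degree (cl ∘ fsuc) (toℕ u)
  D u = if toℕ w ≡ᵇ toℕ u then suc (D′ u) else D′ u
  D-w : D w ≡ suc (D′ w)
  D-w rewrite ≡ᵇ-refl (toℕ w) = ≡.refl
  D-≢ : ∀ u → u ≢ w → D u ≡ D′ u
  D-≢ u u≢w rewrite ≢⇒≡ᵇ-false (toℕ w) (toℕ u) (u≢w ∘ ≡.sym ∘ toℕ-injective) = ≡.refl
  removed : removePlace (just w) D ≗ D′
  removed u rewrite ≡ᵇ-sym (toℕ w) (toℕ u) with toℕ u ≡ᵇ toℕ w
  ... | true  = ≡.refl
  ... | false = ≡.refl

belowᵇ : ℕ → Maybe (Fin c) → Bool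
belowᵇ k nothing  = true
belowᵇ k (just u) = toℕ u <ᵇ k

increasing : (Fin n → Maybe (Fin c)) → Bool
increasing par = allᶠ (λ v → belowᵇ (toℕ v) (par v))

rootCount : (Fin n → Maybe A) → ℕ
rootCount par = count (is-nothing ∘ par)

module ForestValidity {c ℓ} (R : CommutativeRing c ℓ) (φ : ℕ → CommutativeRing.Carrier R)
  (n : ℕ) (par : Fin n → Maybe (Fin n)) (pos : Fin n → Fin n) where
  open Lah.Forest R φ n par pos

  available : Fin n → Fin n → Bool
  available u x = toℕ x <ᵇ degree par (toℕ u)

  isChild≡ : ∀ u v → isChild u v ≡ isChildOf (toℕ u) (par v)
  isChild≡ u v with par v
  ... | nothing = ≡.refl
  ... | just w  = ≡.refl

  deg≡ : ∀ u → deg u ≡ degree par (toℕ u)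
  deg≡ u = ≡.trans (countB-tabulate (isChild u) id) (count-cong (isChild≡ u))

  isRoot≡ : ∀ v → isRoot v ≡ is-nothing (par v)
  isRoot≡ v with par v
  ... | nothing = ≡.refl
  ... | just w  = ≡.refl

  roots≡ : roots ≡ rootCount par
  roots≡ = ≡.trans (countB-tabulate isRoot id) (count-cong isRoot≡)

  vertexOK≡ : ∀ v → vertexOK v ≡ belowᵇ (toℕ v) (par v) ∧ okAt (par v) available (pos v)
  vertexOK≡ v with par v
  ... | nothing = ≡.refl
  ... | just u  = ≡.cong (λ d → (toℕ u <ᵇ toℕ v) ∧ (toℕ (pos v) <ᵇ d)) (deg≡ u)

  T-pairOK : ∀ v w → T (pairOK v w) ⇔ (v ≢ w → ¬ Clash (par v) (par w) (pos v) (pos w))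
  T-pairOK v w with par v | par w
  ... | nothing | _       = mk⇔ (λ { _ _ (_ , () , _) }) (λ _ → tt)
  ... | just u  | nothing = mk⇔ (λ { _ _ (_ , _ , () , _) }) (λ _ → tt)
  ... | just u  | just u′ with toℕ u ≡ᵇ toℕ u′ in eqU | toℕ v ≡ᵇ toℕ w in eqV
  ... | false | _     = mk⇔ (λ { _ _ (_ , ≡.refl , ≡.refl , _) → ≡.subst T eqU (ℕₚ.≡⇒≡ᵇ (toℕ u) _ ≡.refl) }) (λ _ → tt)
  ... | true  | true  = mk⇔ (λ _ v≢w → contradiction (toℕ-injective (ℕₚ.≡ᵇ⇒≡ (toℕ v) _ (≡.subst T (≡.sym eqV) tt))) v≢w)
                            (λ _ → tt)
  ... | true  | false = mk⇔
    (λ h _ → λ { (_ , _ , _ , e) → T-not⁻ h (ℕₚ.≡⇒≡ᵇ (toℕ (pos v)) _ (≡.cong toℕ e)) })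
    (λ h → T-not⁺ (λ e → h (λ v≡w → ≡.subst T eqV (ℕₚ.≡⇒≡ᵇ (toℕ v) _ (≡.cong toℕ v≡w)))
      (u , ≡.refl , ≡.cong just (≡.sym (toℕ-injective (ℕₚ.≡ᵇ⇒≡ (toℕ u) _ (≡.subst T (≡.sym eqU) tt)))) ,
       toℕ-injective (ℕₚ.≡ᵇ⇒≡ (toℕ (pos v)) _ e))))

  T-allB : ∀ {p : Fin n → Bool} → T (allB p (allFin n)) ⇔ (∀ i → T (p i))
  T-allB {p} = ≡.subst (λ b → T b ⇔ (∀ i → T (p i))) (≡.sym (allB-tabulate p id)) T-allᶠ

  -- Separates a condition on the parents alone from one on the positions, so that for fixed parents
  -- the positions can be summed out.
  valid≡ : valid ≡ increasing par ∧ placeable n par available pos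
  valid≡ = T-injective to from
    where
    to : T valid → T (increasing par ∧ placeable n par available pos)
    to h = Equivalence.from T-∧
      ( Equivalence.from T-allᶠ (λ v → proj₁ (vertex v))
      , Equivalence.from (T-placeable n par available pos)
          ( (λ v → proj₂ (vertex v))
          , (λ v w → Equivalence.to (T-pairOK v w) (Equivalence.to T-allB (Equivalence.to T-allB (proj₂ both) v) w))))
      where
      both = Equivalence.to (T-∧ {allB vertexOK (allFin n)}) h
      vertex : ∀ v → T (belowᵇ (toℕ v) (par v)) × T (okAt (par v) available (pos v))
      vertex v = Equivalence.to T-∧ (≡.subst T (vertexOK≡ v) (Equivalence.to T-allB (proj₁ both) v))
    from : T (increasing par ∧ placeable n par available pos) → T valid
    from h = Equivalence.from T-∧
      ( Equivalence.from T-allB (λ v → ≡.subst T (≡.sym (vertexOK≡ v))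
          (Equivalence.from T-∧ (Equivalence.to T-allᶠ (proj₁ both) v , proj₁ placed v)))
      , Equivalence.from T-allB (λ v → Equivalence.from T-allB (λ w →
          Equivalence.from (T-pairOK v w) (proj₂ placed v w))))
      where
      both = Equivalence.to (T-∧ {increasing par}) h
      placed = Equivalence.to (T-placeable n par available pos) (proj₂ both)

-- Sums over parent functions and position functions

∷ᶠ-cong : ∀ (x : A) {f g : Fin n → A} → f ≗ g → (x ∷ᶠ f) ≗ (x ∷ᶠ g)
∷ᶠ-cong x e fzero    = ≡.refl
∷ᶠ-cong x e (fsuc i) = e i

nC0≡1 : ∀ n → n C 0 ≡ 1
nC0≡1 n = ≡.trans (nCk≡nC[n∸k] {0} {n} z≤n) (nCn≡1 n)

-- The effect on parents of deleting vertex 0: its children become roots and the other labels drop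
-- by one.
collapse : Maybe (Fin (suc n)) → Maybe (Fin n)
collapse nothing         = nothing
collapse (just fzero)    = nothing
collapse (just (fsuc u)) = just u

collapse-∷ᶠ : ∀ x (g : Fin m → Maybe (Fin (suc n))) → collapse ∘ (x ∷ᶠ g) ≗ (collapse x ∷ᶠ (collapse ∘ g))
collapse-∷ᶠ x g fzero    = ≡.refl
collapse-∷ᶠ x g (fsuc i) = ≡.refl

module ListSums {c ℓ} (R : CommutativeRing c ℓ) where
  open CommutativeRing R hiding (zero)
  open Determinant R using (sum; sum-suc; sum-zero; sum-+; +-interchange)
  open import Algebra.Properties.Semiring.Mult semiring using (×-congʳ; ×-congˡ; ×-assocˡ; ×-homo-+; ×-homo-1)
    renaming (_×_ to _·_)
  open import Relation.Binary.Reasoning.Setoid setoid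

  total : List Carrier → Carrier
  total = foldr _+_ 0#

  Σᴸ : List A → (A → Carrier) → Carrier
  Σᴸ xs f = total (map f xs)

  Σᴸ-cong : ∀ (xs : List A) {f g} → (∀ x → f x ≈ g x) → Σᴸ xs f ≈ Σᴸ xs g
  Σᴸ-cong []       e = refl
  Σᴸ-cong (x ∷ xs) e = +-cong (e x) (Σᴸ-cong xs e)

  Σᴸ-zero : ∀ (xs : List A) {f} → (∀ x → f x ≈ 0#) → Σᴸ xs f ≈ 0#
  Σᴸ-zero []       e = refl
  Σᴸ-zero (x ∷ xs) e = trans (+-cong (e x) (Σᴸ-zero xs e)) (+-identityʳ 0#)

  Σᴸ-map : ∀ (h : A → B) xs (f : B → Carrier) → Σᴸ (map h xs) f ≡ Σᴸ xs (f ∘ h)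
  Σᴸ-map h xs f = ≡.cong total (≡.sym (map-∘ xs))

  Σᴸ-*ʳ : ∀ (xs : List A) f a → Σᴸ xs (λ x → f x * a) ≈ Σᴸ xs f * a
  Σᴸ-*ʳ []       f a = sym (zeroˡ a)
  Σᴸ-*ʳ (x ∷ xs) f a = trans (+-congˡ (Σᴸ-*ʳ xs f a)) (sym (distribʳ a _ _))

  Σᴸ-sum : ∀ (xs : List A) n (f : A → ℕ → Carrier) →
           Σᴸ xs (λ x → sum n (f x)) ≈ sum n (λ j → Σᴸ xs (λ x → f x j))
  Σᴸ-sum []       n f = sym (sum-zero n (λ _ _ → refl))
  Σᴸ-sum (x ∷ xs) n f = trans (+-congˡ (Σᴸ-sum xs n f)) (sym (sum-+ n (f x) _))

  total-++ : ∀ xs ys → total (xs ++ ys) ≈ total xs + total ys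
  total-++ []       ys = sym (+-identityˡ _)
  total-++ (x ∷ xs) ys = trans (+-congˡ (total-++ xs ys)) (sym (+-assoc _ _ _))

  total-concatMap : ∀ (f : A → List Carrier) xs → total (concatMap f xs) ≈ Σᴸ xs (total ∘ f)
  total-concatMap f []       = refl
  total-concatMap f (x ∷ xs) = trans (total-++ (f x) _) (+-congˡ (total-concatMap f xs))

  Σᴸ-concatMap : ∀ (h : A → List B) xs (f : B → Carrier) → Σᴸ (concatMap h xs) f ≈ Σᴸ xs (λ x → Σᴸ (h x) f)
  Σᴸ-concatMap h []       f = refl
  Σᴸ-concatMap h (x ∷ xs) f = trans
    (trans (reflexive (≡.cong total (map-++ f (h x) _))) (total-++ (map f (h x)) _))
    (+-congˡ (Σᴸ-concatMap h xs f))

  -- The functions listed by `allFuns` agree with `x ∷ᶠ f` only pointwise, so a summand has to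
  -- respect pointwise equality.
  Extensional : ((Fin n → A) → Carrier) → Set _
  Extensional F = ∀ {f g} → f ≗ g → F f ≈ F g

  Σᴸ-allFuns : ∀ n (xs : List A) (F : (Fin (suc n) → A) → Carrier) → Extensional F →
    Σᴸ (allFuns (suc n) xs) F ≈ Σᴸ xs (λ x → Σᴸ (allFuns n xs) (λ f → F (x ∷ᶠ f)))
  Σᴸ-allFuns n xs F ext = trans (Σᴸ-concatMap _ xs F) (Σᴸ-cong xs (λ x →
    trans (reflexive (Σᴸ-map _ (allFuns n xs) F)) (Σᴸ-cong (allFuns n xs) (λ f →
      ext (λ { fzero → ≡.refl ; (fsuc i) → ≡.refl })))))

  [_]_ : Bool → Carrier → Carrier
  [ b ] x = if b then x else 0#

  []-cong : ∀ b {x y} → x ≈ y → [ b ] x ≈ [ b ] y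
  []-cong true  e = e
  []-cong false e = refl

  []-cong₂ : ∀ {b b′ x y} → b ≡ b′ → x ≈ y → [ b ] x ≈ [ b′ ] y
  []-cong₂ {b} ≡.refl = []-cong b

  []-∧ : ∀ b b′ x → [ b ∧ b′ ] x ≈ [ b ] ([ b′ ] x)
  []-∧ true  b′ x = refl
  []-∧ false b′ x = refl

  []-zero : ∀ b → [ b ] 0# ≈ 0#
  []-zero true  = refl
  []-zero false = refl

  Σᴸ-[] : ∀ (xs : List A) b f → Σᴸ xs (λ x → [ b ] f x) ≈ [ b ] Σᴸ xs f
  Σᴸ-[] xs true  f = refl
  Σᴸ-[] xs false f = Σᴸ-zero xs (λ _ → refl)

  Σᴸ-indicator : ∀ (g : Fin n → A) (p : A → Bool) z → Σᴸ (tabulate g) (λ x → [ p x ] z) ≈ count (p ∘ g) · z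
  Σᴸ-indicator {zero}  g p z = refl
  Σᴸ-indicator {suc n} g p z with p (g fzero)
  ... | true  = +-congˡ (Σᴸ-indicator (g ∘ fsuc) p z)
  ... | false = trans (+-identityˡ _) (Σᴸ-indicator (g ∘ fsuc) p z)

  sum-pick : ∀ n i x (f : ℕ → Carrier) → i < n → sum n (λ j → ([ i ≡ᵇ j ] x) * f j) ≈ x * f i
  sum-pick (suc n) zero    x f i<n = trans (sum-suc n _)
    (trans (+-congˡ (sum-zero n (λ _ _ → zeroˡ _))) (+-identityʳ _))
  sum-pick (suc n) (suc i) x f (s≤s i<n) = trans (sum-suc n _)
    (trans (+-congʳ (zeroˡ _)) (trans (+-identityˡ _) (sum-pick n i x (f ∘ suc) i<n)))

  prod : ∀ n → (Fin n → Carrier) → Carrier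
  prod zero    f = 1#
  prod (suc n) f = f fzero * prod n (f ∘ fsuc)

  prod-cong : ∀ n {f g : Fin n → Carrier} → (∀ i → f i ≈ g i) → prod n f ≈ prod n g
  prod-cong zero    e = refl
  prod-cong (suc n) e = *-cong (e fzero) (prod-cong n (e ∘ fsuc))

  -- Σ of h (j ∸ |S|) |S| over all subsets S of a j-element set.
  subsetSum : ℕ → (ℕ → ℕ → Carrier) → Carrier
  subsetSum zero    h = h 0 0
  subsetSum (suc j) h = subsetSum j (λ a b → h (suc a) b) + subsetSum j (λ a b → h a (suc b))

  subsetSum-cong : ∀ j {h h′} → (∀ a b → h a b ≈ h′ a b) → subsetSum j h ≈ subsetSum j h′
  subsetSum-cong zero    e = e 0 0
  subsetSum-cong (suc j) e = +-cong (subsetSum-cong j (λ a b → e (suc a) b)) (subsetSum-cong j (λ a b → e a (suc b)))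

  subsetSum-zero : ∀ j {h} → (∀ a b → h a b ≈ 0#) → subsetSum j h ≈ 0#
  subsetSum-zero zero    e = e 0 0
  subsetSum-zero (suc j) e = trans (+-cong (subsetSum-zero j (λ a b → e (suc a) b)) (subsetSum-zero j (λ a b → e a (suc b))))
    (+-identityʳ 0#)

  subsetSum-*ʳ : ∀ j h a → subsetSum j (λ x y → h x y * a) ≈ subsetSum j h * a
  subsetSum-*ʳ zero    h a = refl
  subsetSum-*ʳ (suc j) h a = trans (+-cong (subsetSum-*ʳ j _ a) (subsetSum-*ʳ j _ a)) (sym (distribʳ a _ _))

  -- Only subsets whose complement has k elements survive; there are C(j,k) of them, each of size j
  -- - k. The two branches of `subsetSum` give Pascal's rule.
  subsetSum-choose : ∀ j k (f : ℕ → Carrier) → subsetSum j (λ a b → [ a ≡ᵇ k ] f b) ≈ (j C k) · f (j ∸ k)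
  subsetSum-choose zero    zero    f = sym (×-homo-1 _)
  subsetSum-choose zero    (suc k) f = refl
  subsetSum-choose (suc j) zero    f = begin
    subsetSum j (λ a b → 0#) + subsetSum j (λ a b → [ a ≡ᵇ 0 ] f (suc b))
      ≈⟨ +-cong (subsetSum-zero j (λ _ _ → refl)) (subsetSum-choose j 0 (f ∘ suc)) ⟩
    0# + (j C 0) · f (suc j)
      ≈⟨ trans (+-identityˡ _) (×-congˡ {f (suc j)} (≡.trans (nC0≡1 j) (≡.sym (nC0≡1 (suc j))))) ⟩
    (suc j C 0) · f (suc j) ∎
  subsetSum-choose (suc j) (suc k) f = begin
    subsetSum j (λ a b → [ a ≡ᵇ k ] f b) + subsetSum j (λ a b → [ a ≡ᵇ suc k ] f (suc b))
      ≈⟨ +-cong (subsetSum-choose j k f) (subsetSum-choose j (suc k) (f ∘ suc)) ⟩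
    (j C k) · f (j ∸ k) + (j C suc k) · f (suc (j ∸ suc k))
      ≈⟨ +-congˡ shift ⟩
    (j C k) · f (j ∸ k) + (j C suc k) · f (j ∸ k)
      ≈⟨ ×-homo-+ (f (j ∸ k)) (j C k) (j C suc k) ⟨
    ((j C k) +ℕ (j C suc k)) · f (j ∸ k)
      ≈⟨ ×-congˡ {f (j ∸ k)} (nCk+nC[k+1]≡[n+1]C[k+1] j k) ⟩
    (suc j C suc k) · f (j ∸ k) ∎
    where
    -- For k ≥ j the truncated differences disagree, but then C(j, k+1) is zero.
    shift : (j C suc k) · f (suc (j ∸ suc k)) ≈ (j C suc k) · f (j ∸ k)
    shift with suc k ℕₚ.≤? j
    ... | yes k<j = ×-congʳ (j C suc k) (reflexive (≡.cong f (≡.sym (ℕₚ.+-∸-assoc 1 k<j))))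
    ... | no  k≮j = trans (×-congˡ {f (suc (j ∸ suc k))} {_} {0} (k>n⇒nCk≡0 (ℕₚ.≰⇒> k≮j)))
                          (sym (×-congˡ {f (j ∸ k)} {_} {0} (k>n⇒nCk≡0 (ℕₚ.≰⇒> k≮j))))

  -- Deleting vertex 0: the fibre of collapse over p consists of the choices of
  -- the roots of p that are children of vertex 0.
  Σᴸ-collapse : ∀ m (zs : List (Fin n)) (H : (Fin m → Maybe (Fin n)) → ℕ → ℕ → Carrier) →
    (∀ {p q} a b → p ≗ q → H p a b ≈ H q a b) →
    Σᴸ (allFuns m (nothing ∷ just fzero ∷ map (just ∘ fsuc) zs))
       (λ g → H (collapse ∘ g) (rootCount g) (degree g 0)) ≈
    Σᴸ (allFuns m (nothing ∷ map just zs)) (λ p → subsetSum (rootCount p) (H p))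
  Σᴸ-collapse zero zs H ext = +-congʳ (ext 0 0 (λ ()))
  Σᴸ-collapse {n} (suc m) zs H ext = begin
    Σᴸ (allFuns (suc m) xs) G
      ≈⟨ Σᴸ-allFuns m xs G G-ext ⟩
    Σᴸ (allFuns m xs) (G ∘ (nothing ∷ᶠ_)) +
      (Σᴸ (allFuns m xs) (G ∘ (just fzero ∷ᶠ_)) +
       Σᴸ (map (just ∘ fsuc) zs) (λ x → Σᴸ (allFuns m xs) (G ∘ (x ∷ᶠ_))))
      -- A vertex that stays a root and a new child of vertex 0 both collapse to `nothing` but raise
      -- different counters; together they form the two branches of `subsetSum` at that root.
      ≈⟨ +-cong (by nothing (λ p a b → H p (suc a) b) (λ a b → ext (suc a) b) (λ g → refl))
           (+-cong (by (just fzero) (λ p a b → H p a (suc b)) (λ a b → ext a (suc b)) (λ g → refl))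
             (trans (reflexive (Σᴸ-map (just ∘ fsuc) zs _))
               (Σᴸ-cong zs (λ z → by (just (fsuc z)) H ext (λ g → refl))))) ⟩
    Σᴸ (allFuns m ys) (λ p → subsetSum (rootCount p) (λ a b → H (nothing ∷ᶠ p) (suc a) b)) +
      (Σᴸ (allFuns m ys) (λ p → subsetSum (rootCount p) (λ a b → H (nothing ∷ᶠ p) a (suc b))) +
       Σᴸ zs (λ z → Σᴸ (allFuns m ys) (λ p → subsetSum (rootCount p) (H (just z ∷ᶠ p)))))
      ≈⟨ +-assoc _ _ _ ⟨
    (Σᴸ (allFuns m ys) (λ p → subsetSum (rootCount p) (λ a b → H (nothing ∷ᶠ p) (suc a) b)) +
      Σᴸ (allFuns m ys) (λ p → subsetSum (rootCount p) (λ a b → H (nothing ∷ᶠ p) a (suc b)))) +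
       Σᴸ zs (λ z → Σᴸ (allFuns m ys) (λ p → subsetSum (rootCount p) (H (just z ∷ᶠ p))))
      ≈⟨ +-cong (Σᴸ-+ (allFuns m ys) _ _) (reflexive (Σᴸ-map just zs _)) ⟨
    Σᴸ (allFuns m ys) (λ p → F (nothing ∷ᶠ p)) +
      Σᴸ (map just zs) (λ x → Σᴸ (allFuns m ys) (λ p → F (x ∷ᶠ p)))
      ≈⟨ Σᴸ-allFuns m ys F F-ext ⟨
    Σᴸ (allFuns (suc m) ys) F ∎
    where
    xs : List (Maybe (Fin (suc n)))
    xs = nothing ∷ just fzero ∷ map (just ∘ fsuc) zs
    ys : List (Maybe (Fin n))
    ys = nothing ∷ map just zs
    G : (Fin (suc m) → Maybe (Fin (suc n))) → Carrier
    G g = H (collapse ∘ g) (rootCount g) (degree g 0)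
    F : (Fin (suc m) → Maybe (Fin n)) → Carrier
    F p = subsetSum (rootCount p) (H p)
    Σᴸ-+ : ∀ (xs : List A) f g → Σᴸ xs (λ x → f x + g x) ≈ Σᴸ xs f + Σᴸ xs g
    Σᴸ-+ []       f g = sym (+-identityˡ 0#)
    Σᴸ-+ (x ∷ xs) f g = trans (+-congˡ (Σᴸ-+ xs f g)) (+-interchange _ _ _ _)
    G-ext : Extensional G
    G-ext {f} {g} e = trans (ext _ _ (λ i → ≡.cong collapse (e i)))
      (reflexive (≡.cong₂ (H (collapse ∘ g)) (count-cong (λ i → ≡.cong is-nothing (e i)))
        (count-cong (λ i → ≡.cong (isChildOf 0) (e i)))))
    F-ext : Extensional F
    F-ext {p} {q} e = trans (reflexive (≡.cong (λ j → subsetSum j (H p)) (count-cong (λ i → ≡.cong is-nothing (e i)))))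
      (subsetSum-cong (rootCount q) (λ a b → ext a b e))
    by : ∀ x (H′ : (Fin (suc m) → Maybe (Fin n)) → ℕ → ℕ → Carrier) →
      (∀ {p q} a b → p ≗ q → H′ p a b ≈ H′ q a b) →
      (∀ g → H (collapse ∘ (x ∷ᶠ g)) (rootCount (x ∷ᶠ g)) (degree (x ∷ᶠ g) 0) ≈
             H′ (collapse ∘ (x ∷ᶠ g)) (rootCount g) (degree g 0)) →
      Σᴸ (allFuns m xs) (G ∘ (x ∷ᶠ_)) ≈
      Σᴸ (allFuns m ys) (λ p → subsetSum (rootCount p) (H′ (collapse x ∷ᶠ p)))
    by x H′ ext′ eq = trans
      (Σᴸ-cong (allFuns m xs) (λ g → trans (eq g) (ext′ _ _ (collapse-∷ᶠ x g))))
      (Σᴸ-collapse m zs (λ p → H′ (collapse x ∷ᶠ p)) (λ a b e → ext′ a b (∷ᶠ-cong (collapse x) e)))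

  placeable-cong : ∀ m (cl : Fin m → Maybe (Fin k)) av {pos pos′ : Fin m → Fin N} → pos ≗ pos′ →
                   placeable m cl av pos ≡ placeable m cl av pos′
  placeable-cong zero    cl av e = ≡.refl
  placeable-cong (suc m) cl av {pos} {pos′} e rewrite e fzero =
    ≡.cong (okAt (cl fzero) av (pos′ fzero) ∧_) (placeable-cong m (cl ∘ fsuc) _ (e ∘ fsuc))

  -- The vertices are placed one after another. By `count-occupy` every admissible place of the
  -- first vertex leaves the same number of continuations, so the counts multiply.
  Σᴸ-placeable : ∀ m (cl : Fin m → Maybe (Fin k)) (av : Fin k → Fin (suc N) → Bool) w →
    Σᴸ (allFuns m (allFin (suc N))) (λ pos → [ placeable m cl av pos ] w) ≈
    placements m cl (λ u → count (av u)) · w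
  Σᴸ-placeable zero cl av w = refl
  Σᴸ-placeable {N = N} (suc m) cl av w = begin
    Σᴸ (allFuns (suc m) (allFin (suc N))) (λ pos → [ placeable (suc m) cl av pos ] w)
      ≈⟨ Σᴸ-allFuns m (allFin (suc N)) _ (λ e → []-cong₂ (placeable-cong (suc m) cl av e) refl) ⟩
    Σᴸ (allFin (suc N)) (λ x → Σᴸ (allFuns m (allFin (suc N))) (λ pos →
      [ okAt (cl fzero) av x ∧ placeable m (cl ∘ fsuc) (occupy (cl fzero) x av) pos ] w))
      ≈⟨ Σᴸ-cong (allFin (suc N)) (λ x → trans
           (Σᴸ-cong (allFuns m (allFin (suc N))) (λ pos → []-∧ (okAt (cl fzero) av x) _ w))
           (trans (Σᴸ-[] (allFuns m (allFin (suc N))) (okAt (cl fzero) av x) _) (rest x))) ⟩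
    Σᴸ (allFin (suc N)) (λ x → [ okAt (cl fzero) av x ] (K · w))
      ≈⟨ Σᴸ-indicator id (okAt (cl fzero) av) (K · w) ⟩
    count (okAt (cl fzero) av) · (K · w)
      ≈⟨ ×-assocˡ w (count (okAt (cl fzero) av)) K ⟩
    (count (okAt (cl fzero) av) *ℕ K) · w
      ≈⟨ ×-congˡ {w} (≡.cong (_*ℕ K) (first (cl fzero))) ⟩
    placements (suc m) cl (λ u → count (av u)) · w ∎
    where
    K : ℕ
    K = placements m (cl ∘ fsuc) (removePlace (cl fzero) (λ u → count (av u)))
    rest : ∀ x → [ okAt (cl fzero) av x ]
        Σᴸ (allFuns m (allFin (suc N))) (λ pos → [ placeable m (cl ∘ fsuc) (occupy (cl fzero) x av) pos ] w) ≈
      [ okAt (cl fzero) av x ] (K · w)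
    rest x with okAt (cl fzero) av x in eq
    ... | false = refl
    ... | true  = trans (Σᴸ-placeable m (cl ∘ fsuc) (occupy (cl fzero) x av) w)
      (×-congˡ {w} (placements-cong m (cl ∘ fsuc) (count-occupy (cl fzero) x av (≡.subst T (≡.sym eq) tt))))
    first : ∀ k₀ → count (okAt k₀ av) ≡ choices k₀ (λ u → count (av u))
    -- A root has exactly one admissible place, place 0, which exists because the number of places
    -- is `suc N`.
    first nothing  = ≡.cong suc (count-false {N} _ (λ _ → ≡.refl))
    first (just u) = ≡.refl

-- The recurrence for the Lah polynomials by deletion of the smallest vertex

module LahRecurrence {c ℓ p} (R : CommutativeRing c ℓ) (K : Cone R p) (φ : ℕ → CommutativeRing.Carrier R) where
  open CommutativeRing R hiding (zero)
  open Determinant R using (sum; sum-zero; sum-cong)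
  open Scaling R K ∞ using (weightedToeplitz; ·-*-·)
  open TotalPositivity R K ∞ using (ordered)
  open ListSums R
  open Lah R φ
  open import Algebra.Properties.Semiring.Mult semiring using (×-congʳ; ×-congˡ; ×-assocˡ; ×-homo-1)
    renaming (_×_ to _·_)
  open import Relation.Binary.Reasoning.Setoid setoid

  ψ : ℕ → Carrier
  ψ d = (d !) · φ d

  treeWeight : (Fin n → Maybe (Fin n)) → Carrier
  treeWeight {n} par = prod n (λ v → ψ (degree par (toℕ v)))

  -- Forests without the order of the children, which ψ accounts for.
  forestTerm : ℕ → (Fin n → Maybe (Fin n)) → Carrier
  forestTerm k par = [ increasing par ∧ (rootCount par ≡ᵇ k) ] treeWeight par

  degree-cong : ∀ {par par′ : Fin n → Maybe (Fin m)} u → par ≗ par′ → degree par u ≡ degree par′ u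
  degree-cong u e = count-cong (λ v → ≡.cong (isChildOf u) (e v))

  rootCount-cong : ∀ {par par′ : Fin n → Maybe (Fin m)} → par ≗ par′ → rootCount par ≡ rootCount par′
  rootCount-cong e = count-cong (λ v → ≡.cong is-nothing (e v))

  increasing-cong : ∀ {par par′ : Fin n → Maybe (Fin m)} → par ≗ par′ → increasing par ≡ increasing par′
  increasing-cong e = allᶠ-cong (λ v → ≡.cong (belowᵇ (toℕ v)) (e v))

  treeWeight-cong : ∀ {par par′ : Fin n → Maybe (Fin n)} → par ≗ par′ → treeWeight par ≈ treeWeight par′
  treeWeight-cong {n} e = prod-cong n (λ v → reflexive (≡.cong ψ (degree-cong (toℕ v) e)))

  foldr-tabulate : ∀ n (g : Fin n → A) (d : A → ℕ) →
    ∏.sum {n} (λ v → d (g v) !) · foldr (λ v acc → φ (d v) * acc) 1# (tabulate g) ≈ prod n (λ v → ψ (d (g v)))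
  foldr-tabulate zero    g d = ×-homo-1 1#
  foldr-tabulate (suc n) g d = trans (sym (·-*-· (d (g fzero) !) _ _ _)) (*-congˡ (foldr-tabulate n (g ∘ fsuc) d))

  foldr-weight-cong : ∀ n (g : Fin n → A) (d d′ : A → ℕ) → (∀ v → d v ≡ d′ v) →
    foldr (λ v acc → φ (d v) * acc) 1# (tabulate g) ≈ foldr (λ v acc → φ (d′ v) * acc) 1# (tabulate g)
  foldr-weight-cong zero    g d d′ e = refl
  foldr-weight-cong (suc n) g d d′ e =
    *-cong (reflexive (≡.cong φ (e (g fzero)))) (foldr-weight-cong n (g ∘ fsuc) d d′ e)

  -- The weight depends on the parents only, and a given parent function admits ∏ (deg v)! position
  -- functions; these factorials are absorbed into ψ. The empty forest is separate because
  -- `Σᴸ-placeable` asks for at least one place.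
  L-forestTerm : ∀ n k → L n k ≈ Σᴸ (Pars n) (forestTerm k)
  L-forestTerm zero    zero    = refl
  L-forestTerm zero    (suc k) = refl
  L-forestTerm (suc n) k = trans (total-concatMap _ (Pars (suc n))) (Σᴸ-cong (Pars (suc n)) positions)
    where
    positions : ∀ par → Σᴸ (Poss (suc n)) (λ pos → let open Forest (suc n) par pos in [ valid ∧ (roots ≡ᵇ k) ] weight)
                ≈ forestTerm k par
    positions par = begin
      Σᴸ (Poss (suc n)) (λ pos → let open Forest (suc n) par pos in [ valid ∧ (roots ≡ᵇ k) ] weight)
        ≈⟨ Σᴸ-cong (Poss (suc n)) (λ pos → let open ForestValidity R φ (suc n) par pos using (valid≡; roots≡; deg≡) in
             trans ([]-cong₂ (reassoc (increasing par) (placeable (suc n) par avail pos) valid≡ (≡.cong (_≡ᵇ k) roots≡))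
                      (foldr-weight-cong (suc n) id _ (degree par ∘ toℕ) deg≡))
                   ([]-∧ good (placeable (suc n) par avail pos) w)) ⟩
      Σᴸ (Poss (suc n)) (λ pos → [ good ] ([ placeable (suc n) par avail pos ] w))
        ≈⟨ Σᴸ-[] (Poss (suc n)) good _ ⟩
      [ good ] Σᴸ (Poss (suc n)) (λ pos → [ placeable (suc n) par avail pos ] w)
        ≈⟨ []-cong good (trans (Σᴸ-placeable (suc n) par avail w) (trans
             -- Initially u offers as many free places as it has children; they fit among the n + 1
             -- positions because a degree never exceeds the number of vertices.
             (×-congˡ {w} (≡.trans (placements-cong (suc n) par (λ u → count-<ᵇ (degree par (toℕ u)) (count≤n (isChildOf (toℕ u) ∘ par))))
               (placements-degree (suc n) par)))
             (foldr-tabulate (suc n) id (degree par ∘ toℕ)))) ⟩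
      forestTerm k par ∎
      where
      good : Bool
      good = increasing par ∧ (rootCount par ≡ᵇ k)
      avail : Fin (suc n) → Fin (suc n) → Bool
      avail u x = toℕ x <ᵇ degree par (toℕ u)
      w : Carrier
      w = foldr (λ v acc → φ (degree par (toℕ v)) * acc) 1# (allFin (suc n))
      reassoc : ∀ i p {v r r′} → v ≡ i ∧ p → r ≡ r′ → v ∧ r ≡ (i ∧ r′) ∧ p
      reassoc i p {r′ = r′} ≡.refl ≡.refl = ≡.trans (∧-assoc i p r′)
        (≡.trans (≡.cong (i ∧_) (∧-comm p r′)) (≡.sym (∧-assoc i r′ p)))

  -- Here a counts the roots other than vertex 0 and b the children of vertex 0. Vertex 0 is itself
  -- a root, hence `suc a`.
  collapsedTerm : ℕ → (Fin n → Maybe (Fin n)) → ℕ → ℕ → Carrier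
  collapsedTerm k p a b = [ increasing p ∧ (suc a ≡ᵇ k) ] (ψ b * treeWeight p)

  forestTerm-∷ᶠ : ∀ k (g : Fin n → Maybe (Fin (suc n))) →
    forestTerm k (nothing ∷ᶠ g) ≈ collapsedTerm k (collapse ∘ g) (rootCount g) (degree g 0)
  forestTerm-∷ᶠ {n} k g = []-cong₂ (≡.cong (_∧ (suc (rootCount g) ≡ᵇ k)) (allᶠ-cong (λ v → below (toℕ v) (g v))))
    (*-congˡ (prod-cong n (λ v → reflexive (≡.cong ψ (count-cong (λ w → child (toℕ v) (g w)))))))
    where
    below : ∀ j (x : Maybe (Fin (suc n))) → belowᵇ (suc j) x ≡ belowᵇ j (collapse x)
    below j nothing         = ≡.refl
    below j (just fzero)    = ≡.refl
    below j (just (fsuc u)) = ≡.refl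
    child : ∀ u (x : Maybe (Fin (suc n))) → isChildOf (suc u) x ≡ isChildOf u (collapse x)
    child u nothing         = ≡.refl
    child u (just fzero)    = ≡.refl
    child u (just (fsuc w)) = ≡.refl

  L-collapse : ∀ n k → L (suc n) k ≈ Σᴸ (Pars n) (λ p → subsetSum (rootCount p) (collapsedTerm k p))
  L-collapse n k = begin
    L (suc n) k
      ≈⟨ L-forestTerm (suc n) k ⟩
    Σᴸ (Pars (suc n)) (forestTerm k)
      ≈⟨ Σᴸ-allFuns n xs (forestTerm k) (λ e → []-cong₂
           (≡.cong₂ (λ i r → i ∧ (r ≡ᵇ k)) (increasing-cong e) (rootCount-cong e)) (treeWeight-cong e)) ⟩
    Σᴸ (allFuns n xs) (λ g → forestTerm k (nothing ∷ᶠ g)) +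
      Σᴸ (map just (allFin (suc n))) (λ x → Σᴸ (allFuns n xs) (λ g → forestTerm k (x ∷ᶠ g)))
      -- Labels increase away from the root, so vertex 0 has no parent and each of these terms is
      -- zero by computation.
      ≈⟨ +-congˡ (trans (reflexive (Σᴸ-map just (allFin (suc n)) _))
           (Σᴸ-zero (allFin (suc n)) (λ u → Σᴸ-zero (allFuns n xs) (λ g → refl)))) ⟩
    Σᴸ (allFuns n xs) (λ g → forestTerm k (nothing ∷ᶠ g)) + 0#
      ≈⟨ trans (+-identityʳ _) (Σᴸ-cong (allFuns n xs) (forestTerm-∷ᶠ k)) ⟩
    Σᴸ (allFuns n xs) (λ g → collapsedTerm k (collapse ∘ g) (rootCount g) (degree g 0))
      ≡⟨ ≡.cong (λ zs → Σᴸ (allFuns n (nothing ∷ just fzero ∷ zs))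
           (λ g → collapsedTerm k (collapse ∘ g) (rootCount g) (degree g 0))) xs≡ ⟩
    Σᴸ (allFuns n (nothing ∷ just fzero ∷ map (just ∘ fsuc) (allFin n)))
       (λ g → collapsedTerm k (collapse ∘ g) (rootCount g) (degree g 0))
      ≈⟨ Σᴸ-collapse n (allFin n) (collapsedTerm k) (λ a b e → []-cong₂
           (≡.cong (_∧ (suc a ≡ᵇ k)) (increasing-cong e)) (*-congˡ (treeWeight-cong e))) ⟩
    Σᴸ (Pars n) (λ p → subsetSum (rootCount p) (collapsedTerm k p)) ∎
    where
    xs : List (Maybe (Fin (suc n)))
    xs = nothing ∷ map just (allFin (suc n))
    xs≡ : map just (tabulate {n = n} fsuc) ≡ map (just ∘ fsuc) (allFin n)
    xs≡ = ≡.trans (map-tabulate fsuc just) (≡.sym (map-tabulate id (just ∘ fsuc)))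

  -- The origin of M: out of j roots, k stay roots, and the other j - k become children of vertex 0,
  -- in any of (j - k)! orders, with weight φ of the new degree.
  choose-ψ : ∀ j k → (j C k) · ψ (j ∸ k) ≈ weightedToeplitz φ j k
  choose-ψ j k with k ℕₚ.≤? j
  ... | yes k≤j = trans (×-assocˡ _ (j C k) ((j ∸ k) !)) (×-congʳ (factorialRatio j k) (sym entry))
    where
    entry : ToeplitzMatrix ordered φ j k ≈ φ (j ∸ k)
    entry with k <ᵇ suc j in eq
    ... | true  = refl
    ... | false = contradiction (≡.subst T eq (ℕₚ.<⇒<ᵇ (s≤s k≤j))) id
  ... | no  k≰j = trans (×-congˡ {ψ (j ∸ k)} {_} {0} (k>n⇒nCk≡0 (ℕₚ.≰⇒> k≰j)))
    (sym (×-congˡ {ToeplitzMatrix ordered φ j k} {_} {0} (factorialRatio-vanishes (ℕₚ.≰⇒> k≰j))))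

  L₀₀ : L 0 0 ≈ 1#
  L₀₀ = +-identityʳ 1#

  L₀-suc : ∀ k → L 0 (suc k) ≈ 0#
  L₀-suc k = +-identityʳ 0#

  L-suc₀ : ∀ n → L (suc n) 0 ≈ 0#
  L-suc₀ n = trans (L-collapse n 0) (Σᴸ-zero (Pars n) (λ p → subsetSum-zero (rootCount p) (λ a b →
    trans ([]-∧ (increasing p) false _) ([]-zero (increasing p)))))

  L-suc : ∀ n k → L (suc n) (suc k) ≈ sum (suc n) (λ j → L n j * weightedToeplitz φ j k)
  L-suc n k = begin
    L (suc n) (suc k)
      ≈⟨ L-collapse n (suc k) ⟩
    Σᴸ (Pars n) (λ p → subsetSum (rootCount p) (collapsedTerm (suc k) p))
      ≈⟨ Σᴸ-cong (Pars n) perForest ⟩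
    Σᴸ (Pars n) (λ p → sum (suc n) (λ j → forestTerm j p * weightedToeplitz φ j k))
      ≈⟨ Σᴸ-sum (Pars n) (suc n) _ ⟩
    sum (suc n) (λ j → Σᴸ (Pars n) (λ p → forestTerm j p * weightedToeplitz φ j k))
      ≈⟨ sum-cong (suc n) (λ j _ → trans (Σᴸ-*ʳ (Pars n) (forestTerm j) _) (*-congʳ (sym (L-forestTerm n j)))) ⟩
    sum (suc n) (λ j → L n j * weightedToeplitz φ j k) ∎
    where
    inner : ∀ p → subsetSum (rootCount p) (λ a b → [ a ≡ᵇ k ] (ψ b * treeWeight p)) ≈
                  treeWeight p * weightedToeplitz φ (rootCount p) k
    inner p = begin
      subsetSum (rootCount p) (λ a b → [ a ≡ᵇ k ] (ψ b * treeWeight p))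
        ≈⟨ subsetSum-cong (rootCount p) (λ a b → []-*ʳ (a ≡ᵇ k) (ψ b) (treeWeight p)) ⟩
      subsetSum (rootCount p) (λ a b → ([ a ≡ᵇ k ] ψ b) * treeWeight p)
        ≈⟨ subsetSum-*ʳ (rootCount p) _ _ ⟩
      subsetSum (rootCount p) (λ a b → [ a ≡ᵇ k ] ψ b) * treeWeight p
        ≈⟨ trans (*-congʳ (trans (subsetSum-choose (rootCount p) k ψ) (choose-ψ (rootCount p) k))) (*-comm _ _) ⟩
      treeWeight p * weightedToeplitz φ (rootCount p) k ∎
      where
      []-*ʳ : ∀ b x y → [ b ] (x * y) ≈ ([ b ] x) * y
      []-*ʳ true  x y = refl
      []-*ʳ false x y = sym (zeroˡ y)
    perForest : ∀ p → subsetSum (rootCount p) (collapsedTerm (suc k) p) ≈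
                      sum (suc n) (λ j → forestTerm j p * weightedToeplitz φ j k)
    perForest p with increasing p
    ... | false = trans (subsetSum-zero (rootCount p) (λ _ _ → refl)) (sym (sum-zero (suc n) (λ _ _ → zeroˡ _)))
    -- A forest on n vertices has at most n roots, so the range j ≤ n of the sum contains its root
    -- count.
    ... | true  = trans (inner p) (sym (sum-pick (suc n) (rootCount p) _ _ (s≤s (count≤n (is-nothing ∘ p)))))

theorem1p1 : ∀ {c ℓ} (R : POCommRing c ℓ) (r : ℕ∞) → 1 ≤∞ r →
    (φ : ℕ → POCommRing.Carrier R) →
    ToeplitzTP (asOrdered R) r φ →
    TP (asOrdered R) r (Lah.LMatrix (POCommRing.commRing R) φ)
    × HankelTP (Poly.PolyOrdered R) r (Lah.Lpoly (POCommRing.commRing R) φ)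
    × HankelTP (asOrdered R) r (λ n → Lah.L (POCommRing.commRing R) φ (suc n) 1)
theorem1p1 R r 1≤r φ tp = TP-L , HankelTP-Lpoly , HankelTP-trees
  where
  open POCommRing R using (commRing)
  open LahRecurrence commRing (PolynomialRing.cone R) φ
  open LahPositivity.FromRecurrence R r 1≤r φ tp (Lah.L commRing φ) L₀₀ L₀-suc L-suc₀ L-suc
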